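{- One has $$6\sum_{n=-\infty}^{\infty} n\,q^{3\binom{n}{2}+2n}=(q ; q)_{\infty}^3 \left(q ; q^2\right)_{\infty}^2-(-q;q^3)_\infty\,(-q^2;q^3)_\infty\,(q^3; q^3)_{\infty}.$$
   Context: $q$ is a complex number with $0<|q|<1$. For $|p|<1$, $(a;p)_\infty=\prod_{j=0}^{\infty}(1-ap^j)$. For every integer $n$ (including negative ones), $\binom{n}{2}=n(n-1)/2$. -}

module Defs where

open import Algebra.Bundles.Raw using (RawSemiring)
import Algebra.Definitions.RawSemiring as RawSemiringDefs
open import Data.Integer as ℤ using (ℤ; +_; -[1+_]; 0ℤ; 1ℤ)
import Data.Integer.DivMod as ℤ
import Data.Integer.Properties as ℤ
open import Data.Nat as ℕ using (ℕ; zero; suc)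
import Data.Nat.DivMod as ℕ
import Data.Nat.Properties as ℕ
import Data.Nat.Tactic.RingSolver as ℕ-Ring
open import Data.Product using (∃; _×_; _,_; proj₁; proj₂)
open import Data.Rational as ℚ using (ℚ; 0ℚ; 1ℚ; ½)
import Data.Rational.Properties as ℚ
import Data.Rational.Solver as ℚ-Solver
open import Level using (0ℓ)
open import Relation.Binary.PropositionalEquality
  using (_≡_; refl; sym; trans; cong; cong₂; subst; subst₂)

-- The modulus of convergence in the second field of ℝ is ignored by _≃_ and _<_.

Cauchy : (ℕ → ℚ) → Set
Cauchy s = ∀ ε → 0ℚ ℚ.< ε →
  ∃ λ N → ∀ m n → N ℕ.≤ m → N ℕ.≤ n → ℚ.∣ s m ℚ.- s n ∣ ℚ.< ε

record ℝ : Set where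
  constructor mkℝ
  field
    approx : ℕ → ℚ
    cauchy : Cauchy approx

open ℝ public

infix 4 _≃_ _<_

_≃_ : ℝ → ℝ → Set
x ≃ y = ∀ ε → 0ℚ ℚ.< ε →
  ∃ λ N → ∀ n → N ℕ.≤ n → ℚ.∣ approx x n ℚ.- approx y n ∣ ℚ.< ε

_<_ : ℝ → ℝ → Set
x < y = ∃ λ δ → 0ℚ ℚ.< δ ×
  ∃ λ N → ∀ n → N ℕ.≤ n → approx x n ℚ.+ δ ℚ.≤ approx y n

private
  open ℚ-Solver.+-*-Solver

  half-pos : ∀ {ε} → 0ℚ ℚ.< ε → 0ℚ ℚ.< ε ℚ.* ½
  half-pos {ε} 0<ε =
    subst (ℚ._< ε ℚ.* ½) (ℚ.*-zeroˡ ½) (ℚ.*-monoˡ-<-pos ½ 0<ε)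

  half+half : ∀ ε → ε ℚ.* ½ ℚ.+ ε ℚ.* ½ ≡ ε
  half+half ε =
    trans (sym (ℚ.*-distribˡ-+ ε ½ ½)) (ℚ.*-identityʳ ε)

  const-cauchy : ∀ p → Cauchy (λ _ → p)
  const-cauchy p ε 0<ε = 0 , λ _ _ _ _ →
    subst (ℚ._< ε) (sym (cong ℚ.∣_∣ (ℚ.+-inverseʳ p))) 0<ε

  +-cauchy : ∀ {s t} → Cauchy s → Cauchy t → Cauchy (λ n → s n ℚ.+ t n)
  +-cauchy {s} {t} cs ct ε 0<ε
    with cs (ε ℚ.* ½) (half-pos 0<ε) | ct (ε ℚ.* ½) (half-pos 0<ε)
  ... | M , hM | N , hN = M ℕ.⊔ N , λ m n m≥ n≥ →
    let m≥M = ℕ.≤-trans (ℕ.m≤m⊔n M N) m≥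
        n≥M = ℕ.≤-trans (ℕ.m≤m⊔n M N) n≥
        m≥N = ℕ.≤-trans (ℕ.m≤n⊔m M N) m≥
        n≥N = ℕ.≤-trans (ℕ.m≤n⊔m M N) n≥
        open ℚ.≤-Reasoning
    in begin-strict
      ℚ.∣ (s m ℚ.+ t m) ℚ.- (s n ℚ.+ t n) ∣
        ≡⟨ cong ℚ.∣_∣ (solve 4 (λ a b c d →
             (a :+ b) :- (c :+ d) := (a :- c) :+ (b :- d)) refl
             (s m) (t m) (s n) (t n)) ⟩
      ℚ.∣ (s m ℚ.- s n) ℚ.+ (t m ℚ.- t n) ∣
        ≤⟨ ℚ.∣p+q∣≤∣p∣+∣q∣ (s m ℚ.- s n) (t m ℚ.- t n) ⟩
      ℚ.∣ s m ℚ.- s n ∣ ℚ.+ ℚ.∣ t m ℚ.- t n ∣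
        <⟨ ℚ.+-mono-< (hM m n m≥M n≥M) (hN m n m≥N n≥N) ⟩
      ε ℚ.* ½ ℚ.+ ε ℚ.* ½
        ≡⟨ half+half ε ⟩
      ε ∎

  neg-cauchy : ∀ {s} → Cauchy s → Cauchy (λ n → ℚ.- s n)
  neg-cauchy {s} cs ε 0<ε with cs ε 0<ε
  ... | N , hN = N , λ m n m≥ n≥ →
    subst (ℚ._< ε)
      (cong ℚ.∣_∣ (solve 2 (λ a b → b :- a := (:- a) :- (:- b)) refl (s m) (s n)))
      (hN n m n≥ m≥)

  0<1+ : ∀ {a} → 0ℚ ℚ.≤ a → 0ℚ ℚ.< 1ℚ ℚ.+ a
  0<1+ {a} 0≤a = ℚ.positive⁻¹ (1ℚ ℚ.+ a)
    {{ℚ.pos+nonNeg⇒pos 1ℚ a {{ℚ.nonNegative 0≤a}}}}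

  0≤+ : ∀ {a b} → 0ℚ ℚ.≤ a → 0ℚ ℚ.≤ b → 0ℚ ℚ.≤ a ℚ.+ b
  0≤+ {a} {b} 0≤a 0≤b = ℚ.nonNegative⁻¹ (a ℚ.+ b)
    {{ℚ.nonNeg+nonNeg⇒nonNeg a {{ℚ.nonNegative 0≤a}} b {{ℚ.nonNegative 0≤b}}}}

  eventually-bounded : ∀ {s} → Cauchy s →
    ∃ λ B → 0ℚ ℚ.≤ B × ∃ λ N → ∀ n → N ℕ.≤ n → ℚ.∣ s n ∣ ℚ.≤ B
  eventually-bounded {s} cs with cs 1ℚ (ℚ.positive⁻¹ 1ℚ)
  ... | N , hN = B , 0≤B , N , λ n n≥ →
    begin
      ℚ.∣ s n ∣
        ≡⟨ cong ℚ.∣_∣ (solve 2 (λ a b → a := (a :- b) :+ b) refl (s n) (s N)) ⟩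
      ℚ.∣ (s n ℚ.- s N) ℚ.+ s N ∣
        ≤⟨ ℚ.∣p+q∣≤∣p∣+∣q∣ (s n ℚ.- s N) (s N) ⟩
      ℚ.∣ s n ℚ.- s N ∣ ℚ.+ ℚ.∣ s N ∣
        ≤⟨ ℚ.+-monoˡ-≤ ℚ.∣ s N ∣ (ℚ.<⇒≤ (hN n N n≥ ℕ.≤-refl)) ⟩
      B ∎
    where
    open ℚ.≤-Reasoning
    B = 1ℚ ℚ.+ ℚ.∣ s N ∣
    0≤B : 0ℚ ℚ.≤ B
    0≤B = ℚ.<⇒≤ (0<1+ (ℚ.0≤∣p∣ (s N)))

  *-mono-≤ : ∀ {a b c d} → 0ℚ ℚ.≤ a → 0ℚ ℚ.≤ d →
    a ℚ.≤ b → c ℚ.≤ d → a ℚ.* c ℚ.≤ b ℚ.* d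
  *-mono-≤ {a} {b} {c} {d} 0≤a 0≤d a≤b c≤d = ℚ.≤-trans
    (ℚ.*-monoˡ-≤-nonNeg a {{ℚ.nonNegative 0≤a}} c≤d)
    (ℚ.*-monoʳ-≤-nonNeg d {{ℚ.nonNegative 0≤d}} a≤b)

  divide : ∀ {ε D} → 0ℚ ℚ.< ε → 0ℚ ℚ.< D → ∃ λ δ → 0ℚ ℚ.< δ × δ ℚ.* D ≡ ε
  divide {ε} {D} 0<ε 0<D = ε ℚ.* ℚ.1/ D , 0<δ , δD≡ε
    where
    instance
      D-pos : ℚ.Positive D
      D-pos = ℚ.positive 0<D
      D-nonZero : ℚ.NonZero D
      D-nonZero = ℚ.pos⇒nonZero D
      1/D-pos : ℚ.Positive (ℚ.1/ D)
      1/D-pos = ℚ.1/pos⇒pos D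

    0<δ : 0ℚ ℚ.< ε ℚ.* ℚ.1/ D
    0<δ = subst (ℚ._< ε ℚ.* ℚ.1/ D) (ℚ.*-zeroˡ (ℚ.1/ D))
            (ℚ.*-monoˡ-<-pos (ℚ.1/ D) 0<ε)

    δD≡ε : (ε ℚ.* ℚ.1/ D) ℚ.* D ≡ ε
    δD≡ε = trans (ℚ.*-assoc ε (ℚ.1/ D) D)
             (trans (cong (ε ℚ.*_) (ℚ.*-inverseˡ D)) (ℚ.*-identityʳ ε))

  A<1+A : ∀ A → A ℚ.< 1ℚ ℚ.+ A
  A<1+A A = subst (ℚ._< 1ℚ ℚ.+ A) (ℚ.+-identityˡ A)
    (ℚ.+-monoˡ-< A {0ℚ} {1ℚ} (ℚ.positive⁻¹ 1ℚ))

  shrink : ∀ {ε A} → 0ℚ ℚ.< ε → 0ℚ ℚ.≤ A → ∃ λ δ → 0ℚ ℚ.< δ × δ ℚ.* A ℚ.< ε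
  shrink {ε} {A} 0<ε 0≤A = go (divide 0<ε (0<1+ 0≤A))
    where
    go : (∃ λ δ → 0ℚ ℚ.< δ × δ ℚ.* (1ℚ ℚ.+ A) ≡ ε) →
         ∃ λ δ → 0ℚ ℚ.< δ × δ ℚ.* A ℚ.< ε
    go (δ , 0<δ , δD≡ε) = δ , 0<δ , subst (δ ℚ.* A ℚ.<_) δD≡ε
      (ℚ.*-monoʳ-<-pos δ {{ℚ.positive 0<δ}} {A} {1ℚ ℚ.+ A} (A<1+A A))

  EventuallyBounded : (ℕ → ℚ) → ℚ → Set
  EventuallyBounded s B = ∃ λ N → ∀ n → N ℕ.≤ n → ℚ.∣ s n ∣ ℚ.≤ B

  *-cauchy : ∀ {s t} → Cauchy s → Cauchy t → Cauchy (λ n → s n ℚ.* t n)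
  *-cauchy {s} {t} cs ct ε 0<ε = go (eventually-bounded cs) (eventually-bounded ct)
    where
    Goal : Set
    Goal = ∃ λ N → ∀ m n → N ℕ.≤ m → N ℕ.≤ n →
      ℚ.∣ s m ℚ.* t m ℚ.- s n ℚ.* t n ∣ ℚ.< ε

    module _ {B C K L P Q δ}
      (0≤C : 0ℚ ℚ.≤ C) (0<δ : 0ℚ ℚ.< δ) (δ[B+C]<ε : δ ℚ.* (B ℚ.+ C) ℚ.< ε)
      (hK : ∀ n → K ℕ.≤ n → ℚ.∣ s n ∣ ℚ.≤ B)
      (hL : ∀ n → L ℕ.≤ n → ℚ.∣ t n ∣ ℚ.≤ C)
      (hP : ∀ m n → P ℕ.≤ m → P ℕ.≤ n → ℚ.∣ s m ℚ.- s n ∣ ℚ.< δ)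
      (hQ : ∀ m n → Q ℕ.≤ m → Q ℕ.≤ n → ℚ.∣ t m ℚ.- t n ∣ ℚ.< δ)
      where
      N : ℕ
      N = (K ℕ.⊔ L) ℕ.⊔ (P ℕ.⊔ Q)

      K≤N : K ℕ.≤ N
      K≤N = ℕ.≤-trans (ℕ.m≤m⊔n K L) (ℕ.m≤m⊔n (K ℕ.⊔ L) (P ℕ.⊔ Q))
      L≤N : L ℕ.≤ N
      L≤N = ℕ.≤-trans (ℕ.m≤n⊔m K L) (ℕ.m≤m⊔n (K ℕ.⊔ L) (P ℕ.⊔ Q))
      P≤N : P ℕ.≤ N
      P≤N = ℕ.≤-trans (ℕ.m≤m⊔n P Q) (ℕ.m≤n⊔m (K ℕ.⊔ L) (P ℕ.⊔ Q))
      Q≤N : Q ℕ.≤ N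
      Q≤N = ℕ.≤-trans (ℕ.m≤n⊔m P Q) (ℕ.m≤n⊔m (K ℕ.⊔ L) (P ℕ.⊔ Q))

      bound : ∀ m n → N ℕ.≤ m → N ℕ.≤ n →
        ℚ.∣ s m ℚ.* t m ℚ.- s n ℚ.* t n ∣ ℚ.< ε
      bound m n m≥ n≥ = begin-strict
        ℚ.∣ s m ℚ.* t m ℚ.- s n ℚ.* t n ∣
          ≡⟨ cong ℚ.∣_∣ (solve 4 (λ a b c d →
               a :* b :- c :* d := a :* (b :- d) :+ (a :- c) :* d) refl
               (s m) (t m) (s n) (t n)) ⟩
        ℚ.∣ s m ℚ.* (t m ℚ.- t n) ℚ.+ (s m ℚ.- s n) ℚ.* t n ∣
          ≤⟨ ℚ.∣p+q∣≤∣p∣+∣q∣ (s m ℚ.* (t m ℚ.- t n)) ((s m ℚ.- s n) ℚ.* t n) ⟩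
        ℚ.∣ s m ℚ.* (t m ℚ.- t n) ∣ ℚ.+ ℚ.∣ (s m ℚ.- s n) ℚ.* t n ∣
          ≡⟨ cong₂ ℚ._+_ (ℚ.∣p*q∣≡∣p∣*∣q∣ (s m) (t m ℚ.- t n))
               (ℚ.∣p*q∣≡∣p∣*∣q∣ (s m ℚ.- s n) (t n)) ⟩
        ℚ.∣ s m ∣ ℚ.* ℚ.∣ t m ℚ.- t n ∣ ℚ.+ ℚ.∣ s m ℚ.- s n ∣ ℚ.* ℚ.∣ t n ∣
          ≤⟨ ℚ.+-mono-≤
               (*-mono-≤ (ℚ.0≤∣p∣ (s m)) (ℚ.<⇒≤ 0<δ)
                 (hK m (ℕ.≤-trans K≤N m≥))
                 (ℚ.<⇒≤ (hQ m n (ℕ.≤-trans Q≤N m≥) (ℕ.≤-trans Q≤N n≥))))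
               (*-mono-≤ (ℚ.0≤∣p∣ (s m ℚ.- s n)) 0≤C
                 (ℚ.<⇒≤ (hP m n (ℕ.≤-trans P≤N m≥) (ℕ.≤-trans P≤N n≥)))
                 (hL n (ℕ.≤-trans L≤N n≥))) ⟩
        B ℚ.* δ ℚ.+ δ ℚ.* C
          ≡⟨ trans (cong (ℚ._+ δ ℚ.* C) (ℚ.*-comm B δ))
               (sym (ℚ.*-distribˡ-+ δ B C)) ⟩
        δ ℚ.* (B ℚ.+ C)
          <⟨ δ[B+C]<ε ⟩
        ε ∎
        where open ℚ.≤-Reasoning

    go : (∃ λ B → 0ℚ ℚ.≤ B × EventuallyBounded s B) →
         (∃ λ C → 0ℚ ℚ.≤ C × EventuallyBounded t C) → Goal
    go (B , 0≤B , K , hK) (C , 0≤C , L , hL) = go′ (shrink 0<ε (0≤+ 0≤B 0≤C))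
      where
      go′ : (∃ λ δ → 0ℚ ℚ.< δ × δ ℚ.* (B ℚ.+ C) ℚ.< ε) → Goal
      go′ (δ , 0<δ , δ[B+C]<ε) =
        let P , hP = cs δ 0<δ
            Q , hQ = ct δ 0<δ
        in N {B} {C} {K} {L} {P} {Q} 0≤C 0<δ δ[B+C]<ε hK hL hP hQ
         , bound 0≤C 0<δ δ[B+C]<ε hK hL hP hQ

fromℚ : ℚ → ℝ
fromℚ p = mkℝ (λ _ → p) (const-cauchy p)

0ℝ 1ℝ : ℝ
0ℝ = fromℚ 0ℚ
1ℝ = fromℚ 1ℚ

infixl 6 _+ℝ_ _-ℝ_
infixl 7 _*ℝ_
infix  8 -ℝ_

_+ℝ_ _*ℝ_ : ℝ → ℝ → ℝ
x +ℝ y = mkℝ (λ n → approx x n ℚ.+ approx y n)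
  (+-cauchy {approx x} {approx y} (cauchy x) (cauchy y))
x *ℝ y = mkℝ (λ n → approx x n ℚ.* approx y n)
  (*-cauchy {approx x} {approx y} (cauchy x) (cauchy y))

-ℝ_ : ℝ → ℝ
-ℝ_ x = mkℝ (λ n → ℚ.- approx x n) (neg-cauchy {approx x} (cauchy x))

_-ℝ_ : ℝ → ℝ → ℝ
x -ℝ y = x +ℝ (-ℝ y)

infix 5 _+i_

record ℂ : Set where
  constructor _+i_
  field
    re im : ℝ

open ℂ public

infix 4 _≈_

_≈_ : ℂ → ℂ → Set
z ≈ w = re z ≃ re w × im z ≃ im w

infixl 6 _+_ _-_
infixl 7 _*_
infix  8 -_

_+_ _*_ : ℂ → ℂ → ℂ
z + w = (re z +ℝ re w) +i (im z +ℝ im w)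
z * w = (re z *ℝ re w -ℝ im z *ℝ im w) +i (re z *ℝ im w +ℝ im z *ℝ re w)

-_ : ℂ → ℂ
-_ z = (-ℝ re z) +i (-ℝ im z)

_-_ : ℂ → ℂ → ℂ
z - w = z + (- w)

fromℤ : ℤ → ℂ
fromℤ n = fromℚ (n ℚ./ 1) +i 0ℝ

0ℂ 1ℂ : ℂ
0ℂ = 0ℝ +i 0ℝ
1ℂ = 1ℝ +i 0ℝ

ℂ-rawSemiring : RawSemiring 0ℓ 0ℓ
ℂ-rawSemiring = record
  { Carrier = ℂ ; _≈_ = _≈_ ; _+_ = _+_ ; _*_ = _*_ ; 0# = 0ℂ ; 1# = 1ℂ }

open RawSemiringDefs ℂ-rawSemiring public using (_^_)

-- The modulus enters only through strict comparisons with numbers r ≥ 0,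
-- where |z| < r means (re z)² + (im z)² < r² and 0 < |z| means
-- 0 < (re z)² + (im z)²; no square root is needed.

∣_∣² : ℂ → ℝ
∣ z ∣² = re z *ℝ re z +ℝ im z *ℝ im z

infix 4 0<∣_∣ ∣_∣<_

0<∣_∣ : ℂ → Set
0<∣ z ∣ = 0ℝ < ∣ z ∣²

∣_∣<_ : ℂ → ℚ → Set
∣ z ∣< r = 0ℚ ℚ.≤ r × ∣ z ∣² < fromℚ (r ℚ.* r)

infix 4 _⟶_

_⟶_ : (ℕ → ℂ) → ℂ → Set
s ⟶ l = ∀ ε → 0ℚ ℚ.< ε → ∃ λ N → ∀ n → N ℕ.≤ n → ∣ s n - l ∣< ε

-- ∑< N f = f 0 + ⋯ + f (N - 1), and likewise for ∏<
∑< ∏< : ℕ → (ℕ → ℂ) → ℂ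
∑< zero    f = 0ℂ
∑< (suc N) f = ∑< N f + f N
∏< zero    f = 1ℂ
∏< (suc N) f = ∏< N f * f N

-- f (-M) + ⋯ + f (-1) + f 0 + ⋯ + f (N - 1)
∑-between : ℕ → ℕ → (ℤ → ℂ) → ℂ
∑-between M N f = ∑< M (λ k → f -[1+ k ]) + ∑< N (λ k → f (+ k))

-- The two ends of the summation range tend to infinity independently.
HasSumℤ : (ℤ → ℂ) → ℂ → Set
HasSumℤ f S = ∀ ε → 0ℚ ℚ.< ε →
  ∃ λ K → ∀ M N → K ℕ.≤ M → K ℕ.≤ N → ∣ ∑-between M N f - S ∣< ε

-- ⟨ a ⨾ p ⟩∞≔ P says that the product (a;p)_∞ converges to P.
infix 4 ⟨_⨾_⟩∞≔_

⟨_⨾_⟩∞≔_ : ℂ → ℂ → ℂ → Set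
⟨ a ⨾ p ⟩∞≔ P = (λ N → ∏< N (λ j → 1ℂ - a * p ^ j)) ⟶ P

choose2 : ℤ → ℤ
choose2 n = (n ℤ.* (n ℤ.- 1ℤ)) ℤ./ℕ 2

exponentℤ : ℤ → ℤ
exponentℤ n = + 3 ℤ.* choose2 n ℤ.+ + 2 ℤ.* n

exponent : ℤ → ℕ
exponent n = ℤ.∣ exponentℤ n ∣

private
  tri : ℕ → ℕ
  tri zero    = 0
  tri (suc k) = suc k ℕ.+ tri k

  tri-spec : ∀ k → suc k ℕ.* k ≡ tri k ℕ.* 2
  tri-spec zero    = refl
  tri-spec (suc k) = trans (lem k)
    (trans (cong (suc k ℕ.* 2 ℕ.+_) (tri-spec k))
      (sym (ℕ.*-distribʳ-+ 2 (suc k) (tri k))))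
    where
    lem : ∀ k → suc (suc k) ℕ.* suc k ≡ suc k ℕ.* 2 ℕ.+ suc k ℕ.* k
    lem = ℕ-Ring.solve-∀

  half-double : ∀ {m} t → m ≡ + (t ℕ.* 2) → m ℤ./ℕ 2 ≡ + t
  half-double t refl = cong +_ (ℕ.m*n/n≡m t 2)

  product-pos : ∀ k → + suc k ℤ.* (+ suc k ℤ.- 1ℤ) ≡ + (tri k ℕ.* 2)
  product-pos k = trans (sym (ℤ.pos-* (suc k) k)) (cong +_ (tri-spec k))

  product-neg : ∀ k → -[1+ k ] ℤ.* (-[1+ k ] ℤ.- 1ℤ) ≡ + (tri (suc k) ℕ.* 2)
  product-neg k = cong +_ (trans
    (cong (λ j → suc k ℕ.* suc (suc j)) (ℕ.+-identityʳ k))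
    (trans (ℕ.*-comm (suc k) (suc (suc k))) (tri-spec (suc k))))

  choose2-pos : ∀ k → choose2 (+ suc k) ≡ + tri k
  choose2-pos k = half-double (tri k) (product-pos k)

  choose2-neg : ∀ k → choose2 -[1+ k ] ≡ + tri (suc k)
  choose2-neg k = half-double (tri (suc k)) (product-neg k)

choose2-exact : ∀ n → choose2 n ℤ.* + 2 ≡ n ℤ.* (n ℤ.- 1ℤ)
choose2-exact (+ zero)  = refl
choose2-exact (+ suc k) = trans (cong (ℤ._* + 2) (choose2-pos k))
  (trans (sym (ℤ.pos-* (tri k) 2)) (sym (product-pos k)))
choose2-exact -[1+ k ]  = trans (cong (ℤ._* + 2) (choose2-neg k))
  (trans (sym (ℤ.pos-* (tri (suc k)) 2)) (sym (product-neg k)))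

-- Hence no negative power of q occurs in the series.
exponent-exact : ∀ n → + exponent n ≡ exponentℤ n
exponent-exact n = ℤ.0≤i⇒+∣i∣≡i (nonneg n)
  where
  nonneg : ∀ n → 0ℤ ℤ.≤ exponentℤ n
  nonneg (+ zero)  = ℤ.+≤+ ℕ.z≤n
  nonneg (+ suc k) = subst (λ c → 0ℤ ℤ.≤ + 3 ℤ.* c ℤ.+ + 2 ℤ.* + suc k)
    (sym (choose2-pos k))
    (subst (λ c → 0ℤ ℤ.≤ c ℤ.+ + 2 ℤ.* + suc k)
      (ℤ.pos-* 3 (tri k)) (ℤ.+≤+ ℕ.z≤n))
  nonneg -[1+ k ]  = subst (λ c → 0ℤ ℤ.≤ + 3 ℤ.* c ℤ.- + (2 ℕ.* suc k))
    (sym (choose2-neg k))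
    (subst (λ c → 0ℤ ℤ.≤ c ℤ.- + (2 ℕ.* suc k))
      (ℤ.pos-* 3 (tri (suc k)))
      (ℤ.i≤j⇒0≤j-i (ℤ.+≤+ (ℕ.*-mono-≤ {2} {3} (ℕ.n≤1+n 2)
        (ℕ.m≤m+n (suc k) (tri k))))))

{-# OPTIONS --safe #-}

-- By the triple product, C D E = ∑ q^(n(3n+1)/2), so the claim is ∑ (6n+1) q^(n(3n+1)/2) = A³ B².
-- Let P = (q²;q²)_∞ = ∑ (-1)ⁿ q^(3n²+n).  Jacobi's A³ = -∑ (-1)ⁱ i q^(i(i-1)/2), which is the
-- ε-coefficient of the triple product at z = 1 + ε, and B² P = ∑ (-1)ʲ q^(j²) give
--   -A³ B² P = ∑ (-1)^(i+j) (i + 2j) q^(i(i-1)/2 + j²),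
-- because ∑ (-1)ⁱ q^(i(i-1)/2) = 0.  Summing over l = i + 2j, the inner series over j is ±P times a
-- power of q when l ≢ 2 mod 3 and vanishes when l ≡ 2; this yields -P ∑ (6n+1) q^(n(3n+1)/2), and P
-- cancels.
--
-- All of this is carried out modulo x^N for formal x, where x is nilpotent and every series is finite.
-- If two polynomials agree modulo x^N and their coefficients satisfy ∑ ∣aₙ∣ rⁿ ≤ M, then their values
-- at ∣q∣ ≤ r² differ by at most 2 M r^N.  This estimate gives the convergence of the products and of
-- the series, and it carries the identity over to their limits.

module Submission where

open import Algebra.Bundles using (CommutativeRing)
open import Algebra.Bundles.Raw using (module RawSemiring)
import Algebra.Definitions.RawMonoid as RawMonoid
import Algebra.Definitions.RawSemiring as RawSemiringDefs
import Algebra.Properties.CommutativeSemiring.Exp as Exp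
open import Data.Empty using (⊥-elim)
open import Data.Integer as ℤ using (ℤ; +_; -[1+_])
import Data.Integer.Properties as ℤ
import Data.Integer.Tactic.RingSolver as ℤ-Ring
open import Data.List using (List; []; _∷_; map)
open import Data.Nat as ℕ using (ℕ; zero; suc)
import Data.Nat.Coprimality as Coprime
import Data.Nat.Properties as ℕ
import Data.Nat.Tactic.RingSolver as ℕ-Ring
open import Data.Product using (∃; ∃-syntax; _×_; _,_; proj₁; proj₂)
open import Data.Rational as ℚ using (ℚ; 0ℚ; 1ℚ; ½; mkℚ)
import Data.Rational.Properties as ℚ
import Data.Rational.Solver as ℚ-Solver
open import Data.Sum using (inj₁; inj₂)
open import Level using (0ℓ)
open import Relation.Binary.PropositionalEquality as ≡ using (_≡_)
open import Relation.Binary.Structures using (IsEquivalence)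
open import Relation.Nullary using (yes; no)

-- Commutative rings and finite sums

-- The residue classes mod 3 come from completing the square. For fixed `l`, the exponent
-- `i(i-1)/2 + j²` at `i = l - 2j` is `3j² - (2l-1)j + l(l-1)/2`, with vertex `(2l-1)/6`: this is
-- `m - 1/6`, `m + 1/6`, `m + 1/2` for `l = 3m`, `3m+1`, `3m+2`. The sign is `(-1)^(l-j)`. The first
-- two columns are translates of the series for P, one of them reflected; in the third, reflection
-- about a half-integer keeps the exponent and flips the sign. With x nilpotent, shifting,
-- interchanging, regrouping and cancelling P concern only finite sums and units. The price is paid
-- on the way to ℂ: evaluation at a number is not defined on classes modulo x^N, so it acts on
-- chosen representatives, whose coefficients must be bounded along the way. Reals are Cauchy
-- sequences with pointwise operations, so taking i-th approximations is exactly compatible with the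
-- ring operations, and all estimates take place in the Gaussian rationals. Of the two factors in
-- ∣q∣ ≤ r², one is absorbed by the weights of the coefficient bound and the other produces the
-- decay r^N.

module IntegerMultiples (K : CommutativeRing 0ℓ 0ℓ) where
  open CommutativeRing K
  open import Algebra.Properties.Ring ring
  open import Algebra.Properties.Semiring.Mult.TCOptimised semiring renaming (_×_ to infixl 8 _·_)
  open import Relation.Binary.Reasoning.Setoid setoid

  -- With the optimised multiple, `1 · 1#` is `1#` by definition, so `con (+ 1)` in a solver goal
  -- denotes `1#` itself.
  ι : ℤ → Carrier
  ι (+ n)    = n · 1#
  ι -[1+ n ] = - (suc n · 1#)

  private
    cancel : ∀ a x y → x - y ≈ (a + x) - (a + y)
    cancel a x y = sym (begin
      (a + x) - (a + y)      ≈⟨ +-cong (+-comm a x) (trans (-‿cong (+-comm a y)) (-‿anti-homo-+ y a)) ⟩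
      (x + a) + (- a - y)    ≈⟨ +-assoc x a _ ⟩
      x + (a + (- a - y))    ≈⟨ +-congˡ (+-assoc a (- a) (- y)) ⟨
      x + ((a - a) - y)      ≈⟨ +-congˡ (+-congʳ (-‿inverseʳ a)) ⟩
      x + (0# - y)           ≈⟨ +-congˡ (+-identityˡ (- y)) ⟩
      x - y                  ∎)

  ι-⊖ : ∀ m n → ι (m ℤ.⊖ n) ≈ m · 1# - n · 1#
  ι-⊖ m zero = begin
    m · 1#       ≈⟨ +-identityʳ _ ⟨
    m · 1# + 0#  ≈⟨ +-congˡ -0#≈0# ⟨
    m · 1# - 0#  ∎
  ι-⊖ zero    (suc n) = sym (+-identityˡ _)
  ι-⊖ (suc m) (suc n) = begin
    ι (suc m ℤ.⊖ suc n)                ≡⟨ ≡.cong ι (ℤ.[1+m]⊖[1+n]≡m⊖n m n) ⟩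
    ι (m ℤ.⊖ n)                        ≈⟨ ι-⊖ m n ⟩
    m · 1# - n · 1#                    ≈⟨ cancel 1# _ _ ⟩
    (1# + m · 1#) - (1# + n · 1#)      ≈⟨ +-cong (1+× m 1#) (-‿cong (1+× n 1#)) ⟨
    suc m · 1# - suc n · 1#            ∎

  ι-+ : ∀ i j → ι (i ℤ.+ j) ≈ ι i + ι j
  ι-+ (+ m)    (+ n)    = ×-homo-+ 1# m n
  ι-+ (+ m)    -[1+ n ] = ι-⊖ m (suc n)
  ι-+ -[1+ m ] (+ n)    = trans (ι-⊖ n (suc m)) (+-comm _ _)
  ι-+ -[1+ m ] -[1+ n ] = begin
    - (suc (suc (m ℕ.+ n)) · 1#)       ≡⟨ ≡.cong (λ k → - (k · 1#)) (ℕ.+-suc (suc m) n) ⟨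
    - ((suc m ℕ.+ suc n) · 1#)         ≈⟨ -‿cong (×-homo-+ 1# (suc m) (suc n)) ⟩
    - (suc m · 1# + suc n · 1#)        ≈⟨ -‿+-comm _ _ ⟨
    - (suc m · 1#) - (suc n · 1#)      ∎

  ι-neg : ∀ i → ι (ℤ.- i) ≈ - ι i
  ι-neg (+ zero)   = sym -0#≈0#
  ι-neg (+ suc n)  = refl
  ι-neg -[1+ n ]   = sym (-‿involutive _)

  private
    ι-neg-pos : ∀ m → ι (ℤ.- (+ m)) ≈ - (m · 1#)
    ι-neg-pos m = ι-neg (+ m)

  ι-* : ∀ i j → ι (i ℤ.* j) ≈ ι i * ι j
  ι-* (+ m) (+ n) = trans (reflexive (≡.cong ι (≡.sym (ℤ.pos-* m n)))) (×1-homo-* m n)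
  ι-* (+ m) -[1+ n ] = begin
    ι (+ m ℤ.* -[1+ n ])              ≡⟨ ≡.cong ι (ℤ.neg-distribʳ-* (+ m) (+ suc n)) ⟨
    ι (ℤ.- (+ m ℤ.* + suc n))         ≡⟨ ≡.cong (λ i → ι (ℤ.- i)) (ℤ.pos-* m (suc n)) ⟨
    ι (ℤ.- (+ (m ℕ.* suc n)))         ≈⟨ ι-neg-pos (m ℕ.* suc n) ⟩
    - ((m ℕ.* suc n) · 1#)            ≈⟨ -‿cong (×1-homo-* m (suc n)) ⟩
    - ((m · 1#) * (suc n · 1#))       ≈⟨ -‿distribʳ-* _ _ ⟩
    (m · 1#) * - (suc n · 1#)         ∎
  ι-* -[1+ m ] (+ n) = begin
    ι (-[1+ m ] ℤ.* + n)              ≡⟨ ≡.cong ι (ℤ.neg-distribˡ-* (+ suc m) (+ n)) ⟨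
    ι (ℤ.- (+ suc m ℤ.* + n))         ≡⟨ ≡.cong (λ i → ι (ℤ.- i)) (ℤ.pos-* (suc m) n) ⟨
    ι (ℤ.- (+ (suc m ℕ.* n)))         ≈⟨ ι-neg-pos (suc m ℕ.* n) ⟩
    - ((suc m ℕ.* n) · 1#)            ≈⟨ -‿cong (×1-homo-* (suc m) n) ⟩
    - ((suc m · 1#) * (n · 1#))       ≈⟨ -‿distribˡ-* _ _ ⟩
    - (suc m · 1#) * (n · 1#)         ∎
  ι-* -[1+ m ] -[1+ n ] = begin
    (suc m ℕ.* suc n) · 1#            ≈⟨ ×1-homo-* (suc m) (suc n) ⟩
    (suc m · 1#) * (suc n · 1#)       ≈⟨ -‿involutive _ ⟨
    - - ((suc m · 1#) * (suc n · 1#)) ≈⟨ -‿cong (-‿distribʳ-* _ _) ⟩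
    - ((suc m · 1#) * - (suc n · 1#)) ≈⟨ -‿distribˡ-* _ _ ⟩
    - (suc m · 1#) * - (suc n · 1#)   ∎

  ι-unique : (j : ℤ → Carrier) → j (+ 1) ≈ 1# → (∀ m n → j (m ℤ.+ n) ≈ j m + j n) →
    ∀ n → j n ≈ ι n
  ι-unique j j1 j+ = go
    where
    j0 : j (+ 0) ≈ 0#
    j0 = +-identityʳ-unique (j (+ 0)) (j (+ 0)) (sym (j+ (+ 0) (+ 0)))
    pos : ∀ n → j (+ n) ≈ n · 1#
    pos zero    = j0
    pos (suc n) = trans (j+ (+ 1) (+ n)) (trans (+-cong j1 (pos n)) (sym (1+× n 1#)))
    go : ∀ n → j n ≈ ι n
    go (+ n)    = pos n
    go -[1+ n ] = trans (+-inverseˡ-unique (j -[1+ n ]) (j (+ suc n))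
        (trans (sym (j+ -[1+ n ] (+ suc n)))
          (trans (reflexive (≡.cong j (ℤ.+-inverseˡ (+ suc n)))) j0)))
      (-‿cong (pos (suc n)))

  -- The coefficients are integers because their equality is decidable, while that of `K` need not
  -- be.
  module Solver where
    open import Algebra.Solver.Ring.AlmostCommutativeRing
    open import Data.Maybe.Base using (Maybe; just; nothing)
    open import Relation.Nullary.Decidable using (Dec; yes; no)

    private
      morphism : ℤ.+-*-rawRing -Raw-AlmostCommutative⟶ fromCommutativeRing K
      morphism = record
        { ⟦_⟧ = ι ; +-homo = ι-+ ; *-homo = ι-* ; -‿homo = ι-neg ; 0-homo = refl ; 1-homo = refl }

      weaken : ∀ {m n} → Dec (m ≡ n) → Maybe (ι m ≈ ι n)
      weaken (yes m≡n) = just (reflexive (≡.cong ι m≡n))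
      weaken (no _)    = nothing

    open import Algebra.Solver.Ring ℤ.+-*-rawRing (fromCommutativeRing K) morphism
      (λ m n → weaken (m ℤ.≟ n)) public

module Sums (K : CommutativeRing 0ℓ 0ℓ) where
  open CommutativeRing K hiding (zero)
  open IntegerMultiples K
  open import Relation.Binary.Reasoning.Setoid setoid

  ∑ ∏ : ℕ → (ℕ → Carrier) → Carrier
  ∑ zero    f = 0#
  ∑ (suc n) f = ∑ n f + f n
  ∏ zero    f = 1#
  ∏ (suc n) f = ∏ n f * f n

  ∑-cong< : ∀ n {f g} → (∀ i → i ℕ.< n → f i ≈ g i) → ∑ n f ≈ ∑ n g
  ∑-cong< zero    e = refl
  ∑-cong< (suc n) e = +-cong (∑-cong< n λ i i<n → e i (ℕ.m<n⇒m<1+n i<n)) (e n ℕ.≤-refl)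

  ∑-cong : ∀ n {f g} → (∀ i → f i ≈ g i) → ∑ n f ≈ ∑ n g
  ∑-cong n e = ∑-cong< n λ i _ → e i

  ∏-cong : ∀ n {f g} → (∀ i → f i ≈ g i) → ∏ n f ≈ ∏ n g
  ∏-cong zero    e = refl
  ∏-cong (suc n) e = *-cong (∏-cong n e) (e n)

  ∑-zero : ∀ n {f} → (∀ i → f i ≈ 0#) → ∑ n f ≈ 0#
  ∑-zero zero    e = refl
  ∑-zero (suc n) e = trans (+-cong (∑-zero n e) (e n)) (+-identityˡ 0#)

  ∑-+ : ∀ n f g → ∑ n (λ i → f i + g i) ≈ ∑ n f + ∑ n g
  ∑-+ zero    f g = sym (+-identityˡ 0#)
  ∑-+ (suc n) f g = trans (+-congʳ (∑-+ n f g))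
    (solve 4 (λ a b c d → (a :+ b) :+ (c :+ d) := (a :+ c) :+ (b :+ d)) refl _ _ _ _)
    where open Solver

  ∑-*ˡ : ∀ n c f → ∑ n (λ i → c * f i) ≈ c * ∑ n f
  ∑-*ˡ zero    c f = sym (zeroʳ c)
  ∑-*ˡ (suc n) c f = trans (+-congʳ (∑-*ˡ n c f)) (sym (distribˡ c _ _))

  ∑-head : ∀ n f → ∑ (suc n) f ≈ f 0 + ∑ n (λ i → f (suc i))
  ∑-head zero    f = +-comm 0# (f 0)
  ∑-head (suc n) f = trans (+-congʳ (∑-head n f)) (+-assoc _ _ _)

  ∑-swap : ∀ m n (f : ℕ → ℕ → Carrier) → ∑ m (λ i → ∑ n (f i)) ≈ ∑ n (λ j → ∑ m (λ i → f i j))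
  ∑-swap zero    n f = sym (∑-zero n λ _ → refl)
  ∑-swap (suc m) n f = trans (+-congʳ (∑-swap m n f)) (sym (∑-+ n _ _))

  ∑ℤ : ℕ → ℕ → (ℤ → Carrier) → Carrier
  ∑ℤ a b f = ∑ a (λ k → f -[1+ k ]) + ∑ b (λ k → f (+ k))

  ∑ℤ-cong : ∀ a b {f g} → (∀ n → f n ≈ g n) → ∑ℤ a b f ≈ ∑ℤ a b g
  ∑ℤ-cong a b e = +-cong (∑-cong a λ _ → e _) (∑-cong b λ _ → e _)

  ∑ℤ-zero : ∀ a b {f} → (∀ n → f n ≈ 0#) → ∑ℤ a b f ≈ 0#
  ∑ℤ-zero a b e = trans (+-cong (∑-zero a λ _ → e _) (∑-zero b λ _ → e _)) (+-identityˡ 0#)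

  ∑ℤ-+ : ∀ a b f g → ∑ℤ a b (λ n → f n + g n) ≈ ∑ℤ a b f + ∑ℤ a b g
  ∑ℤ-+ a b f g = trans (+-cong (∑-+ a _ _) (∑-+ b _ _))
    (solve 4 (λ a b c d → (a :+ b) :+ (c :+ d) := (a :+ c) :+ (b :+ d)) refl _ _ _ _)
    where open Solver

  ∑ℤ-*ˡ : ∀ a b c f → ∑ℤ a b (λ n → c * f n) ≈ c * ∑ℤ a b f
  ∑ℤ-*ˡ a b c f = trans (+-cong (∑-*ˡ a c _) (∑-*ˡ b c _)) (sym (distribˡ c _ _))

  ∑-∑ℤ-swap : ∀ n a b (f : ℕ → ℤ → Carrier) →
    ∑ n (λ i → ∑ℤ a b (f i)) ≈ ∑ℤ a b (λ j → ∑ n (λ i → f i j))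
  ∑-∑ℤ-swap n a b f = trans (∑-+ n _ _) (+-cong (∑-swap n a _) (∑-swap n b _))

  ∑ℤ-swap : ∀ a b c d (f : ℤ → ℤ → Carrier) →
    ∑ℤ a b (λ i → ∑ℤ c d (f i)) ≈ ∑ℤ c d (λ j → ∑ℤ a b (λ i → f i j))
  ∑ℤ-swap a b c d f =
    trans (+-cong (∑-∑ℤ-swap a c d (λ k → f -[1+ k ])) (∑-∑ℤ-swap b c d (λ k → f (+ k))))
      (sym (∑ℤ-+ c d (λ j → ∑ a (λ k → f -[1+ k ] j)) (λ j → ∑ b (λ k → f (+ k) j))))

  -- The term `f (+ 0)` changes halves, which moves both ends by one.
  ∑ℤ-suc : ∀ a b f → ∑ℤ (suc a) b (λ n → f (ℤ.suc n)) ≈ ∑ℤ a (suc b) f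
  ∑ℤ-suc a b f = begin
    ∑ (suc a) (λ k → f (ℤ.suc -[1+ k ])) + ∑ b (λ k → f (+ suc k))
      ≈⟨ +-congʳ (∑-head a _) ⟩
    (f (+ 0) + ∑ a (λ k → f -[1+ k ])) + ∑ b (λ k → f (+ suc k))
      ≈⟨ solve 3 (λ x y z → (x :+ y) :+ z := y :+ (x :+ z)) refl _ _ _ ⟩
    ∑ a (λ k → f -[1+ k ]) + (f (+ 0) + ∑ b (λ k → f (+ suc k)))
      ≈⟨ +-congˡ (∑-head b _) ⟨
    ∑ℤ a (suc b) f ∎
    where open Solver

  ∑ℤ-neg : ∀ a b f → ∑ℤ a (suc b) (λ n → f (ℤ.- n)) ≈ ∑ℤ b (suc a) f
  ∑ℤ-neg a b f = begin
    ∑ a (λ k → f (+ suc k)) + ∑ (suc b) (λ k → f (ℤ.- (+ k)))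
      ≈⟨ +-congˡ (∑-head b _) ⟩
    ∑ a (λ k → f (+ suc k)) + (f (+ 0) + ∑ b (λ k → f -[1+ k ]))
      ≈⟨ solve 3 (λ x y z → x :+ (y :+ z) := z :+ (y :+ x)) refl _ _ _ ⟩
    ∑ b (λ k → f -[1+ k ]) + (f (+ 0) + ∑ a (λ k → f (+ suc k)))
      ≈⟨ +-congˡ (∑-head a _) ⟨
    ∑ℤ b (suc a) f ∎
    where open Solver

  infix 4 _⇓_

  -- In the rings considered below q is nilpotent, so that a series over ℤ is eventually constant.
  record _⇓_ (f : ℤ → Carrier) (s : Carrier) : Set where
    constructor eventually
    field
      bound    : ℕ
      constant : ∀ a b → bound ℕ.≤ a → bound ℕ.≤ b → ∑ℤ a b f ≈ s

  ⇓-unique : ∀ {f s t} → f ⇓ s → f ⇓ t → s ≈ t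
  ⇓-unique (eventually M p) (eventually N q) = trans (sym (p L L M≤L M≤L)) (q L L N≤L N≤L)
    where L = M ℕ.⊔ N
          M≤L = ℕ.m≤m⊔n M N
          N≤L = ℕ.m≤n⊔m M N

  ⇓-cong : ∀ {f g s t} → (∀ n → f n ≈ g n) → s ≈ t → f ⇓ s → g ⇓ t
  ⇓-cong {f} {g} e s≈t (eventually N p) = eventually N λ a b a≥ b≥ →
    trans (∑ℤ-cong a b {g} {f} λ n → sym (e n)) (trans (p a b a≥ b≥) s≈t)

  ⇓-+ : ∀ {f g s t} → f ⇓ s → g ⇓ t → (λ n → f n + g n) ⇓ s + t
  ⇓-+ {f} {g} (eventually M p) (eventually N q) = eventually (M ℕ.⊔ N) λ a b a≥ b≥ → trans (∑ℤ-+ a b f g)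
    (+-cong (p a b (ℕ.≤-trans M≤L a≥) (ℕ.≤-trans M≤L b≥))
            (q a b (ℕ.≤-trans N≤L a≥) (ℕ.≤-trans N≤L b≥)))
    where M≤L = ℕ.m≤m⊔n M N
          N≤L = ℕ.m≤n⊔m M N

  ⇓-*ˡ : ∀ {f s} c → f ⇓ s → (λ n → c * f n) ⇓ c * s
  ⇓-*ˡ {f} c (eventually N p) = eventually N λ a b a≥ b≥ → trans (∑ℤ-*ˡ a b c f) (*-congˡ (p a b a≥ b≥))

  -- Since 0 belongs to the nonnegative half, negation pairs the ends `a`, `suc b` with `b`,
  -- `suc a`. The bound `suc N` forces the upper end to be a successor.
  ⇓-neg : ∀ {f s} → f ⇓ s → (λ n → f (ℤ.- n)) ⇓ s
  ⇓-neg {f} {s} (eventually N p) = eventually (suc N) λ where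
    a (suc b) a≥ (ℕ.s≤s b≥) → trans (∑ℤ-neg a b f)
      (p b (suc a) b≥ (ℕ.≤-trans (ℕ.n≤1+n N) (ℕ.m≤n⇒m≤1+n a≥)))

  ⇓-suc : ∀ {f s} → f ⇓ s → (λ n → f (ℤ.suc n)) ⇓ s
  ⇓-suc {f} (eventually N p) = eventually (suc N) λ where
    (suc a) b (ℕ.s≤s a≥) b≥ → trans (∑ℤ-suc a b f)
      (p a (suc b) a≥ (ℕ.≤-trans (ℕ.n≤1+n N) (ℕ.m≤n⇒m≤1+n b≥)))

  ⇓-shiftℕ : ∀ {f s} c → f ⇓ s → (λ n → f (n ℤ.+ + c)) ⇓ s
  ⇓-shiftℕ {f} zero    p = ⇓-cong (λ n → reflexive (≡.cong f (≡.sym (ℤ.+-identityʳ n)))) refl p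
  ⇓-shiftℕ {f} (suc c) p =
    ⇓-cong (λ n → reflexive (≡.cong f (lem n (+ c)))) refl (⇓-suc (⇓-shiftℕ c p))
    where
    lem : ∀ n c → + 1 ℤ.+ n ℤ.+ c ≡ n ℤ.+ (+ 1 ℤ.+ c)
    lem = ℤ-Ring.solve-∀

  ⇓-shift : ∀ {f s} c → f ⇓ s → (λ n → f (n ℤ.+ c)) ⇓ s
  ⇓-shift     (+ c)    p = ⇓-shiftℕ c p
  ⇓-shift {f} -[1+ c ] p = ⇓-cong (λ n → reflexive (≡.cong f (lem n (+ suc c)))) refl
    (⇓-neg (⇓-shiftℕ (suc c) (⇓-neg p)))
    where
    lem : ∀ n c → ℤ.- (ℤ.- n ℤ.+ c) ≡ n ℤ.+ (ℤ.- c)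
    lem = ℤ-Ring.solve-∀

  -- Blocks of three tile an interval: the grouped sum over `[-a, b)` is the sum of `f` over
  -- `[-3a, 3b)`.
  ⇓-trisect : ∀ {f s} → f ⇓ s →
    (λ m → f (+ 3 ℤ.* m) + f (+ 3 ℤ.* m ℤ.+ + 1) + f (+ 3 ℤ.* m ℤ.+ + 2)) ⇓ s
  ⇓-trisect {f} (eventually N p) = eventually N λ a b a≥ b≥ → trans
    (+-cong (trans (∑-cong a negative) (∑-thrice a (λ k → f -[1+ k ])))
            (trans (∑-cong b nonnegative) (∑-thrice b (λ k → f (+ k)))))
    (p (3* a) (3* b) (≥3* a a≥) (≥3* b b≥))
    where
    open Solver
    -- Recursive, so that a sum up to `3* (suc n)` unfolds into three more terms.
    3* : ℕ → ℕ
    3* zero    = zero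
    3* (suc n) = suc (suc (suc (3* n)))
    ≥3* : ∀ n → N ℕ.≤ n → N ℕ.≤ 3* n
    ≥3* n N≤n = ℕ.≤-trans N≤n (go n)
      where
      go : ∀ n → n ℕ.≤ 3* n
      go zero    = ℕ.z≤n
      go (suc n) = ℕ.s≤s (ℕ.m≤n⇒m≤1+n (ℕ.m≤n⇒m≤1+n (go n)))
    ∑-thrice : ∀ n g → ∑ n (λ k → g (3* k) + g (suc (3* k)) + g (suc (suc (3* k)))) ≈ ∑ (3* n) g
    ∑-thrice zero    g = refl
    ∑-thrice (suc n) g = trans (+-congʳ (∑-thrice n g))
      (solve 4 (λ s x y z → s :+ (x :+ y :+ z) := s :+ x :+ y :+ z) refl _ _ _ _)
    3*-pos : ∀ k → + 3 ℤ.* + k ≡ + 3* k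
    3*-pos zero    = ≡.refl
    3*-pos (suc k) = ≡.trans (lem (+ k)) (≡.cong (λ i → + 3 ℤ.+ i) (3*-pos k))
      where
      lem : ∀ k → + 3 ℤ.* (+ 1 ℤ.+ k) ≡ + 3 ℤ.+ + 3 ℤ.* k
      lem = ℤ-Ring.solve-∀
    3*-neg : ∀ k → + 3 ℤ.* -[1+ k ] ≡ -[1+ 3* k ] ℤ.- + 2
    3*-neg k = ≡.trans (lem (+ k)) (≡.cong (λ i → ℤ.- (+ 1 ℤ.+ i) ℤ.- + 2) (3*-pos k))
      where
      lem : ∀ k → + 3 ℤ.* (ℤ.- (+ 1 ℤ.+ k)) ≡ ℤ.- (+ 1 ℤ.+ + 3 ℤ.* k) ℤ.- + 2
      lem = ℤ-Ring.solve-∀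
    nonnegative : ∀ k → f (+ 3 ℤ.* + k) + f (+ 3 ℤ.* + k ℤ.+ + 1) + f (+ 3 ℤ.* + k ℤ.+ + 2)
      ≈ f (+ 3* k) + f (+ suc (3* k)) + f (+ suc (suc (3* k)))
    nonnegative k = +-cong (+-cong
      (reflexive (≡.cong f (3*-pos k)))
      (reflexive (≡.cong f (≡.trans (≡.cong (ℤ._+ + 1) (3*-pos k)) (ℤ.+-comm (+ 3* k) (+ 1))))))
      (reflexive (≡.cong f (≡.trans (≡.cong (ℤ._+ + 2) (3*-pos k)) (ℤ.+-comm (+ 3* k) (+ 2)))))
    negative : ∀ k → f (+ 3 ℤ.* -[1+ k ]) + f (+ 3 ℤ.* -[1+ k ] ℤ.+ + 1) + f (+ 3 ℤ.* -[1+ k ] ℤ.+ + 2)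
      ≈ f -[1+ 3* k ] + f -[1+ suc (3* k) ] + f -[1+ suc (suc (3* k)) ]
    negative k = trans (+-cong (+-cong
        (reflexive (≡.cong f (≡.trans (3*-neg k) (≡.cong -[1+_] (ℕ.+-comm (suc (3* k)) 1)))))
        (reflexive (≡.cong f (≡.trans (≡.cong (ℤ._+ + 1) (3*-neg k)) (≡.trans (lem₁ -[1+ 3* k ]) (≡.cong (λ i → -[1+ suc i ]) (ℕ.+-identityʳ (3* k))))))))
        (reflexive (≡.cong f (≡.trans (≡.cong (ℤ._+ + 2) (3*-neg k)) (lem₂ -[1+ 3* k ])))))
      -- The negative half is enumerated downwards from -1, so each block appears reversed.
      (solve 3 (λ x y z → x :+ y :+ z := z :+ y :+ x) refl _ _ _)
      where
      lem₁ : ∀ i → i ℤ.- + 2 ℤ.+ + 1 ≡ i ℤ.- + 1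
      lem₁ = ℤ-Ring.solve-∀
      lem₂ : ∀ i → i ℤ.- + 2 ℤ.+ + 2 ≡ i
      lem₂ = ℤ-Ring.solve-∀

  -- The reflection `k ↦ -1 - k` fixes no integer, so in a partial sum with equal ends the terms
  -- cancel in pairs.
  ⇓-antisymmetric : ∀ {f s} → (∀ k → f -[1+ k ] + f (+ k) ≈ 0#) → f ⇓ s → s ≈ 0#
  ⇓-antisymmetric e (eventually N p) = trans (sym (p N N ℕ.≤-refl ℕ.≤-refl))
    (trans (sym (∑-+ N _ _)) (∑-zero N e))

  Supported : ℕ → (ℤ → Carrier) → Set
  Supported N f = ∀ n → N ℕ.≤ ℤ.∣ n ∣ → f n ≈ 0#

  ∑-stable : ∀ {N} f → (∀ k → N ℕ.≤ k → f k ≈ 0#) → ∀ n → N ℕ.≤ n → ∑ n f ≈ ∑ N f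
  ∑-stable {N} f z n N≤n = go (ℕ.≤⇒≤′ N≤n)
    where
    go : ∀ {n} → N ℕ.≤′ n → ∑ n f ≈ ∑ N f
    go ℕ.≤′-refl       = refl
    go (ℕ.≤′-step N≤n) = trans (+-cong (go N≤n) (z _ (ℕ.≤′⇒≤ N≤n))) (+-identityʳ _)

  supported⇒⇓ : ∀ {N} f → Supported N f → f ⇓ ∑ℤ N N f
  supported⇒⇓ {N} f z = eventually N λ a b a≥ b≥ → +-cong
    (∑-stable _ (λ k N≤k → z -[1+ k ] (ℕ.m≤n⇒m≤1+n N≤k)) a a≥)
    (∑-stable _ (λ k → z (+ k)) b b≥)

  -- A support inside one fixed square turns both iterated series into the same finite double sum.
  fubini : ∀ {N} {F : ℤ → ℤ → Carrier} {r c s} →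
    (∀ j → Supported N (λ i → F i j)) → (∀ i → Supported N (F i)) →
    (∀ j → (λ i → F i j) ⇓ r j) → r ⇓ s → (∀ i → F i ⇓ c i) → c ⇓ s
  fubini {N} {F} {r} {c} {s} zi zj rows r⇓s columns =
    ⇓-cong (λ i → sym (c≈ i)) (trans (sym (∑ℤ-swap N N N N (λ j i → F i j))) s≈)
      (supported⇒⇓ (λ i → ∑ℤ N N (F i)) λ i i≥ → ∑ℤ-zero N N {F i} λ j → zi j i i≥)
    where
    c≈ : ∀ i → c i ≈ ∑ℤ N N (F i)
    c≈ i = ⇓-unique (columns i) (supported⇒⇓ (F i) (zj i))
    r≈ : ∀ j → r j ≈ ∑ℤ N N (λ i → F i j)
    r≈ j = ⇓-unique (rows j) (supported⇒⇓ (λ i → F i j) (zi j))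
    s≈ : ∑ℤ N N (λ j → ∑ℤ N N (λ i → F i j)) ≈ s
    s≈ = ⇓-unique (supported⇒⇓ (λ j → ∑ℤ N N (λ i → F i j)) λ j j≥ → ∑ℤ-zero N N {λ i → F i j} λ i → zj i j j≥)
                  (⇓-cong r≈ refl r⇓s)

-- The triple product in a ring with nilpotent base

-- Zero at both 0 and 1: this is `n (n - 1) / 2`, the exponent of the triple product.
triangle : ℕ → ℕ
triangle zero    = 0
triangle (suc n) = n ℕ.+ triangle n

module TripleProduct (K : CommutativeRing 0ℓ 0ℓ) where
  open CommutativeRing K hiding (zero)
  open import Algebra.Properties.Ring ring using (-0#≈0#)
  open import Algebra.Properties.CommutativeSemiring.Exp commutativeSemiring
    using (_^_; ^-homo-*; ^-congˡ; ^-assocʳ; ^-distrib-*)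
  open IntegerMultiples K
  open Sums K
  open import Relation.Binary.Reasoning.Setoid setoid

  ⟨_⨾_⟩ : Carrier → Carrier → ℕ → Carrier
  ⟨ a ⨾ p ⟩ n = ∏ n (λ j → 1# - a * p ^ j)

  ^-vanish : ∀ {p N} → p ^ N ≈ 0# → ∀ {n} → N ℕ.≤ n → p ^ n ≈ 0#
  ^-vanish {p} {N} z {n} N≤n = begin
    p ^ n                   ≡⟨ ≡.cong (p ^_) (ℕ.m+[n∸m]≡n N≤n) ⟨
    p ^ (N ℕ.+ (n ℕ.∸ N))   ≈⟨ ^-homo-* p N _ ⟩
    p ^ N * p ^ (n ℕ.∸ N)   ≈⟨ *-congʳ z ⟩
    0# * p ^ (n ℕ.∸ N)      ≈⟨ zeroˡ _ ⟩
    0#                      ∎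

  1^n≈1 : ∀ n → 1# ^ n ≈ 1#
  1^n≈1 zero    = refl
  1^n≈1 (suc n) = trans (*-identityˡ _) (1^n≈1 n)

  ⟨⟩-cong : ∀ {a b p r} n → a ≈ b → p ≈ r → ⟨ a ⨾ p ⟩ n ≈ ⟨ b ⨾ r ⟩ n
  ⟨⟩-cong n a≈b p≈r = ∏-cong n λ j → +-congˡ (-‿cong (*-cong a≈b (^-congˡ j p≈r)))

  -- Factors beyond the N-th are 1, so `⟨ a ⨾ p ⟩ N` already is the infinite product.
  ⟨⟩-stable : ∀ {a p N} → p ^ N ≈ 0# → ∀ {n} → N ℕ.≤ n → ⟨ a ⨾ p ⟩ n ≈ ⟨ a ⨾ p ⟩ N
  ⟨⟩-stable {a} {p} {N} z N≤n = go (ℕ.≤⇒≤′ N≤n)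
    where
    go : ∀ {n} → N ℕ.≤′ n → ⟨ a ⨾ p ⟩ n ≈ ⟨ a ⨾ p ⟩ N
    go ℕ.≤′-refl           = refl
    go (ℕ.≤′-step {n} N≤n) = begin
      ⟨ a ⨾ p ⟩ n * (1# - a * p ^ n)
        ≈⟨ *-cong (go N≤n) (+-congˡ (-‿cong (*-congˡ (^-vanish z (ℕ.≤′⇒≤ N≤n))))) ⟩
      ⟨ a ⨾ p ⟩ N * (1# - a * 0#)
        ≈⟨ solve 2 (λ x a → x :* (con (+ 1) :- a :* con (+ 0)) := x) refl _ _ ⟩
      ⟨ a ⨾ p ⟩ N ∎
      where open Solver

  Invertible : Carrier → Set
  Invertible x = ∃ λ y → x * y ≈ 1#

  -- The geometric series of a nilpotent element is finite. This is what makes the products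
  -- cancellable.
  1-nilpotent-invertible : ∀ {c} N → c ^ N ≈ 0# → Invertible (1# - c)
  1-nilpotent-invertible {c} N z = ∑ N (c ^_) , trans (geometric N) (begin
    1# - c ^ N ≈⟨ +-congˡ (trans (-‿cong z) -0#≈0#) ⟩
    1# + 0#    ≈⟨ +-identityʳ 1# ⟩
    1#         ∎)
    where
    open Solver
    geometric : ∀ n → (1# - c) * ∑ n (c ^_) ≈ 1# - c ^ n
    geometric zero    = solve 1 (λ c → (con (+ 1) :- c) :* con (+ 0) := con (+ 1) :- con (+ 1)) refl c
    geometric (suc n) = trans (distribˡ _ _ _) (trans (+-congʳ (geometric n))
      (solve 2 (λ c x → con (+ 1) :- x :+ (con (+ 1) :- c) :* x := con (+ 1) :- c :* x) refl _ _))

  ⟨⟩-invertible : ∀ {a p N} → a ^ N ≈ 0# → ∀ n → Invertible (⟨ a ⨾ p ⟩ n)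
  ⟨⟩-invertible         z zero    = 1# , *-identityˡ 1#
  ⟨⟩-invertible {a} {p} {N} z (suc n) =
    let x , e = ⟨⟩-invertible {a} {p} {N} z n
        y , f = 1-nilpotent-invertible N (begin
          (a * p ^ n) ^ N    ≈⟨ ^-distrib-* a (p ^ n) N ⟩
          a ^ N * (p ^ n) ^ N ≈⟨ *-congʳ z ⟩
          0# * (p ^ n) ^ N    ≈⟨ zeroˡ _ ⟩
          0#                  ∎)
    in x * y , (begin
      (⟨ a ⨾ p ⟩ n * (1# - a * p ^ n)) * (x * y)
        ≈⟨ solve 4 (λ u v x y → (u :* v) :* (x :* y) := (u :* x) :* (v :* y)) refl _ _ _ _ ⟩
      (⟨ a ⨾ p ⟩ n * x) * ((1# - a * p ^ n) * y) ≈⟨ *-cong e f ⟩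
      1# * 1#                                    ≈⟨ *-identityˡ 1# ⟩
      1# ∎)
    where open Solver

  invertible-cancel : ∀ {u x y} → Invertible u → u * x ≈ u * y → x ≈ y
  invertible-cancel {u} {x} {y} (v , uv≈1) e = begin
    x            ≈⟨ *-identityˡ x ⟨
    1# * x       ≈⟨ *-congʳ uv≈1 ⟨
    (u * v) * x  ≈⟨ solve 3 (λ u v x → (u :* v) :* x := v :* (u :* x)) refl u v x ⟩
    v * (u * x)  ≈⟨ *-congˡ e ⟩
    v * (u * y)  ≈⟨ solve 3 (λ u v x → (u :* v) :* x := v :* (u :* x)) refl u v y ⟨
    (u * v) * y  ≈⟨ *-congʳ uv≈1 ⟩
    1# * y       ≈⟨ *-identityˡ y ⟩
    y            ∎
    where open Solver

  ⟨⟩-trisect : ∀ a p n →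
    ⟨ a ⨾ p ⟩ (n ℕ.* 3) ≈ ⟨ a ⨾ p ^ 3 ⟩ n * ⟨ a * p ⨾ p ^ 3 ⟩ n * ⟨ a * p ^ 2 ⨾ p ^ 3 ⟩ n
  ⟨⟩-trisect a p zero    = solve 0 (con (+ 1) := con (+ 1) :* con (+ 1) :* con (+ 1)) refl
    where open Solver
  ⟨⟩-trisect a p (suc n) = begin
    ⟨ a ⨾ p ⟩ (n ℕ.* 3) * (1# - a * p ^ m) * (1# - a * (p * p ^ m)) * (1# - a * (p * (p * p ^ m)))
      ≈⟨ *-cong (*-cong (*-cong (⟨⟩-trisect a p n)
           (+-congˡ (-‿cong (*-congˡ e))))
           (+-congˡ (-‿cong (*-congˡ (*-congˡ e)))))
           (+-congˡ (-‿cong (*-congˡ (*-congˡ (*-congˡ e))))) ⟩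
    _ ≈⟨ solve 6 (λ x y z a p r →
           x :* y :* z :* (con (+ 1) :- a :* r) :* (con (+ 1) :- a :* (p :* r)) :* (con (+ 1) :- a :* (p :* (p :* r)))
           := (x :* (con (+ 1) :- a :* r)) :* (y :* (con (+ 1) :- a :* p :* r))
              :* (z :* (con (+ 1) :- a :* (p :* (p :* con (+ 1))) :* r))) refl _ _ _ _ _ _ ⟩
    _ ∎
    where
    open Solver
    m = n ℕ.* 3
    e : p ^ m ≈ (p ^ 3) ^ n
    e = trans (reflexive (≡.cong (p ^_) (ℕ.*-comm n 3))) (sym (^-assocʳ p 3 n))

  module Gaussian (p : Carrier) where
    open Solver

    binomial : ℕ → ℕ → Carrier
    binomial n       zero    = 1#
    binomial zero    (suc i) = 0#
    binomial (suc n) (suc i) = binomial n i + p ^ suc i * binomial n (suc i)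

    binomial-vanish : ∀ {n i} → n ℕ.< i → binomial n i ≈ 0#
    binomial-vanish {zero}  {suc i} _           = refl
    binomial-vanish {suc n} {suc i} (ℕ.s≤s n<i) = begin
      binomial n i + p ^ suc i * binomial n (suc i)
        ≈⟨ +-cong (binomial-vanish n<i) (*-congˡ (binomial-vanish (ℕ.m<n⇒m<1+n n<i))) ⟩
      0# + p ^ suc i * 0#
        ≈⟨ solve 1 (λ x → con (+ 0) :+ x :* con (+ 0) := con (+ 0)) refl _ ⟩
      0# ∎

    -- The second q-Pascal rule. Attaching a factor `1 - a p^M` to the expansion below produces this
    -- rule, attaching `1 - b p^L` the defining one.
    pascal : ∀ n i → binomial (suc n) (suc i) ≈ binomial n (suc i) + p ^ (n ℕ.∸ i) * binomial n i
    pascal zero zero = solve 1 (λ p → con (+ 1) :+ p :* con (+ 1) :* con (+ 0) := con (+ 0) :+ con (+ 1) :* con (+ 1)) refl p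
    pascal zero (suc i) = solve 1 (λ p → con (+ 0) :+ p :* con (+ 0) := con (+ 0) :+ con (+ 1) :* con (+ 0)) refl _
    pascal (suc n) zero = begin
      1# + p ^ 1 * binomial (suc n) 1
        ≈⟨ +-congˡ (*-congˡ (pascal n zero)) ⟩
      1# + p ^ 1 * (binomial n 1 + p ^ n * 1#)
        ≈⟨ solve 3 (λ p b x → con (+ 1) :+ p :* con (+ 1) :* (b :+ x :* con (+ 1))
             := con (+ 1) :+ p :* con (+ 1) :* b :+ p :* x :* con (+ 1)) refl p _ _ ⟩
      binomial (suc n) 1 + p ^ suc n * 1# ∎
    pascal (suc n) (suc i) = begin
      binomial (suc n) (suc i) + p ^ suc (suc i) * binomial (suc n) (suc (suc i))
        ≈⟨ +-cong (pascal n i) (*-congˡ (pascal n (suc i))) ⟩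
      (b₁ + x * b₀) + p * y * (b₂ + p ^ (n ℕ.∸ suc i) * b₁)
        ≈⟨ solve 7 (λ b₀ b₁ b₂ x y z p → (b₁ :+ x :* b₀) :+ p :* y :* (b₂ :+ z :* b₁)
             := b₁ :+ p :* y :* b₂ :+ x :* b₀ :+ y :* ((p :* z) :* b₁)) refl b₀ b₁ b₂ x y _ p ⟩
      b₁ + p * y * b₂ + x * b₀ + y * ((p * p ^ (n ℕ.∸ suc i)) * b₁)
        ≈⟨ +-congˡ (*-congˡ adjust) ⟩
      b₁ + p * y * b₂ + x * b₀ + y * (x * b₁)
        ≈⟨ solve 6 (λ b₀ b₁ b₂ x y p → b₁ :+ p :* y :* b₂ :+ x :* b₀ :+ y :* (x :* b₁)
             := b₁ :+ p :* y :* b₂ :+ x :* (b₀ :+ y :* b₁)) refl b₀ b₁ b₂ x y p ⟩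
      binomial (suc n) (suc (suc i)) + p ^ (n ℕ.∸ i) * binomial (suc n) (suc i) ∎
      where
      b₀ = binomial n i
      b₁ = binomial n (suc i)
      b₂ = binomial n (suc (suc i))
      x = p ^ (n ℕ.∸ i)
      y = p ^ suc i
      -- n ∸ suc i is truncated exactly when the binomial next to it vanishes.
      adjust : (p * p ^ (n ℕ.∸ suc i)) * b₁ ≈ x * b₁
      adjust with i ℕ.<? n
      ... | yes i<n = *-congʳ (reflexive (≡.cong (p ^_) (≡.sym (ℕ.+-∸-assoc 1 i<n))))
      ... | no  i≮n = begin
        (p * p ^ (n ℕ.∸ suc i)) * b₁ ≈⟨ *-congˡ b₁≈0 ⟩
        (p * p ^ (n ℕ.∸ suc i)) * 0# ≈⟨ zeroʳ _ ⟩
        0#                           ≈⟨ zeroʳ x ⟨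
        x * 0#                       ≈⟨ *-congˡ b₁≈0 ⟨
        x * b₁                       ∎
        where b₁≈0 = binomial-vanish (ℕ.s≤s (ℕ.≮⇒≥ i≮n))

    factorial : ℕ → Carrier
    factorial = ⟨ p ⨾ p ⟩

    binomial-full : ∀ n → binomial n n ≈ 1#
    binomial-full zero    = refl
    binomial-full (suc n) = begin
      binomial n n + p ^ suc n * binomial n (suc n)
        ≈⟨ +-cong (binomial-full n) (*-congˡ (binomial-vanish {n} ℕ.≤-refl)) ⟩
      1# + p ^ suc n * 0#
        ≈⟨ solve 1 (λ x → con (+ 1) :+ x :* con (+ 0) := con (+ 1)) refl _ ⟩
      1# ∎

    -- The quotient formula cleared of denominators. The induction rests on `(1 - p^(i+1)) + p^(i+1)
    -- (1 - p^(j+1)) = 1 - p^(i+j+2)`.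
    binomial-factorial : ∀ i j → binomial (i ℕ.+ j) i * factorial i * factorial j ≈ factorial (i ℕ.+ j)
    binomial-factorial zero    j    = solve 1 (λ x → con (+ 1) :* con (+ 1) :* x := x) refl _
    binomial-factorial (suc i) zero = begin
      binomial (suc i ℕ.+ 0) (suc i) * factorial (suc i) * 1#
        ≡⟨ ≡.cong (λ n → binomial n (suc i) * factorial (suc i) * 1#) (ℕ.+-identityʳ (suc i)) ⟩
      binomial (suc i) (suc i) * factorial (suc i) * 1#
        ≈⟨ *-congʳ (*-congʳ (binomial-full (suc i))) ⟩
      1# * factorial (suc i) * 1#
        ≈⟨ solve 1 (λ x → con (+ 1) :* x :* con (+ 1) := x) refl _ ⟩
      factorial (suc i)
        ≡⟨ ≡.cong factorial (ℕ.+-identityʳ (suc i)) ⟨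
      factorial (suc i ℕ.+ 0) ∎
    binomial-factorial (suc i) (suc j) = begin
      (binomial (i ℕ.+ suc j) i + p ^ suc i * binomial (i ℕ.+ suc j) (suc i))
        * (factorial i * (1# - p * p ^ i)) * (factorial j * (1# - p * p ^ j))
        ≡⟨ ≡.cong (λ n → (binomial (i ℕ.+ suc j) i + p ^ suc i * binomial n (suc i))
             * (factorial i * (1# - p * p ^ i)) * (factorial j * (1# - p * p ^ j))) (ℕ.+-suc i j) ⟩
      (B + p * x * B′) * (factorial i * (1# - p * x)) * (factorial j * (1# - p * y))
        ≈⟨ solve 7 (λ b b′ f g p x y →
             (b :+ p :* x :* b′) :* (f :* (con (+ 1) :- p :* x)) :* (g :* (con (+ 1) :- p :* y))
             := (con (+ 1) :- p :* x) :* (b :* f :* (g :* (con (+ 1) :- p :* y)))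
             :+ p :* x :* (con (+ 1) :- p :* y) :* (b′ :* (f :* (con (+ 1) :- p :* x)) :* g))
             refl B B′ (factorial i) (factorial j) p x y ⟩
      (1# - p * x) * (B * factorial i * factorial (suc j))
        + p * x * (1# - p * y) * (B′ * factorial (suc i) * factorial j)
        ≈⟨ +-cong (*-congˡ (trans (binomial-factorial i (suc j)) (reflexive (≡.cong factorial (ℕ.+-suc i j)))))
                  (*-congˡ (binomial-factorial (suc i) j)) ⟩
      (1# - p * x) * factorial (suc (i ℕ.+ j)) + p * x * (1# - p * y) * factorial (suc (i ℕ.+ j))
        ≈⟨ solve 4 (λ p x y f → (con (+ 1) :- p :* x) :* f :+ p :* x :* (con (+ 1) :- p :* y) :* f
             := f :* (con (+ 1) :- p :* (x :* (p :* y)))) refl p x y _ ⟩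
      factorial (suc (i ℕ.+ j)) * (1# - p * (x * (p * y)))
        ≈⟨ *-cong (reflexive (≡.cong factorial (≡.sym (ℕ.+-suc i j))))
             (+-congˡ (-‿cong (*-congˡ (sym (^-homo-* p i (suc j)))))) ⟩
      factorial (i ℕ.+ suc j) * (1# - p * p ^ (i ℕ.+ suc j)) ∎
      where
      B = binomial (i ℕ.+ suc j) i
      B′ = binomial (suc i ℕ.+ j) (suc i)
      x = p ^ i
      y = p ^ j

  module Theta (a b p : Carrier) (ab≈p : a * b ≈ p) where
    open Gaussian p
    open Solver

    -- Formally `(-a)^n p^(n(n-1)/2)` for all integers `n`. As `a` need not be invertible, `b`
    -- stands for `p / a` and carries the negative indices.
    θ-term : ℤ → Carrier
    θ-term (+ n)    = (- a) ^ n * p ^ triangle n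
    θ-term -[1+ n ] = (- b) ^ suc n * p ^ triangle (suc n)

    -- θ-term shifted by L, so that the index becomes a natural number
    shifted : ℕ → ℕ → Carrier
    shifted zero    i       = θ-term (+ i)
    shifted (suc L) zero    = θ-term -[1+ L ]
    shifted (suc L) (suc i) = shifted L i

    shifted-⊖ : ∀ L i → shifted L i ≡ θ-term (i ℤ.⊖ L)
    shifted-⊖ zero    i       = ≡.refl
    shifted-⊖ (suc L) zero    = ≡.refl
    shifted-⊖ (suc L) (suc i) = ≡.trans (shifted-⊖ L i) (≡.cong θ-term (≡.sym (ℤ.[1+m]⊖[1+n]≡m⊖n i L)))

    shifted-0 : ∀ L → shifted L 0 ≈ (- b) ^ L * p ^ triangle L
    shifted-0 zero    = refl
    shifted-0 (suc L) = refl

    -- With `k = i - L`, the term at `k + 1` is formally `- a p^k` times the term at `k`; the factor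
    -- `p ^ M` clears the negative powers. For negative `k` the relation is read backwards, and
    -- `ab≈p` trades `a` against `b`. The bound on `i` keeps the truncated subtraction exact.
    a-shift : ∀ M L i → i ℕ.≤ M ℕ.+ L →
      - a * p ^ M * shifted L i ≈ p ^ (M ℕ.+ L ℕ.∸ i) * shifted L (suc i)
    a-shift M zero i i≤M+0 = begin
      - a * p ^ M * ((- a) ^ i * p ^ triangle i)
        ≡⟨ ≡.cong (λ n → - a * p ^ n * ((- a) ^ i * p ^ triangle i))
             (≡.trans (≡.sym (ℕ.+-identityʳ M)) (≡.sym (ℕ.m∸n+n≡m i≤M+0))) ⟩
      - a * p ^ (M ℕ.+ 0 ℕ.∸ i ℕ.+ i) * ((- a) ^ i * p ^ triangle i)
        ≈⟨ *-congʳ (*-congˡ (^-homo-* p (M ℕ.+ 0 ℕ.∸ i) i)) ⟩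
      - a * (p ^ (M ℕ.+ 0 ℕ.∸ i) * p ^ i) * ((- a) ^ i * p ^ triangle i)
        ≈⟨ solve 5 (λ a x y z w → a :* (x :* y) :* (z :* w) := x :* (a :* z :* (y :* w))) refl _ _ _ _ _ ⟩
      p ^ (M ℕ.+ 0 ℕ.∸ i) * (- a * (- a) ^ i * (p ^ i * p ^ triangle i))
        ≈⟨ *-congˡ (*-congˡ (^-homo-* p i (triangle i))) ⟨
      p ^ (M ℕ.+ 0 ℕ.∸ i) * ((- a) ^ suc i * p ^ triangle (suc i)) ∎
    a-shift M (suc L) zero _ = begin
      - a * p ^ M * ((- b) ^ suc L * p ^ triangle (suc L))
        ≈⟨ *-congˡ (*-congˡ (^-homo-* p L (triangle L))) ⟩
      - a * p ^ M * (- b * (- b) ^ L * (p ^ L * p ^ triangle L))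
        ≈⟨ solve 6 (λ a x b z w v → :- a :* x :* (:- b :* z :* (w :* v)) := (x :* ((a :* b) :* w)) :* (z :* v)) refl _ _ _ _ _ _ ⟩
      p ^ M * ((a * b) * p ^ L) * ((- b) ^ L * p ^ triangle L)
        ≈⟨ *-cong (*-congˡ (*-congʳ ab≈p)) (sym (shifted-0 L)) ⟩
      p ^ M * p ^ suc L * shifted L 0
        ≈⟨ *-congʳ (^-homo-* p M (suc L)) ⟨
      p ^ (M ℕ.+ suc L) * shifted L 0 ∎
    a-shift M (suc L) (suc i) i≤ = trans (a-shift M L i (ℕ.≤-pred (≡.subst (suc i ℕ.≤_) (ℕ.+-suc M L) i≤)))
      (*-congʳ (reflexive (≡.cong (λ n → p ^ (n ℕ.∸ suc i)) (≡.sym (ℕ.+-suc M L)))))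

    b-shift : ∀ L i → - b * p ^ L * shifted L i ≈ p ^ i * shifted (suc L) i
    b-shift zero zero =
      solve 1 (λ b → :- b :* con (+ 1) :* (con (+ 1) :* con (+ 1))
        := con (+ 1) :* ((:- b :* con (+ 1)) :* con (+ 1))) refl b
    b-shift zero (suc i) = begin
      - b * 1# * ((- a) ^ suc i * p ^ triangle (suc i))
        ≈⟨ *-congˡ (*-congˡ (^-homo-* p i (triangle i))) ⟩
      - b * 1# * (- a * (- a) ^ i * (p ^ i * p ^ triangle i))
        ≈⟨ solve 5 (λ a b x y z → :- b :* con (+ 1) :* (:- a :* x :* (y :* z)) := ((a :* b) :* y) :* (x :* z)) refl _ _ _ _ _ ⟩
      ((a * b) * p ^ i) * ((- a) ^ i * p ^ triangle i)
        ≈⟨ *-congʳ (*-congʳ ab≈p) ⟩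
      p ^ suc i * ((- a) ^ i * p ^ triangle i) ∎
    b-shift (suc L) zero = begin
      - b * p ^ suc L * ((- b) ^ suc L * p ^ triangle (suc L))
        ≈⟨ solve 4 (λ b x y z → b :* x :* (y :* z) := con (+ 1) :* (b :* y :* (x :* z))) refl _ _ _ _ ⟩
      1# * (- b * (- b) ^ suc L * (p ^ suc L * p ^ triangle (suc L)))
        ≈⟨ *-congˡ (*-congˡ (^-homo-* p (suc L) (triangle (suc L)))) ⟨
      1# * ((- b) ^ suc (suc L) * p ^ triangle (suc (suc L))) ∎
    b-shift (suc L) (suc i) = begin
      - b * (p * p ^ L) * shifted L i
        ≈⟨ solve 4 (λ b p x y → b :* (p :* x) :* y := p :* (b :* x :* y)) refl _ _ _ _ ⟩
      p * (- b * p ^ L * shifted L i)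
        ≈⟨ *-congˡ (b-shift L i) ⟩
      p * (p ^ i * shifted (suc L) i)
        ≈⟨ *-assoc _ _ _ ⟨
      p ^ suc i * shifted (suc L) i ∎

    expansion : ℕ → ℕ → Carrier
    expansion n L = ∑ (suc n) (λ i → binomial n i * shifted L i)

    expansion-a : ∀ M L → expansion (M ℕ.+ L) L * (1# - a * p ^ M) ≈ expansion (suc (M ℕ.+ L)) L
    expansion-a M L = begin
      expansion n L * (1# - a * p ^ M)
        ≈⟨ solve 3 (λ e a x → e :* (con (+ 1) :- a :* x) := e :+ :- a :* x :* e) refl _ _ _ ⟩
      expansion n L + - a * p ^ M * expansion n L
        ≈⟨ +-cong extend (sym (∑-*ˡ (suc n) _ _)) ⟩
      (1# * s 0 + ∑ (suc n) (λ i → binomial n (suc i) * s (suc i)))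
        + ∑ (suc n) (λ i → - a * p ^ M * (binomial n i * s i))
        ≈⟨ +-congˡ (∑-cong< (suc n) λ i i≤n → trans
             (solve 3 (λ c b s → c :* (b :* s) := b :* (c :* s)) refl _ _ _)
             (*-congˡ (a-shift M L i (ℕ.≤-pred i≤n)))) ⟩
      (1# * s 0 + ∑ (suc n) (λ i → binomial n (suc i) * s (suc i)))
        + ∑ (suc n) (λ i → binomial n i * (p ^ (n ℕ.∸ i) * s (suc i)))
        ≈⟨ trans (+-assoc _ _ _) (+-congˡ (sym (∑-+ (suc n) _ _))) ⟩
      1# * s 0 + ∑ (suc n) (λ i → binomial n (suc i) * s (suc i) + binomial n i * (p ^ (n ℕ.∸ i) * s (suc i)))
        ≈⟨ +-congˡ (∑-cong (suc n) λ i → trans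
             (solve 4 (λ x b c s → x :* s :+ b :* (c :* s) := (x :+ c :* b) :* s) refl _ _ _ _)
             (*-congʳ (sym (pascal n i)))) ⟩
      1# * s 0 + ∑ (suc n) (λ i → binomial (suc n) (suc i) * s (suc i))
        ≈⟨ ∑-head (suc n) _ ⟨
      expansion (suc n) L ∎
      where
      n = M ℕ.+ L
      s = shifted L
      extend : expansion n L ≈ 1# * s 0 + ∑ (suc n) (λ i → binomial n (suc i) * s (suc i))
      extend = begin
        expansion n L
          ≈⟨ +-identityʳ _ ⟨
        expansion n L + 0#
          ≈⟨ +-congˡ (trans (*-congʳ (binomial-vanish {n} ℕ.≤-refl)) (zeroˡ _)) ⟨
        ∑ (suc (suc n)) (λ i → binomial n i * s i)
          ≈⟨ ∑-head (suc n) _ ⟩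
        1# * s 0 + ∑ (suc n) (λ i → binomial n (suc i) * s (suc i)) ∎

    expansion-b : ∀ n L → expansion n L * (1# - b * p ^ L) ≈ expansion (suc n) (suc L)
    expansion-b n L = begin
      expansion n L * (1# - b * p ^ L)
        ≈⟨ solve 3 (λ e a x → e :* (con (+ 1) :- a :* x) := :- a :* x :* e :+ e) refl _ _ _ ⟩
      - b * p ^ L * expansion n L + expansion n L
        ≈⟨ +-congʳ (sym (∑-*ˡ (suc n) _ _)) ⟩
      ∑ (suc n) (λ i → - b * p ^ L * (binomial n i * shifted L i)) + expansion n L
        ≈⟨ +-congʳ (∑-cong (suc n) λ i → trans
             (solve 3 (λ c b s → c :* (b :* s) := b :* (c :* s)) refl _ _ _)
             (*-congˡ (b-shift L i))) ⟩
      ∑ (suc n) (λ i → binomial n i * (p ^ i * s i)) + expansion n L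
        ≈⟨ +-congʳ extend ⟩
      (s 0 + ∑ (suc n) (λ i → binomial n (suc i) * (p ^ suc i * s (suc i)))) + expansion n L
        ≈⟨ trans (+-assoc _ _ _) (+-congˡ (sym (∑-+ (suc n) _ _))) ⟩
      s 0 + ∑ (suc n) (λ i → binomial n (suc i) * (p ^ suc i * s (suc i)) + binomial n i * s (suc i))
        ≈⟨ +-cong (sym (*-identityˡ _)) (∑-cong (suc n) λ i →
             solve 4 (λ x c b s → x :* (c :* s) :+ b :* s := (b :+ c :* x) :* s) refl _ _ _ _) ⟩
      1# * s 0 + ∑ (suc n) (λ i → binomial (suc n) (suc i) * s (suc i))
        ≈⟨ ∑-head (suc n) _ ⟨
      expansion (suc n) (suc L) ∎
      where
      s = shifted (suc L)
      extend : ∑ (suc n) (λ i → binomial n i * (p ^ i * s i))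
             ≈ s 0 + ∑ (suc n) (λ i → binomial n (suc i) * (p ^ suc i * s (suc i)))
      extend = begin
        ∑ (suc n) (λ i → binomial n i * (p ^ i * s i))
          ≈⟨ +-identityʳ _ ⟨
        ∑ (suc n) (λ i → binomial n i * (p ^ i * s i)) + 0#
          ≈⟨ +-congˡ (trans (*-congʳ (binomial-vanish {n} ℕ.≤-refl)) (zeroˡ _)) ⟨
        ∑ (suc (suc n)) (λ i → binomial n i * (p ^ i * s i))
          ≈⟨ ∑-head (suc n) _ ⟩
        1# * (1# * s 0) + ∑ (suc n) (λ i → binomial n (suc i) * (p ^ suc i * s (suc i)))
          ≈⟨ +-congʳ (solve 1 (λ x → con (+ 1) :* (con (+ 1) :* x) := x) refl _) ⟩
        s 0 + ∑ (suc n) (λ i → binomial n (suc i) * (p ^ suc i * s (suc i))) ∎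

    -- Cauchy's finite form of the triple product, built one factor at a time. A factor with `b`
    -- also moves the origin `L`, because it adds a term on the negative side.
    finite-triple-product : ∀ M L → ⟨ a ⨾ p ⟩ M * ⟨ b ⨾ p ⟩ L ≈ expansion (M ℕ.+ L) L
    finite-triple-product zero zero =
      solve 0 (con (+ 1) :* con (+ 1) := con (+ 0) :+ con (+ 1) :* (con (+ 1) :* con (+ 1))) refl
    finite-triple-product zero (suc L) = begin
      1# * (⟨ b ⨾ p ⟩ L * (1# - b * p ^ L))  ≈⟨ *-assoc _ _ _ ⟨
      1# * ⟨ b ⨾ p ⟩ L * (1# - b * p ^ L)    ≈⟨ *-congʳ (finite-triple-product zero L) ⟩
      expansion L L * (1# - b * p ^ L)       ≈⟨ expansion-b L L ⟩
      expansion (suc L) (suc L)              ∎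
    finite-triple-product (suc M) L = begin
      ⟨ a ⨾ p ⟩ M * (1# - a * p ^ M) * ⟨ b ⨾ p ⟩ L
        ≈⟨ solve 3 (λ x y z → x :* y :* z := x :* z :* y) refl _ _ _ ⟩
      ⟨ a ⨾ p ⟩ M * ⟨ b ⨾ p ⟩ L * (1# - a * p ^ M)  ≈⟨ *-congʳ (finite-triple-product M L) ⟩
      expansion (M ℕ.+ L) L * (1# - a * p ^ M)      ≈⟨ expansion-a M L ⟩
      expansion (suc (M ℕ.+ L)) L                   ∎

    ∑-shifted : ∀ L M → ∑ (L ℕ.+ M) (shifted L) ≈ ∑ℤ L M θ-term
    ∑-shifted zero    M = sym (+-identityˡ _)
    ∑-shifted (suc L) M = begin
      ∑ (suc (L ℕ.+ M)) (shifted (suc L))               ≈⟨ ∑-head (L ℕ.+ M) _ ⟩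
      θ-term -[1+ L ] + ∑ (L ℕ.+ M) (shifted L)         ≈⟨ +-congˡ (∑-shifted L M) ⟩
      θ-term -[1+ L ] + ∑ℤ L M θ-term
        ≈⟨ solve 3 (λ x y z → x :+ (y :+ z) := (y :+ x) :+ z) refl _ _ _ ⟩
      ∑ℤ (suc L) M θ-term ∎

    -- In the finite form every Gaussian binomial next to a nonzero term is the inverse of `P`, once
    -- the number of factors is large; multiplication by `P` removes them all.
    triple-product : ∀ {N S} → p ^ N ≈ 0# → Supported S θ-term →
      θ-term ⇓ ⟨ a ⨾ p ⟩ N * ⟨ b ⨾ p ⟩ N * ⟨ p ⨾ p ⟩ N
    triple-product {N} {S} pᴺ≈0 supp = ⇓-cong (λ _ → refl) value (supported⇒⇓ θ-term supp)
      where
      -- `R - S = N`: outside `N < i ≤ R + S` the shifted terms vanish, and inside both `i` and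
      -- `2R - i` are at least `N`, where the binomial times `P` is 1.
      R = N ℕ.+ S
      N≤R : N ℕ.≤ R
      N≤R = ℕ.m≤m+n N S
      S≤R : S ℕ.≤ R
      S≤R = ℕ.m≤n+m S N
      P = factorial N

      binomial-limit : ∀ i j → N ℕ.≤ i → N ℕ.≤ j → binomial (i ℕ.+ j) i * P ≈ 1#
      binomial-limit i j N≤i N≤j = invertible-cancel (⟨⟩-invertible {p} {p} {N} pᴺ≈0 N) (begin
        P * (binomial (i ℕ.+ j) i * P)
          ≈⟨ solve 2 (λ P b → P :* (b :* P) := b :* P :* P) refl _ _ ⟩
        binomial (i ℕ.+ j) i * P * P
          ≈⟨ *-cong (*-congˡ (⟨⟩-stable pᴺ≈0 N≤i)) (⟨⟩-stable pᴺ≈0 N≤j) ⟨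
        binomial (i ℕ.+ j) i * factorial i * factorial j
          ≈⟨ binomial-factorial i j ⟩
        factorial (i ℕ.+ j)
          ≈⟨ ⟨⟩-stable pᴺ≈0 (ℕ.≤-trans N≤i (ℕ.m≤m+n i j)) ⟩
        P
          ≈⟨ *-identityʳ P ⟨
        P * 1# ∎)

      vanish : ∀ i → S ℕ.≤ ℤ.∣ i ℤ.⊖ R ∣ → binomial (R ℕ.+ R) i * shifted R i * P ≈ shifted R i
      vanish i far = begin
        binomial (R ℕ.+ R) i * shifted R i * P  ≈⟨ *-congʳ (*-congˡ s≈0) ⟩
        binomial (R ℕ.+ R) i * 0# * P
          ≈⟨ solve 2 (λ x y → x :* con (+ 0) :* y := con (+ 0)) refl _ _ ⟩
        0#                                      ≈⟨ s≈0 ⟨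
        shifted R i                             ∎
        where
        s≈0 : shifted R i ≈ 0#
        s≈0 = trans (reflexive (shifted-⊖ R i)) (supp (i ℤ.⊖ R) far)

      term : ∀ i → binomial (R ℕ.+ R) i * shifted R i * P ≈ shifted R i
      term i with i ℕ.≤? N | i ℕ.≤? R ℕ.+ S
      ... | yes i≤N | _ = vanish i (≡.subst (S ℕ.≤_) (≡.sym (ℤ.∣⊖∣-≤ (ℕ.≤-trans i≤N N≤R)))
        (ℕ.≤-trans (ℕ.≤-reflexive (≡.sym (ℕ.m+n∸m≡n N S))) (ℕ.∸-monoʳ-≤ R i≤N)))
      ... | no _ | no i≰R+S = vanish i (≡.subst (S ℕ.≤_)
        (≡.trans (≡.sym (ℤ.∣⊖∣-≤ (ℕ.≤-trans (ℕ.m≤m+n R S) R+S≤i))) (ℤ.∣m⊖n∣≡∣n⊖m∣ R i))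
        (ℕ.≤-trans (ℕ.≤-reflexive (≡.sym (ℕ.m+n∸m≡n R S))) (ℕ.∸-monoˡ-≤ R R+S≤i)))
        where R+S≤i = ℕ.<⇒≤ (ℕ.≰⇒> i≰R+S)
      ... | no i≰N | yes i≤R+S = begin
        binomial (R ℕ.+ R) i * shifted R i * P
          ≈⟨ solve 3 (λ b s P → b :* s :* P := (b :* P) :* s) refl _ _ _ ⟩
        binomial (R ℕ.+ R) i * P * shifted R i
          ≡⟨ ≡.cong (λ n → binomial n i * P * shifted R i) (ℕ.m+[n∸m]≡n i≤2R) ⟨
        binomial (i ℕ.+ j) i * P * shifted R i
          ≈⟨ *-congʳ (binomial-limit i j (ℕ.<⇒≤ (ℕ.≰⇒> i≰N)) N≤j) ⟩
        1# * shifted R i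
          ≈⟨ *-identityˡ _ ⟩
        shifted R i ∎
        where
        j = R ℕ.+ R ℕ.∸ i
        i≤2R : i ℕ.≤ R ℕ.+ R
        i≤2R = ℕ.≤-trans i≤R+S (ℕ.+-monoʳ-≤ R S≤R)
        N≤j : N ℕ.≤ j
        N≤j = ℕ.≤-trans (ℕ.≤-reflexive (≡.trans (≡.sym (ℕ.m+n∸n≡m N S))
          (≡.sym (ℕ.[m+n]∸[m+o]≡n∸o R R S)))) (ℕ.∸-monoʳ-≤ (R ℕ.+ R) i≤R+S)

      value : ∑ℤ S S θ-term ≈ ⟨ a ⨾ p ⟩ N * ⟨ b ⨾ p ⟩ N * P
      value = begin
        ∑ℤ S S θ-term
          -- The expansion has `2R + 1` terms, with indices from `-R` to `R`; hence the unequal ends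
          -- `R` and `suc R`.
          ≈⟨ _⇓_.constant (supported⇒⇓ θ-term supp) R (suc R) S≤R (ℕ.m≤n⇒m≤1+n S≤R) ⟨
        ∑ℤ R (suc R) θ-term
          ≈⟨ ∑-shifted R (suc R) ⟨
        ∑ (R ℕ.+ suc R) (shifted R)
          ≡⟨ ≡.cong (λ n → ∑ n (shifted R)) (ℕ.+-suc R R) ⟩
        ∑ (suc (R ℕ.+ R)) (shifted R)
          ≈⟨ ∑-cong (suc (R ℕ.+ R)) term ⟨
        ∑ (suc (R ℕ.+ R)) (λ i → binomial (R ℕ.+ R) i * shifted R i * P)
          ≈⟨ ∑-cong (suc (R ℕ.+ R)) (λ i → *-comm P _) ⟨
        ∑ (suc (R ℕ.+ R)) (λ i → P * (binomial (R ℕ.+ R) i * shifted R i))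
          ≈⟨ ∑-*ˡ (suc (R ℕ.+ R)) P _ ⟩
        P * expansion (R ℕ.+ R) R
          ≈⟨ trans (*-comm _ _) (*-congʳ (sym (finite-triple-product R R))) ⟩
        ⟨ a ⨾ p ⟩ R * ⟨ b ⨾ p ⟩ R * P
          ≈⟨ *-congʳ (*-cong (⟨⟩-stable pᴺ≈0 N≤R) (⟨⟩-stable pᴺ≈0 N≤R)) ⟩
        ⟨ a ⨾ p ⟩ N * ⟨ b ⨾ p ⟩ N * P ∎

-- Commutative rings from one-sided laws, and the dual numbers

module CommutativeRingLaws
  {A : Set} (_≈_ : A → A → Set) (_+_ _*_ : A → A → A) (-_ : A → A) (0# 1# : A)
  (≈-equiv : IsEquivalence _≈_)
  (+-cong : ∀ {x y u v} → x ≈ y → u ≈ v → (x + u) ≈ (y + v))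
  (*-cong : ∀ {x y u v} → x ≈ y → u ≈ v → (x * u) ≈ (y * v))
  (neg-cong : ∀ {x y} → x ≈ y → (- x) ≈ (- y))
  (+-assoc : ∀ x y z → ((x + y) + z) ≈ (x + (y + z)))
  (+-comm : ∀ x y → (x + y) ≈ (y + x))
  (+-identityˡ : ∀ x → (0# + x) ≈ x)
  (+-inverseˡ : ∀ x → ((- x) + x) ≈ 0#)
  (*-assoc : ∀ x y z → ((x * y) * z) ≈ (x * (y * z)))
  (*-comm : ∀ x y → (x * y) ≈ (y * x))
  (*-identityˡ : ∀ x → (1# * x) ≈ x)
  (distribʳ : ∀ x y z → ((y + z) * x) ≈ ((y * x) + (z * x)))
  where

  open IsEquivalence ≈-equiv

  commutativeRing : CommutativeRing 0ℓ 0ℓ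
  commutativeRing = record
    { Carrier = A ; _≈_ = _≈_ ; _+_ = _+_ ; _*_ = _*_ ; -_ = -_ ; 0# = 0# ; 1# = 1#
    ; isCommutativeRing = record
      { isRing = record
        { +-isAbelianGroup = record
          { isGroup = record
            { isMonoid = record
              { isSemigroup = record
                { isMagma = record { isEquivalence = ≈-equiv ; ∙-cong = +-cong }
                ; assoc = +-assoc }
              ; identity = +-identityˡ , λ x → trans (+-comm x 0#) (+-identityˡ x) }
            ; inverse = +-inverseˡ , λ x → trans (+-comm x (- x)) (+-inverseˡ x)
            ; ⁻¹-cong = neg-cong }
          ; comm = +-comm }
        ; *-cong = *-cong
        ; *-assoc = *-assoc
        ; *-identity = *-identityˡ , λ x → trans (*-comm x 1#) (*-identityˡ x)
        ; distrib = (λ x y z → trans (*-comm x (y + z))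
                      (trans (distribʳ x y z) (+-cong (*-comm y x) (*-comm z x))))
                  , distribʳ }
      ; *-comm = *-comm } }

module DualNumbers (K : CommutativeRing 0ℓ 0ℓ) where
  open CommutativeRing K hiding (zero)
  open IntegerMultiples K
  open Sums K
  open import Relation.Binary.Reasoning.Setoid setoid
  open Solver
  open import Algebra.Properties.CommutativeSemiring.Exp commutativeSemiring using (_^_)

  -- (x , y) stands for x + y ε with ε² = 0.
  K[ε] : CommutativeRing 0ℓ 0ℓ
  K[ε] = CommutativeRingLaws.commutativeRing {Carrier × Carrier}
    (λ (a , b) (c , d) → a ≈ c × b ≈ d)
    (λ (a , b) (c , d) → a + c , b + d)
    (λ (a , b) (c , d) → a * c , a * d + b * c)
    (λ (a , b) → - a , - b)
    (0# , 0#) (1# , 0#)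
    (record { refl = refl , refl ; sym = λ (p , q) → sym p , sym q
            ; trans = λ (p , q) (r , s) → trans p r , trans q s })
    (λ (p , q) (r , s) → +-cong p r , +-cong q s)
    (λ (p , q) (r , s) → *-cong p r , +-cong (*-cong p s) (*-cong q r))
    (λ (p , q) → -‿cong p , -‿cong q)
    (λ _ _ _ → +-assoc _ _ _ , +-assoc _ _ _)
    (λ _ _ → +-comm _ _ , +-comm _ _)
    (λ _ → +-identityˡ _ , +-identityˡ _)
    (λ _ → -‿inverseˡ _ , -‿inverseˡ _)
    (λ (a , b) (c , d) (e , f) → *-assoc a c e ,
      solve 6 (λ a b c d e f → (a :* c) :* f :+ (a :* d :+ b :* c) :* e
        := a :* (c :* f :+ d :* e) :+ b :* (c :* e)) refl a b c d e f)
    (λ (a , b) (c , d) → *-comm a c ,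
      solve 4 (λ a b c d → a :* d :+ b :* c := c :* b :+ d :* a) refl a b c d)
    (λ (a , b) → *-identityˡ a ,
      solve 2 (λ a b → con (+ 1) :* b :+ con (+ 0) :* a := b) refl a b)
    (λ (a , b) (c , d) (e , f) → distribʳ a c e ,
      solve 6 (λ a b c d e f → (c :+ e) :* b :+ (d :+ f) :* a
        := (c :* b :+ d :* a) :+ (e :* b :+ f :* a)) refl a b c d e f)

  private
    module ε = CommutativeRing K[ε]
    module Sε = Sums K[ε]
    open import Algebra.Properties.CommutativeSemiring.Exp ε.commutativeSemiring
      using () renaming (_^_ to _^ε_)

  proj-∑ : ∀ n f → Sε.∑ n f ε.≈ (∑ n (λ i → proj₁ (f i)) , ∑ n (λ i → proj₂ (f i)))
  proj-∑ zero    f = refl , refl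
  proj-∑ (suc n) f = +-congʳ (proj₁ (proj-∑ n f)) , +-congʳ (proj₂ (proj-∑ n f))

  proj₁-⇓ : ∀ {f x y} → f Sε.⇓ (x , y) → (λ n → proj₁ (f n)) ⇓ x
  proj₁-⇓ {f} (Sε.eventually N c) = eventually N λ a b a≥ b≥ →
    trans (sym (+-cong (proj₁ (proj-∑ a λ k → f -[1+ k ])) (proj₁ (proj-∑ b λ k → f (+ k)))))
      (proj₁ (c a b a≥ b≥))

  proj₂-⇓ : ∀ {f x y} → f Sε.⇓ (x , y) → (λ n → proj₂ (f n)) ⇓ y
  proj₂-⇓ {f} (Sε.eventually N c) = eventually N λ a b a≥ b≥ →
    trans (sym (+-cong (proj₂ (proj-∑ a λ k → f -[1+ k ])) (proj₂ (proj-∑ b λ k → f (+ k)))))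
      (proj₂ (c a b a≥ b≥))

  -- The base is `x (1 + c ε)` and `(1 + c ε)^n = 1 + n c ε`. Writing the ε-part as a multiple of
  -- `x` avoids the power `x^(n-1)`.
  ε-power : ∀ x c n → (x , x * c) ^ε n ε.≈ (x ^ n , ι (+ n) * c * x ^ n)
  ε-power x c zero    = refl , solve 1 (λ c → con (+ 0) := con (+ 0) :* c :* con (+ 1)) refl c
  ε-power x c (suc n) = *-congˡ (proj₁ (ε-power x c n)) , (begin
    x * proj₂ ((x , x * c) ^ε n) + x * c * proj₁ ((x , x * c) ^ε n)
      ≈⟨ +-cong (*-congˡ (proj₂ (ε-power x c n))) (*-congˡ (proj₁ (ε-power x c n))) ⟩
    x * (ι (+ n) * c * x ^ n) + x * c * x ^ n
      ≈⟨ solve 4 (λ x c n y → x :* (n :* c :* y) :+ x :* c :* y := (con (+ 1) :+ n) :* c :* (x :* y)) refl x c _ _ ⟩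
    (1# + ι (+ n)) * c * (x * x ^ n)
      ≈⟨ *-congʳ (*-congʳ (ι-+ (+ 1) (+ n))) ⟨
    ι (+ suc n) * c * x ^ suc n ∎)

-- Jacobi's series for the cube of the Euler product

module Jacobi (K : CommutativeRing 0ℓ 0ℓ) (q : CommutativeRing.Carrier K) where
  open CommutativeRing K hiding (zero)
  open IntegerMultiples K
  open Sums K
  open TripleProduct K
  open DualNumbers K
  open import Algebra.Properties.CommutativeSemiring.Exp commutativeSemiring
    using (_^_; ^-homo-*; ^-distrib-*; ^-congˡ)
  open import Relation.Binary.Reasoning.Setoid setoid
  open Solver

  sgn : ℤ → Carrier
  sgn n = (- 1#) ^ ℤ.∣ n ∣

  choose₂ : ℤ → ℕ
  choose₂ (+ n)    = triangle n
  choose₂ -[1+ n ] = triangle (suc (suc n))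

  u : ℤ → Carrier
  u n = sgn n * q ^ choose₂ n

  triangle-≥ : ∀ n → n ℕ.≤ suc (triangle n)
  triangle-≥ zero    = ℕ.z≤n
  triangle-≥ (suc n) = ℕ.s≤s (ℕ.m≤m+n n (triangle n))

  module _ {N} (qᴺ≈0 : q ^ N ≈ 0#) where
    -- At a positive index `n` the exponent `n (n - 1) / 2` is at least `n - 1` but not always `n`;
    -- hence `suc N`.
    u-supported : Supported (suc N) u
    u-supported n N<∣n∣ = trans (*-congˡ (^-vanish qᴺ≈0 (go n N<∣n∣))) (zeroʳ _)
      where
      go : ∀ n → suc N ℕ.≤ ℤ.∣ n ∣ → N ℕ.≤ choose₂ n
      go (+ n)    N<n = ℕ.≤-pred (ℕ.≤-trans N<n (triangle-≥ n))
      go -[1+ n ] N<n = ℕ.≤-trans (ℕ.≤-trans (ℕ.n≤1+n N) N<n) (ℕ.m≤m+n (suc n) (triangle (suc n)))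

  private
    module ε = CommutativeRing K[ε]
    module Tε = TripleProduct K[ε]
    module Sε = Sums K[ε]
    open import Algebra.Properties.CommutativeSemiring.Exp ε.commutativeSemiring
      using () renaming (_^_ to _^ε_; ^-cong to ^ε-cong; ^-congˡ to ^ε-congˡ)

    -- The inverse of `1 + ε` is `1 - ε`, so `q / z` is `q - q ε`.
    z q/z qε : ε.Carrier
    z   = 1# , 1#
    q/z = q , - q
    qε  = q , 0#

    z*q/z≈q : z ε.* q/z ε.≈ qε
    z*q/z≈q = *-identityˡ q , solve 1 (λ q → con (+ 1) :* :- q :+ con (+ 1) :* q := con (+ 0)) refl q

    open Tε.Theta z q/z qε z*q/z≈q using () renaming (θ-term to t; triple-product to triple-product-ε)

    q-power : ∀ n → qε ^ε n ε.≈ (q ^ n , 0#)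
    q-power n = ε.trans (^ε-congˡ n (refl , sym (zeroʳ q))) (ε.trans (ε-power q 0# n)
      (refl , solve 2 (λ n x → n :* con (+ 0) :* x := con (+ 0)) refl _ _))

    power-term : ∀ x c n k →
      (x , x * c) ^ε n ε.* qε ^ε k ε.≈ (x ^ n * q ^ k , ι (+ n) * c * (x ^ n * q ^ k))
    power-term x c n k = ε.trans (ε.*-cong (ε-power x c n) (q-power k))
      (refl , solve 4 (λ n c x y → x :* con (+ 0) :+ n :* c :* x :* y := n :* c :* (x :* y)) refl _ _ _ _)

    -q^n : ∀ n k → (- q) ^ n * q ^ k ≈ (- 1#) ^ n * q ^ (n ℕ.+ k)
    -q^n n k = begin
      (- q) ^ n * q ^ k
        ≈⟨ *-congʳ (^-congˡ n (solve 1 (λ q → :- q := :- con (+ 1) :* q) refl q)) ⟩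
      (- 1# * q) ^ n * q ^ k           ≈⟨ *-congʳ (^-distrib-* (- 1#) q n) ⟩
      (- 1#) ^ n * q ^ n * q ^ k       ≈⟨ *-assoc _ _ _ ⟩
      (- 1#) ^ n * (q ^ n * q ^ k)     ≈⟨ *-congˡ (^-homo-* q n k) ⟨
      (- 1#) ^ n * q ^ (n ℕ.+ k)       ∎

    -- The n-th power of `z` contributes `1 + n ε`. At a negative index the base is `q (1 - ε)`,
    -- which again gives the weight `ι n`, and its powers of `q` complete `triangle (suc n)` to
    -- `choose₂`.
    t≈ : ∀ n → t n ε.≈ (u n , ι n * u n)
    t≈ (+ n) = ε.trans (ε.*-congʳ (^ε-congˡ n (refl , sym (*-identityʳ (- 1#)))))
      (ε.trans (power-term (- 1#) 1# n (triangle n)) (refl , *-congʳ (*-identityʳ _)))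
    t≈ -[1+ n ] = ε.trans
      (ε.*-congʳ (^ε-congˡ (suc n) (refl , solve 1 (λ q → :- :- q := :- q :* :- con (+ 1)) refl q)))
      (ε.trans (power-term (- q) (- 1#) (suc n) (triangle (suc n)))
        (-q^n (suc n) (triangle (suc n))
        , *-cong (solve 1 (λ n → n :* :- con (+ 1) := :- n) refl _) (-q^n (suc n) (triangle (suc n)))))

    -- The factor at 0 is `1 - z = - ε`. As `ε² = 0`, only the constant parts `1 - q^j` of the other
    -- factors survive; the removal of that factor shifts the count by one.
    ⟨z⟩ : ∀ n → Tε.⟨ z ⨾ qε ⟩ (suc n) ε.≈ (0# , - ⟨ q ⨾ q ⟩ n)
    ⟨z⟩ zero = solve 0 (con (+ 1) :* (con (+ 1) :- con (+ 1) :* con (+ 1)) := con (+ 0)) refl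
             , solve 0 (con (+ 1) :* (con (+ 0) :- (con (+ 1) :* con (+ 0) :+ con (+ 1) :* con (+ 1)))
                 :+ con (+ 0) :* (con (+ 1) :- con (+ 1) :* con (+ 1)) := :- con (+ 1)) refl
    ⟨z⟩ (suc n) =
      trans (*-congʳ (proj₁ (⟨z⟩ n))) (zeroˡ _) ,
      (begin
        proj₁ P * proj₂ w + proj₂ P * (1# - 1# * proj₁ (qε ^ε suc n))
          ≈⟨ +-cong (*-congʳ (proj₁ (⟨z⟩ n))) (*-cong (proj₂ (⟨z⟩ n))
               (+-congˡ (-‿cong (*-congˡ (proj₁ (q-power (suc n))))))) ⟩
        0# * proj₂ w + - A * (1# - 1# * q ^ suc n)
          ≈⟨ solve 3 (λ w a x → con (+ 0) :* w :+ :- a :* (con (+ 1) :- con (+ 1) :* x)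
               := :- (a :* (con (+ 1) :- x))) refl (proj₂ w) A (q ^ suc n) ⟩
        - (A * (1# - q * q ^ n)) ∎)
      where
      A = ⟨ q ⨾ q ⟩ n
      P = Tε.⟨ z ⨾ qε ⟩ (suc n)
      w = ε.1# ε.- z ε.* qε ^ε suc n

    proj₁-⟨⟩ : ∀ y n → proj₁ (Tε.⟨ (q , y) ⨾ qε ⟩ n) ≈ ⟨ q ⨾ q ⟩ n
    proj₁-⟨⟩ y zero    = refl
    proj₁-⟨⟩ y (suc n) = *-cong (proj₁-⟨⟩ y n) (+-congˡ (-‿cong (*-congˡ (proj₁ (q-power n)))))

  module _ {N} (qᴺ≈0 : q ^ N ≈ 0#) where
    private
      A = ⟨ q ⨾ q ⟩ N

      -- The first product is `- A ε`, so the other two enter only through their constant parts,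
      -- each equal to `A`.
      product : Tε.⟨ z ⨾ qε ⟩ (suc N) ε.* Tε.⟨ q/z ⨾ qε ⟩ (suc N) ε.* Tε.⟨ qε ⨾ qε ⟩ (suc N)
        ε.≈ (0# , - (A ^ 3))
      product =
        trans (*-congʳ (trans (*-congʳ (proj₁ (⟨z⟩ N))) (zeroˡ _))) (zeroˡ _) ,
        (begin
          proj₁ W * X * Z′ + (proj₁ W * Y′ + proj₂ W * X) * Z
            ≈⟨ +-cong (*-congʳ (*-congʳ (proj₁ (⟨z⟩ N))))
                 (*-cong (+-cong (*-congʳ (proj₁ (⟨z⟩ N))) (*-cong (proj₂ (⟨z⟩ N)) (stable (- q)))) (stable 0#)) ⟩
          0# * X * Z′ + (0# * Y′ + - A * A) * A
            ≈⟨ solve 4 (λ x y z a → con (+ 0) :* x :* z :+ (con (+ 0) :* y :+ :- a :* a) :* a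
                 := :- (a :* (a :* (a :* con (+ 1))))) refl X Y′ Z′ A ⟩
          - (A ^ 3) ∎)
        where
        W = Tε.⟨ z ⨾ qε ⟩ (suc N)
        X = proj₁ (Tε.⟨ q/z ⨾ qε ⟩ (suc N))
        Y′ = proj₂ (Tε.⟨ q/z ⨾ qε ⟩ (suc N))
        Z = proj₁ (Tε.⟨ qε ⨾ qε ⟩ (suc N))
        Z′ = proj₂ (Tε.⟨ qε ⨾ qε ⟩ (suc N))
        stable : ∀ y → proj₁ (Tε.⟨ (q , y) ⨾ qε ⟩ (suc N)) ≈ A
        stable y = trans (proj₁-⟨⟩ y (suc N)) (⟨⟩-stable qᴺ≈0 (ℕ.n≤1+n N))

      t-supported : Sε.Supported (suc N) t
      t-supported n n≥ = trans (proj₁ (t≈ n)) (u-supported {N} qᴺ≈0 n n≥)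
        , trans (proj₂ (t≈ n)) (trans (*-congˡ (u-supported {N} qᴺ≈0 n n≥)) (zeroʳ _))

      qε-nilpotent : qε ^ε suc N ε.≈ ε.0#
      qε-nilpotent = trans (proj₁ (q-power (suc N))) (^-vanish {q} {N} qᴺ≈0 (ℕ.n≤1+n N))
        , proj₂ (q-power (suc N))

      series : t Sε.⇓ (Tε.⟨ z ⨾ qε ⟩ (suc N) ε.* Tε.⟨ q/z ⨾ qε ⟩ (suc N) ε.* Tε.⟨ qε ⨾ qε ⟩ (suc N))
      series = triple-product-ε {suc N} {suc N} qε-nilpotent t-supported

    ∑u : u ⇓ 0#
    ∑u = ⇓-cong (λ n → proj₁ (t≈ n)) (proj₁ product) (proj₁-⇓ series)

    ∑nu : (λ n → ι n * u n) ⇓ - (A ^ 3)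
    ∑nu = ⇓-cong (λ n → proj₂ (t≈ n)) (proj₂ product) (proj₂-⇓ series)

-- The double series

-- Exponents with denominator 2 are compared after doubling, where they are integer polynomials
-- within reach of the ring solver.
double-injective : ∀ m n → + 2 ℤ.* + m ≡ + 2 ℤ.* + n → m ≡ n
double-injective m n e = ℤ.+-injective (ℤ.*-cancelˡ-≡ (+ 2) (+ m) (+ n) e)

square : ℤ → ℕ
square n = ℤ.∣ n ∣ ℕ.* ℤ.∣ n ∣

-- n (3 n + 1) / 2
pentagonal : ℤ → ℕ
pentagonal (+ n)    = 2 ℕ.* n ℕ.+ 3 ℕ.* triangle n
pentagonal -[1+ n ] = suc n ℕ.+ 3 ℕ.* triangle (suc n)

triangle-double : ∀ n → + 2 ℤ.* + triangle n ≡ + n ℤ.* (+ n ℤ.+ ℤ.- (+ 1))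
triangle-double zero    = ≡.refl
triangle-double (suc n) = ≡.trans (expand (+ n) (+ triangle n))
  (≡.trans (≡.cong (λ i → + 2 ℤ.* + n ℤ.+ i) (triangle-double n)) (collect (+ n)))
  where
  expand : ∀ n t → + 2 ℤ.* (n ℤ.+ t) ≡ + 2 ℤ.* n ℤ.+ + 2 ℤ.* t
  expand = ℤ-Ring.solve-∀
  collect : ∀ n → + 2 ℤ.* n ℤ.+ n ℤ.* (n ℤ.+ ℤ.- (+ 1)) ≡ (+ 1 ℤ.+ n) ℤ.* (+ 1 ℤ.+ n ℤ.+ ℤ.- (+ 1))
  collect = ℤ-Ring.solve-∀

square-spec : ∀ n → + square n ≡ n ℤ.* n
square-spec (+ n)    = ℤ.pos-* n n
square-spec -[1+ n ] = ≡.refl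

pentagonal-double : ∀ n → + 2 ℤ.* + pentagonal n ≡ + 3 ℤ.* (n ℤ.* n) ℤ.+ n
pentagonal-double (+ n) = ≡.trans
  (≡.cong (λ i → + 2 ℤ.* i) (≡.cong₂ ℤ._+_ (ℤ.pos-* 2 n) (ℤ.pos-* 3 (triangle n))))
  (≡.trans (expand (+ n) (+ triangle n))
    (≡.trans (≡.cong (λ i → + 4 ℤ.* + n ℤ.+ + 3 ℤ.* i) (triangle-double n)) (collect (+ n))))
  where
  expand : ∀ n t → + 2 ℤ.* (+ 2 ℤ.* n ℤ.+ + 3 ℤ.* t) ≡ + 4 ℤ.* n ℤ.+ + 3 ℤ.* (+ 2 ℤ.* t)
  expand = ℤ-Ring.solve-∀
  collect : ∀ n → + 4 ℤ.* n ℤ.+ + 3 ℤ.* (n ℤ.* (n ℤ.+ ℤ.- (+ 1))) ≡ + 3 ℤ.* (n ℤ.* n) ℤ.+ n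
  collect = ℤ-Ring.solve-∀
pentagonal-double -[1+ n ] = ≡.trans
  (≡.cong (λ i → + 2 ℤ.* (+ suc n ℤ.+ i)) (ℤ.pos-* 3 (triangle (suc n))))
  (≡.trans (expand (+ suc n) (+ triangle (suc n)))
    (≡.trans (≡.cong (λ i → + 2 ℤ.* + suc n ℤ.+ + 3 ℤ.* i) (triangle-double (suc n))) (collect (+ suc n))))
  where
  expand : ∀ n t → + 2 ℤ.* (n ℤ.+ + 3 ℤ.* t) ≡ + 2 ℤ.* n ℤ.+ + 3 ℤ.* (+ 2 ℤ.* t)
  expand = ℤ-Ring.solve-∀
  collect : ∀ n → + 2 ℤ.* n ℤ.+ + 3 ℤ.* (n ℤ.* (n ℤ.+ ℤ.- (+ 1))) ≡ + 3 ℤ.* (ℤ.- n ℤ.* ℤ.- n) ℤ.+ ℤ.- n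
  collect = ℤ-Ring.solve-∀

pentagonal-≥ : ∀ n → ℤ.∣ n ∣ ℕ.≤ pentagonal n
pentagonal-≥ (+ n)    = ℕ.≤-trans (ℕ.m≤m+n n (n ℕ.+ 0)) (ℕ.m≤m+n _ _)
pentagonal-≥ -[1+ n ] = ℕ.m≤m+n (suc n) _

square-≥ : ∀ n → ℤ.∣ n ∣ ℕ.≤ square n
square-≥ n with ℤ.∣ n ∣
... | zero  = ℕ.z≤n
... | suc k = ℕ.m≤m*n (suc k) (suc k)

∣l∣-bound : ∀ {K N} l j → ℤ.∣ l ℤ.+ ℤ.- (+ 2 ℤ.* j) ∣ ℕ.< K → ℤ.∣ j ∣ ℕ.≤ N → ℤ.∣ l ∣ ℕ.< K ℕ.+ (N ℕ.+ N)
∣l∣-bound {K} {N} l j near j≤N = begin-strict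
  ℤ.∣ l ∣
    ≡⟨ ≡.cong ℤ.∣_∣ (lem l j) ⟩
  ℤ.∣ l ℤ.+ ℤ.- (+ 2 ℤ.* j) ℤ.+ (j ℤ.+ j) ∣
    ≤⟨ ℤ.∣i+j∣≤∣i∣+∣j∣ (l ℤ.+ ℤ.- (+ 2 ℤ.* j)) (j ℤ.+ j) ⟩
  ℤ.∣ l ℤ.+ ℤ.- (+ 2 ℤ.* j) ∣ ℕ.+ ℤ.∣ j ℤ.+ j ∣
    <⟨ ℕ.+-mono-<-≤ near (ℕ.≤-trans (ℤ.∣i+j∣≤∣i∣+∣j∣ j j) (ℕ.+-mono-≤ j≤N j≤N)) ⟩
  K ℕ.+ (N ℕ.+ N) ∎
  where
  open ℕ.≤-Reasoning
  lem : ∀ l j → l ≡ l ℤ.+ ℤ.- (+ 2 ℤ.* j) ℤ.+ (j ℤ.+ j)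
  lem = ℤ-Ring.solve-∀

module Series (K : CommutativeRing 0ℓ 0ℓ) (q : CommutativeRing.Carrier K) (N : ℕ)
  (qᴺ≈0 : CommutativeRing._≈_ K (Exp._^_ (CommutativeRing.commutativeSemiring K) q N) (CommutativeRing.0# K)) where
  open CommutativeRing K hiding (zero)
  open import Algebra.Properties.Ring ring using (-‿involutive; -1*x≈-x)
  open IntegerMultiples K
  open Sums K
  open TripleProduct K
  open Jacobi K q
  open import Algebra.Properties.CommutativeSemiring.Exp commutativeSemiring
    using (_^_; ^-homo-*; ^-distrib-*; ^-congˡ; ^-assocʳ)
  open import Relation.Binary.Reasoning.Setoid setoid
  open Solver

  choose₂-double : ∀ n → + 2 ℤ.* + choose₂ n ≡ n ℤ.* (n ℤ.+ ℤ.- (+ 1))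
  choose₂-double (+ n)    = triangle-double n
  choose₂-double -[1+ n ] = ≡.trans (triangle-double (suc (suc n))) (flip (+ n))
    where
    flip : ∀ n → (+ 2 ℤ.+ n) ℤ.* (+ 2 ℤ.+ n ℤ.+ ℤ.- (+ 1))
      ≡ ℤ.- (+ 1 ℤ.+ n) ℤ.* (ℤ.- (+ 1 ℤ.+ n) ℤ.+ ℤ.- (+ 1))
    flip = ℤ-Ring.solve-∀

  qᵏ-nilpotent : ∀ k → (q ^ suc k) ^ N ≈ 0#
  qᵏ-nilpotent k = trans (^-assocʳ q (suc k) N) (^-vanish qᴺ≈0 (ℕ.m≤m+n N (k ℕ.* N)))

  sgn-suc : ∀ n → sgn (ℤ.suc n) ≈ - sgn n
  sgn-suc (+ n)          = -1*x≈-x _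
  sgn-suc -[1+ zero ]    = solve 0 (con (+ 1) := :- (:- con (+ 1) :* con (+ 1))) refl
  sgn-suc -[1+ suc n ]   = solve 1 (λ x → x := :- (:- con (+ 1) :* x)) refl _

  sgn-neg : ∀ n → sgn (ℤ.- n) ≡ sgn n
  sgn-neg n = ≡.cong ((- 1#) ^_) (ℤ.∣-i∣≡∣i∣ n)

  sgn-+ℕ : ∀ m n → sgn (+ m ℤ.+ n) ≈ sgn (+ m) * sgn n
  sgn-+ℕ zero    n = trans (reflexive (≡.cong sgn (ℤ.+-identityˡ n))) (sym (*-identityˡ _))
  sgn-+ℕ (suc m) n = begin
    sgn (+ suc m ℤ.+ n)           ≡⟨ ≡.cong sgn (ℤ.suc-+ m n) ⟩
    sgn (ℤ.suc (+ m ℤ.+ n))       ≈⟨ sgn-suc (+ m ℤ.+ n) ⟩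
    - sgn (+ m ℤ.+ n)             ≈⟨ -‿cong (sgn-+ℕ m n) ⟩
    - (sgn (+ m) * sgn n)
      ≈⟨ solve 2 (λ x y → :- (x :* y) := :- con (+ 1) :* x :* y) refl _ _ ⟩
    sgn (+ suc m) * sgn n         ∎

  sgn-+ : ∀ m n → sgn (m ℤ.+ n) ≈ sgn m * sgn n
  sgn-+ (+ m)    n = sgn-+ℕ m n
  sgn-+ -[1+ m ] n = begin
    sgn (-[1+ m ] ℤ.+ n)
      ≡⟨ sgn-neg (-[1+ m ] ℤ.+ n) ⟨
    sgn (ℤ.- (-[1+ m ] ℤ.+ n))
      ≡⟨ ≡.cong sgn (ℤ.neg-distrib-+ -[1+ m ] n) ⟩
    sgn (+ suc m ℤ.+ ℤ.- n)
      ≈⟨ sgn-+ℕ (suc m) (ℤ.- n) ⟩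
    sgn (+ suc m) * sgn (ℤ.- n)
      ≡⟨ ≡.cong (sgn (+ suc m) *_) (sgn-neg n) ⟩
    sgn -[1+ m ] * sgn n ∎

  sgn-square : ∀ n → sgn n * sgn n ≈ 1#
  sgn-square n = trans (sym (^-distrib-* (- 1#) (- 1#) ℤ.∣ n ∣))
    (trans (^-congˡ ℤ.∣ n ∣ (solve 0 (:- con (+ 1) :* :- con (+ 1) := con (+ 1)) refl)) (1^n≈1 ℤ.∣ n ∣))

  sgn-even : ∀ m n → sgn (n ℤ.+ (m ℤ.+ m)) ≈ sgn n
  sgn-even m n = begin
    sgn (n ℤ.+ (m ℤ.+ m))    ≈⟨ trans (sgn-+ n (m ℤ.+ m)) (*-congˡ (sgn-+ m m)) ⟩
    sgn n * (sgn m * sgn m)  ≈⟨ *-congˡ (sgn-square m) ⟩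
    sgn n * 1#               ≈⟨ *-identityʳ _ ⟩
    sgn n                    ∎

  -- In each use of the triple product below, `- a` is a signed power of `q` and `p` a power of `q`,
  -- so every term is a signed monomial in `q`.
  power-term : ∀ {a p} s α c n → - a ≈ s * q ^ α → p ≈ q ^ c → ∀ k →
    (- a) ^ n * p ^ k ≈ s ^ n * q ^ (α ℕ.* n ℕ.+ c ℕ.* k)
  power-term {a} {p} s α c n a≈ p≈ k = begin
    (- a) ^ n * p ^ k
      ≈⟨ *-cong (^-congˡ n a≈) (^-congˡ k p≈) ⟩
    (s * q ^ α) ^ n * (q ^ c) ^ k
      ≈⟨ *-cong (^-distrib-* s (q ^ α) n) (^-assocʳ q c k) ⟩
    s ^ n * (q ^ α) ^ n * q ^ (c ℕ.* k)
      ≈⟨ *-congʳ (*-congˡ (^-assocʳ q α n)) ⟩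
    s ^ n * q ^ (α ℕ.* n) * q ^ (c ℕ.* k)
      ≈⟨ *-assoc _ _ _ ⟩
    s ^ n * (q ^ (α ℕ.* n) * q ^ (c ℕ.* k))
      ≈⟨ *-congˡ (^-homo-* q (α ℕ.* n) (c ℕ.* k)) ⟨
    s ^ n * q ^ (α ℕ.* n ℕ.+ c ℕ.* k) ∎

  -- `h` is the summand of the theorem, since `3 n(n-1)/2 + 2n = n(3n+1)/2`; `w` is `z` with `q²`
  -- for `q` and alternating signs.
  v w z h : ℤ → Carrier
  v n = sgn n * q ^ square n
  w n = sgn n * q ^ (2 ℕ.* pentagonal n)
  z n = q ^ pentagonal n
  h n = ι n * z n

  private
    large-power : ∀ {n k} x → N ℕ.≤ n → n ℕ.≤ k → x * q ^ k ≈ 0#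
    large-power x N≤n n≤k = trans (*-congˡ (^-vanish qᴺ≈0 (ℕ.≤-trans N≤n n≤k))) (zeroʳ x)

  v-supported : Supported N v
  v-supported n n≥ = large-power (sgn n) n≥ (square-≥ n)

  w-supported : Supported N w
  w-supported n n≥ = large-power (sgn n) n≥ (ℕ.≤-trans (pentagonal-≥ n) (ℕ.m≤m+n _ _))

  z-supported : Supported N z
  z-supported n n≥ = ^-vanish qᴺ≈0 (ℕ.≤-trans n≥ (pentagonal-≥ n))

  h-supported : Supported N h
  h-supported n n≥ = trans (*-congˡ (z-supported n n≥)) (zeroʳ _)

  A B C D E P : Carrier
  A = ⟨ q ⨾ q ⟩ N
  B = ⟨ q ⨾ q ^ 2 ⟩ N
  C = ⟨ - q ⨾ q ^ 3 ⟩ N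
  D = ⟨ - (q ^ 2) ⨾ q ^ 3 ⟩ N
  E = ⟨ q ^ 3 ⨾ q ^ 3 ⟩ N
  P = ⟨ q ^ 2 ⨾ q ^ 2 ⟩ N

  private
    triple : ∀ {a b p f} → (ab≈p : a * b ≈ p) → p ^ N ≈ 0# → Supported N f →
      (∀ n → (- a) ^ n * p ^ triangle n ≈ f (+ n)) →
      (∀ n → (- b) ^ suc n * p ^ triangle (suc n) ≈ f -[1+ n ]) →
      f ⇓ ⟨ a ⨾ p ⟩ N * ⟨ b ⨾ p ⟩ N * ⟨ p ⨾ p ⟩ N
    triple {a} {b} {p} {f} ab≈p nil supp f⁺ f⁻ = ⇓-cong t≈f refl
      (Theta.triple-product a b p ab≈p {N} {N} nil λ n n≥ → trans (t≈f n) (supp n n≥))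
      where
      t≈f : ∀ n → Theta.θ-term a b p ab≈p n ≈ f n
      t≈f (+ n)    = f⁺ n
      t≈f -[1+ n ] = f⁻ n

  -- Gauss's theta series: the triple product with both parameters `q` and base `q²`.
  ∑v : v ⇓ B * B * P
  ∑v = triple (*-congˡ (sym (*-identityʳ q))) (qᵏ-nilpotent 1) v-supported
    (λ n → term n) (λ n → term (suc n))
    where
    exponents : ∀ n → 1 ℕ.* n ℕ.+ 2 ℕ.* triangle n ≡ n ℕ.* n
    exponents zero    = ≡.refl
    exponents (suc n) = ≡.trans (step n (triangle n))
      (≡.trans (≡.cong (λ x → 1 ℕ.+ n ℕ.+ n ℕ.+ x) (exponents n)) (collect n))
      where
      step : ∀ n t → 1 ℕ.* (1 ℕ.+ n) ℕ.+ 2 ℕ.* (n ℕ.+ t) ≡ 1 ℕ.+ n ℕ.+ n ℕ.+ (1 ℕ.* n ℕ.+ 2 ℕ.* t)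
      step = ℕ-Ring.solve-∀
      collect : ∀ n → 1 ℕ.+ n ℕ.+ n ℕ.+ n ℕ.* n ≡ (1 ℕ.+ n) ℕ.* (1 ℕ.+ n)
      collect = ℕ-Ring.solve-∀
    term : ∀ n → (- q) ^ n * (q ^ 2) ^ triangle n ≈ (- 1#) ^ n * q ^ (n ℕ.* n)
    term n = trans
      (power-term (- 1#) 1 2 n (solve 1 (λ q → :- q := :- con (+ 1) :* (q :* con (+ 1))) refl q) refl (triangle n))
      (*-congˡ (reflexive (≡.cong (q ^_) (exponents n))))

  -- Euler's pentagonal number theorem for `q²`: the triple product with parameters `q⁴`, `q²` and
  -- base `q⁶`, whose three products are the residue classes mod 3 of the factors of `P`.
  ∑w : w ⇓ P
  ∑w = ⇓-cong (λ _ → refl) product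
    (triple {q ^ 2 * (q ^ 2) ^ 1 * 1#} {q ^ 2 * 1#} {(q ^ 2) ^ 3}
      (solve 1 (λ x → (x :* (x :* con (+ 1)) :* con (+ 1)) :* (x :* con (+ 1)) := x :* (x :* (x :* con (+ 1)))) refl (q ^ 2))
      nil w-supported
      (λ n → trans (power-term (- 1#) 4 6 n
          (solve 1 (λ q → :- ((q :* (q :* con (+ 1))) :* ((q :* (q :* con (+ 1))) :* con (+ 1)) :* con (+ 1)) :=
            :- con (+ 1) :* (q :* (q :* (q :* (q :* con (+ 1)))))) refl q) (^-assocʳ q 2 3) (triangle n))
        (*-congˡ (reflexive (≡.cong (q ^_) (exponents⁺ n (triangle n))))))
      (λ n → trans (power-term (- 1#) 2 6 (suc n)
          (solve 1 (λ q → :- ((q :* (q :* con (+ 1))) :* con (+ 1)) :=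
            :- con (+ 1) :* (q :* (q :* con (+ 1)))) refl q) (^-assocʳ q 2 3) (triangle (suc n)))
        (*-congˡ (reflexive (≡.cong (q ^_) (exponents⁻ (suc n) (triangle (suc n))))))))
    where
    nil : ((q ^ 2) ^ 3) ^ N ≈ 0#
    nil = trans (^-congˡ N (^-assocʳ q 2 3)) (qᵏ-nilpotent 5)
    exponents⁺ : ∀ n t → 4 ℕ.* n ℕ.+ 6 ℕ.* t ≡ 2 ℕ.* (2 ℕ.* n ℕ.+ 3 ℕ.* t)
    exponents⁺ = ℕ-Ring.solve-∀
    exponents⁻ : ∀ n t → 2 ℕ.* n ℕ.+ 6 ℕ.* t ≡ 2 ℕ.* (n ℕ.+ 3 ℕ.* t)
    exponents⁻ = ℕ-Ring.solve-∀
    product : ⟨ q ^ 2 * (q ^ 2) ^ 1 * 1# ⨾ (q ^ 2) ^ 3 ⟩ N * ⟨ q ^ 2 * 1# ⨾ (q ^ 2) ^ 3 ⟩ N * ⟨ (q ^ 2) ^ 3 ⨾ (q ^ 2) ^ 3 ⟩ N ≈ P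
    product = begin
      ⟨ x * x ^ 1 * 1# ⨾ x ^ 3 ⟩ N * ⟨ x * 1# ⨾ x ^ 3 ⟩ N * ⟨ x ^ 3 ⨾ x ^ 3 ⟩ N
        ≈⟨ *-cong (*-cong
             (⟨⟩-cong N (solve 1 (λ x → x :* (x :* con (+ 1)) :* con (+ 1) := x :* x) refl x) refl)
             (⟨⟩-cong N (*-identityʳ x) refl))
             (⟨⟩-cong N refl refl) ⟩
      ⟨ x * x ⨾ x ^ 3 ⟩ N * ⟨ x ⨾ x ^ 3 ⟩ N * ⟨ x * x ^ 2 ⨾ x ^ 3 ⟩ N
        ≈⟨ *-congʳ (*-comm _ _) ⟩
      ⟨ x ⨾ x ^ 3 ⟩ N * ⟨ x * x ⨾ x ^ 3 ⟩ N * ⟨ x * x ^ 2 ⨾ x ^ 3 ⟩ N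
        ≈⟨ ⟨⟩-trisect x x N ⟨
      ⟨ x ⨾ x ⟩ (N ℕ.* 3)
        ≈⟨ ⟨⟩-stable (qᵏ-nilpotent 1) (ℕ.m≤m*n N 3) ⟩
      P ∎
      where x = q ^ 2

  -- The triple product with parameters `-q²`, `-q` and base `q³`. The larger one comes first so
  -- that nonnegative indices get `n(3n+1)/2`.
  ∑z : z ⇓ C * D * E
  ∑z = ⇓-cong (λ _ → refl) (*-congʳ (*-comm D C))
    (triple { - (q ^ 2)} { - q} {q ^ 3}
      (solve 1 (λ q → :- (q :* (q :* con (+ 1))) :* :- q := q :* (q :* (q :* con (+ 1)))) refl q)
      (qᵏ-nilpotent 2) z-supported
      (λ n → term { - (q ^ 2)} {2} n (trans (-‿involutive _) (sym (*-identityˡ _))) (triangle n))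
      (λ n → trans (term { - q} {1} (suc n)
          (solve 1 (λ q → :- :- q := con (+ 1) :* (q :* con (+ 1))) refl q) (triangle (suc n)))
        (reflexive (≡.cong (λ x → q ^ (x ℕ.+ 3 ℕ.* triangle (suc n))) (ℕ.*-identityˡ (suc n))))))
    where
    term : ∀ {a α} n → - a ≈ 1# * q ^ α → ∀ k →
      (- a) ^ n * (q ^ 3) ^ k ≈ q ^ (α ℕ.* n ℕ.+ 3 ℕ.* k)
    term {a} {α} n a≈ k = trans (power-term 1# α 3 n a≈ refl k)
      (trans (*-congʳ (1^n≈1 n)) (*-identityˡ _))

  f F : ℤ → ℤ → Carrier
  f i j = ι (i ℤ.+ + 2 ℤ.* j) * (u i * v j)
  -- the substitution l = i + 2 j in the double series
  F l j = f (l ℤ.+ ℤ.- (+ 2 ℤ.* j)) j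

  rows : ∀ j → (λ i → f i j) ⇓ - (A ^ 3) * v j
  rows j = ⇓-cong
    (λ i → trans
      (solve 4 (λ i j u v → v :* (i :* u) :+ con (+ 2) :* j :* v :* u := (i :+ con (+ 2) :* j) :* (u :* v)) refl (ι i) (ι j) (u i) (v j))
      (*-congʳ (sym (trans (ι-+ i (+ 2 ℤ.* j)) (+-congˡ (ι-* (+ 2) j))))))
    (solve 3 (λ v j a → v :* a :+ con (+ 2) :* j :* v :* con (+ 0) := a :* v) refl (v j) (ι j) (- (A ^ 3)))
    (⇓-+ (⇓-*ˡ (v j) (∑nu {N} qᴺ≈0)) (⇓-*ˡ (ι (+ 2) * ι j * v j) (∑u {N} qᴺ≈0)))

  uv-form : ∀ i j → u i * v j ≈ sgn (i ℤ.+ j) * q ^ (choose₂ i ℕ.+ square j)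
  uv-form i j = begin
    (sgn i * q ^ choose₂ i) * (sgn j * q ^ square j)
      ≈⟨ solve 4 (λ a b c d → (a :* b) :* (c :* d) := (a :* c) :* (b :* d)) refl _ _ _ _ ⟩
    (sgn i * sgn j) * (q ^ choose₂ i * q ^ square j)
      ≈⟨ *-cong (sgn-+ i j) (^-homo-* q (choose₂ i) (square j)) ⟨
    sgn (i ℤ.+ j) * q ^ (choose₂ i ℕ.+ square j) ∎

  uv-exponent : ∀ i j →
    + 2 ℤ.* + (choose₂ i ℕ.+ square j) ≡ i ℤ.* (i ℤ.+ ℤ.- (+ 1)) ℤ.+ + 2 ℤ.* (j ℤ.* j)
  uv-exponent i j = ≡.trans (ℤ.*-distribˡ-+ (+ 2) (+ choose₂ i) (+ square j))
    (≡.cong₂ ℤ._+_ (choose₂-double i) (≡.cong (λ x → + 2 ℤ.* x) (square-spec j)))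

  -- `k` witnesses the parity of `i + j`; `m` and `n` split the exponent as `m(3m+1) + n(3n+1)/2`.
  -- In a column only the first part varies, and it sums to `P`.
  uv-split : ∀ i j {k s m n} → i ℤ.+ j ≡ s ℤ.+ (k ℤ.+ k) →
    + 2 ℤ.* (+ 3 ℤ.* (m ℤ.* m) ℤ.+ m) ℤ.+ (+ 3 ℤ.* (n ℤ.* n) ℤ.+ n)
      ≡ i ℤ.* (i ℤ.+ ℤ.- (+ 1)) ℤ.+ + 2 ℤ.* (j ℤ.* j) →
    u i * v j ≈ sgn s * (q ^ (2 ℕ.* pentagonal m) * z n)
  uv-split i j {k} {s} {m} {n} i+j e = begin
    u i * v j
      ≈⟨ uv-form i j ⟩
    sgn (i ℤ.+ j) * q ^ (choose₂ i ℕ.+ square j)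
      ≈⟨ *-cong (trans (reflexive (≡.cong sgn i+j)) (sgn-even k s))
           (reflexive (≡.cong (q ^_) (double-injective (choose₂ i ℕ.+ square j) (2 ℕ.* pentagonal m ℕ.+ pentagonal n)
             (≡.trans (uv-exponent i j) (≡.trans (≡.sym e) (≡.sym exponents)))))) ⟩
    sgn s * q ^ (2 ℕ.* pentagonal m ℕ.+ pentagonal n)
      ≈⟨ *-congˡ (^-homo-* q (2 ℕ.* pentagonal m) (pentagonal n)) ⟩
    sgn s * (q ^ (2 ℕ.* pentagonal m) * z n) ∎
    where
    exponents : + 2 ℤ.* + (2 ℕ.* pentagonal m ℕ.+ pentagonal n)
      ≡ + 2 ℤ.* (+ 3 ℤ.* (m ℤ.* m) ℤ.+ m) ℤ.+ (+ 3 ℤ.* (n ℤ.* n) ℤ.+ n)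
    exponents = ≡.trans (ℤ.*-distribˡ-+ (+ 2) (+ (2 ℕ.* pentagonal m)) (+ pentagonal n))
      (≡.cong₂ (λ x y → + 2 ℤ.* x ℤ.+ y)
        (≡.trans (ℤ.pos-* 2 (pentagonal m)) (pentagonal-double m)) (pentagonal-double n))

  uv-opposite : ∀ {i j i′ j′ k} → i′ ℤ.+ j′ ≡ + 1 ℤ.+ (i ℤ.+ j) ℤ.+ (k ℤ.+ k) →
    i′ ℤ.* (i′ ℤ.+ ℤ.- (+ 1)) ℤ.+ + 2 ℤ.* (j′ ℤ.* j′) ≡ i ℤ.* (i ℤ.+ ℤ.- (+ 1)) ℤ.+ + 2 ℤ.* (j ℤ.* j) →
    u i′ * v j′ ≈ - (u i * v j)
  uv-opposite {i} {j} {i′} {j′} {k} i′+j′ e = begin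
    u i′ * v j′
      ≈⟨ uv-form i′ j′ ⟩
    sgn (i′ ℤ.+ j′) * q ^ (choose₂ i′ ℕ.+ square j′)
      ≈⟨ *-cong (trans (reflexive (≡.cong sgn i′+j′)) (trans (sgn-even k (+ 1 ℤ.+ (i ℤ.+ j))) (sgn-suc (i ℤ.+ j))))
           (reflexive (≡.cong (q ^_) (double-injective (choose₂ i′ ℕ.+ square j′) (choose₂ i ℕ.+ square j)
             (≡.trans (uv-exponent i′ j′) (≡.trans e (≡.sym (uv-exponent i j))))))) ⟩
    - sgn (i ℤ.+ j) * q ^ (choose₂ i ℕ.+ square j)
      ≈⟨ solve 2 (λ x y → :- x :* y := :- (x :* y)) refl _ _ ⟩
    - (sgn (i ℤ.+ j) * q ^ (choose₂ i ℕ.+ square j))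
      ≈⟨ -‿cong (uv-form i j) ⟨
    - (u i * v j) ∎

  F-weight : ∀ l j → F l j ≈ ι l * (u (l ℤ.+ ℤ.- (+ 2 ℤ.* j)) * v j)
  F-weight l j = *-congʳ (reflexive (≡.cong ι (lem l j)))
    where
    lem : ∀ l j → l ℤ.+ ℤ.- (+ 2 ℤ.* j) ℤ.+ + 2 ℤ.* j ≡ l
    lem = ℤ-Ring.solve-∀

  -- Lets a column be summed after recentring `j` near the vertex of its exponent.
  F-column : ∀ l c {g s} → (∀ j → F l (j ℤ.+ c) ≈ g j) → g ⇓ s → F l ⇓ s
  F-column l c e g⇓s = ⇓-cong
    (λ j → reflexive (≡.cong (F l) (lem j c))) refl
    (⇓-shift (ℤ.- c) (⇓-cong (λ j → sym (e j)) refl g⇓s))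
    where
    lem : ∀ j c → j ℤ.+ ℤ.- c ℤ.+ c ≡ j
    lem = ℤ-Ring.solve-∀

  -- After `j ↦ j + m` the exponent is `j(3j+1) + m(3m-1)/2` and the sign is `(-1)^j`.
  column₀ : ∀ m → F (+ 3 ℤ.* m) ⇓ ι (+ 3 ℤ.* m) * (z (ℤ.- m) * P)
  column₀ m = F-column l m
    (λ j → trans (F-weight l (j ℤ.+ m)) (*-congˡ (trans
      (uv-split (l ℤ.+ ℤ.- (+ 2 ℤ.* (j ℤ.+ m))) (j ℤ.+ m) {m} {ℤ.- j} {j} {ℤ.- m} (sign m j) (exponent m j))
      (trans (*-congʳ (reflexive (sgn-neg j)))
        (solve 3 (λ s x y → s :* (x :* y) := y :* (s :* x)) refl _ _ _)))))
    (⇓-*ˡ (ι l) (⇓-*ˡ (z (ℤ.- m)) ∑w))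
    where
    l = + 3 ℤ.* m
    sign : ∀ m j → + 3 ℤ.* m ℤ.+ ℤ.- (+ 2 ℤ.* (j ℤ.+ m)) ℤ.+ (j ℤ.+ m) ≡ ℤ.- j ℤ.+ (m ℤ.+ m)
    sign = ℤ-Ring.solve-∀
    exponent : ∀ m j → + 2 ℤ.* (+ 3 ℤ.* (j ℤ.* j) ℤ.+ j) ℤ.+ (+ 3 ℤ.* (ℤ.- m ℤ.* ℤ.- m) ℤ.+ ℤ.- m)
      ≡ (+ 3 ℤ.* m ℤ.+ ℤ.- (+ 2 ℤ.* (j ℤ.+ m))) ℤ.* (+ 3 ℤ.* m ℤ.+ ℤ.- (+ 2 ℤ.* (j ℤ.+ m)) ℤ.+ ℤ.- (+ 1))
        ℤ.+ + 2 ℤ.* ((j ℤ.+ m) ℤ.* (j ℤ.+ m))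
    exponent = ℤ-Ring.solve-∀

  -- After `j ↦ j + m` the exponent is `j(3j-1) + m(3m+1)/2` and the sign `-(-1)^j`; the reflected
  -- series for `P` appears, negated.
  column₁ : ∀ m → F (+ 3 ℤ.* m ℤ.+ + 1) ⇓ - ι (+ 3 ℤ.* m ℤ.+ + 1) * (z m * P)
  column₁ m = F-column l m
    (λ j → trans (F-weight l (j ℤ.+ m)) (trans (*-congˡ
      (uv-split (l ℤ.+ ℤ.- (+ 2 ℤ.* (j ℤ.+ m))) (j ℤ.+ m) {m} {+ 1 ℤ.+ ℤ.- j} {ℤ.- j} {m} (sign m j) (exponent m j)))
      (trans (*-congˡ (*-congʳ (sgn-suc (ℤ.- j))))
        (solve 4 (λ l s x y → l :* (:- s :* (x :* y)) := :- l :* (y :* (s :* x))) refl _ _ _ _))))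
    (⇓-*ˡ (- ι l) (⇓-*ˡ (z m) (⇓-neg ∑w)))
    where
    l = + 3 ℤ.* m ℤ.+ + 1
    sign : ∀ m j → + 3 ℤ.* m ℤ.+ + 1 ℤ.+ ℤ.- (+ 2 ℤ.* (j ℤ.+ m)) ℤ.+ (j ℤ.+ m) ≡ + 1 ℤ.+ ℤ.- j ℤ.+ (m ℤ.+ m)
    sign = ℤ-Ring.solve-∀
    exponent : ∀ m j → + 2 ℤ.* (+ 3 ℤ.* (ℤ.- j ℤ.* ℤ.- j) ℤ.+ ℤ.- j) ℤ.+ (+ 3 ℤ.* (m ℤ.* m) ℤ.+ m)
      ≡ (+ 3 ℤ.* m ℤ.+ + 1 ℤ.+ ℤ.- (+ 2 ℤ.* (j ℤ.+ m)))
        ℤ.* (+ 3 ℤ.* m ℤ.+ + 1 ℤ.+ ℤ.- (+ 2 ℤ.* (j ℤ.+ m)) ℤ.+ ℤ.- (+ 1))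
        ℤ.+ + 2 ℤ.* ((j ℤ.+ m) ℤ.* (j ℤ.+ m))
    exponent = ℤ-Ring.solve-∀

  private
    M : ℕ
    -- A nonzero term has `∣l - 2j∣ ≤ N` and `∣j∣ < N`, from the supports of `u` and `v`; `M`
    -- exceeds the resulting `∣l∣` as well as `∣j∣`.
    M = suc N ℕ.+ (N ℕ.+ N)

    N≤M : N ℕ.≤ M
    N≤M = ℕ.≤-trans (ℕ.n≤1+n N) (ℕ.m≤m+n (suc N) _)

  F-vanishˡ : ∀ l j → suc N ℕ.≤ ℤ.∣ l ℤ.+ ℤ.- (+ 2 ℤ.* j) ∣ → F l j ≈ 0#
  F-vanishˡ l j far = trans (*-congˡ (trans (*-congʳ (u-supported {N} qᴺ≈0 (l ℤ.+ ℤ.- (+ 2 ℤ.* j)) far)) (zeroˡ _))) (zeroʳ _)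

  F-vanishʳ : ∀ l j → N ℕ.≤ ℤ.∣ j ∣ → F l j ≈ 0#
  F-vanishʳ l j far = trans (*-congˡ (trans (*-congˡ (v-supported j far)) (zeroʳ _))) (zeroʳ _)

  F-supportedˡ : ∀ j → Supported M (λ l → F l j)
  F-supportedˡ j l M≤l with N ℕ.≤? ℤ.∣ j ∣ | suc N ℕ.≤? ℤ.∣ l ℤ.+ ℤ.- (+ 2 ℤ.* j) ∣
  ... | yes N≤j | _      = F-vanishʳ l j N≤j
  ... | no _    | yes far = F-vanishˡ l j far
  ... | no N≰j  | no near = ⊥-elim (ℕ.<⇒≱
    (∣l∣-bound l j (ℕ.≰⇒> near) (ℕ.<⇒≤ (ℕ.≰⇒> N≰j))) M≤l)

  F-supportedʳ : ∀ l → Supported M (F l)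
  F-supportedʳ l j M≤j = F-vanishʳ l j (ℕ.≤-trans N≤M M≤j)

  -- Defined uniformly in `l`, because the interchange and the trisection need a single function;
  -- its values on the residue classes are identified afterwards by uniqueness.
  c : ℤ → Carrier
  c l = ∑ℤ M M (F l)

  column : ∀ l → F l ⇓ c l
  column l = supported⇒⇓ (F l) (F-supportedʳ l)

  -- The vertex is `m + 1/2`, so `j ↦ 2m + 1 - j` preserves the exponent and changes the parity of
  -- `i + j`. The shift by `m + 1` turns this into `k ↦ -1 - k`.
  column₂ : ∀ m → c (+ 3 ℤ.* m ℤ.+ + 2) ≈ 0#
  column₂ m = ⇓-antisymmetric
    (λ k → trans (+-cong (F-weight l (-[1+ k ] ℤ.+ d)) (F-weight l (+ k ℤ.+ d)))
      (trans (+-congʳ (*-congˡ (opposite (+ k))))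
        (solve 2 (λ l x → l :* :- x :+ l :* x := con (+ 0)) refl _ _)))
    (⇓-shift d (column l))
    where
    l = + 3 ℤ.* m ℤ.+ + 2
    d = m ℤ.+ + 1
    index : ℤ → ℤ
    index j = l ℤ.+ ℤ.- (+ 2 ℤ.* (j ℤ.+ d))
    opposite : ∀ k → u (index (ℤ.- (+ 1 ℤ.+ k))) * v (ℤ.- (+ 1 ℤ.+ k) ℤ.+ d) ≈ - (u (index k) * v (k ℤ.+ d))
    opposite k = uv-opposite {index k} {k ℤ.+ d} {index (ℤ.- (+ 1 ℤ.+ k))} {ℤ.- (+ 1 ℤ.+ k) ℤ.+ d} {k} (sign m k) (exponent m k)
      where
      sign : ∀ m k → + 3 ℤ.* m ℤ.+ + 2 ℤ.+ ℤ.- (+ 2 ℤ.* (ℤ.- (+ 1 ℤ.+ k) ℤ.+ (m ℤ.+ + 1))) ℤ.+ (ℤ.- (+ 1 ℤ.+ k) ℤ.+ (m ℤ.+ + 1))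
        ≡ + 1 ℤ.+ (+ 3 ℤ.* m ℤ.+ + 2 ℤ.+ ℤ.- (+ 2 ℤ.* (k ℤ.+ (m ℤ.+ + 1))) ℤ.+ (k ℤ.+ (m ℤ.+ + 1))) ℤ.+ (k ℤ.+ k)
      sign = ℤ-Ring.solve-∀
      exponent : ∀ m k →
        let i′ = + 3 ℤ.* m ℤ.+ + 2 ℤ.+ ℤ.- (+ 2 ℤ.* (ℤ.- (+ 1 ℤ.+ k) ℤ.+ (m ℤ.+ + 1)))
            j′ = ℤ.- (+ 1 ℤ.+ k) ℤ.+ (m ℤ.+ + 1)
            i = + 3 ℤ.* m ℤ.+ + 2 ℤ.+ ℤ.- (+ 2 ℤ.* (k ℤ.+ (m ℤ.+ + 1)))
            j = k ℤ.+ (m ℤ.+ + 1)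
        in i′ ℤ.* (i′ ℤ.+ ℤ.- (+ 1)) ℤ.+ + 2 ℤ.* (j′ ℤ.* j′) ≡ i ℤ.* (i ℤ.+ ℤ.- (+ 1)) ℤ.+ + 2 ℤ.* (j ℤ.* j)
      exponent = ℤ-Ring.solve-∀

  ∑c : c ⇓ - (A ^ 3) * (B * B * P)
  ∑c = fubini {M} F-supportedˡ F-supportedʳ
    (λ j → ⇓-shift (ℤ.- (+ 2 ℤ.* j)) (rows j)) (⇓-*ˡ (- (A ^ 3)) ∑v) column

  S : Carrier
  S = ∑ℤ N N h

  ∑h : h ⇓ S
  ∑h = supported⇒⇓ h h-supported

  -- The weight `3m` on `z (- m)` is absorbed into `h (- m)`, with a change of sign. As `h` and its
  -- reflection have the same sum, the total is `-6 P S - P ∑ z`.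
  trisected : ∀ m → c (+ 3 ℤ.* m) + c (+ 3 ℤ.* m ℤ.+ + 1) + c (+ 3 ℤ.* m ℤ.+ + 2)
    ≈ - (ι (+ 3) * P) * h (ℤ.- m) + (- (ι (+ 3) * P) * h m + - P * z m)
  trisected m = begin
    c (+ 3 ℤ.* m) + c (+ 3 ℤ.* m ℤ.+ + 1) + c (+ 3 ℤ.* m ℤ.+ + 2)
      ≈⟨ +-cong (+-cong (⇓-unique (column (+ 3 ℤ.* m)) (column₀ m)) (⇓-unique (column (+ 3 ℤ.* m ℤ.+ + 1)) (column₁ m))) (column₂ m) ⟩
    ι (+ 3 ℤ.* m) * (z (ℤ.- m) * P) + - ι (+ 3 ℤ.* m ℤ.+ + 1) * (z m * P) + 0#
      ≈⟨ +-congʳ (+-cong (*-congʳ (ι-* (+ 3) m))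
           (*-congʳ (-‿cong (trans (ι-+ (+ 3 ℤ.* m) (+ 1)) (+-congʳ (ι-* (+ 3) m)))))) ⟩
    ι (+ 3) * ι m * (z (ℤ.- m) * P) + - (ι (+ 3) * ι m + 1#) * (z m * P) + 0#
      ≈⟨ solve 5 (λ t n y x P → t :* n :* (y :* P) :+ :- (t :* n :+ con (+ 1)) :* (x :* P) :+ con (+ 0)
           := :- (t :* P) :* (:- n :* y) :+ (:- (t :* P) :* (n :* x) :+ :- P :* x)) refl _ _ _ _ _ ⟩
    - (ι (+ 3) * P) * (- ι m * z (ℤ.- m)) + (- (ι (+ 3) * P) * h m + - P * z m)
      ≈⟨ +-congʳ (*-congˡ (*-congʳ (ι-neg m))) ⟨
    - (ι (+ 3) * P) * h (ℤ.- m) + (- (ι (+ 3) * P) * h m + - P * z m) ∎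

  -- With `C * D * E` moved to the left, this is the derivative of the quintuple product identity at
  -- the point where both sides vanish.
  quintuple-derivative : ι (+ 6) * S ≈ A ^ 3 * B ^ 2 - C * D * E
  quintuple-derivative = begin
    ι (+ 6) * S
      ≈⟨ solve 2 (λ s x → con (+ 6) :* s := (con (+ 6) :* s :+ x) :- x) refl S (C * D * E) ⟩
    (ι (+ 6) * S + C * D * E) - C * D * E
      ≈⟨ +-congʳ (invertible-cancel (⟨⟩-invertible {q ^ 2} {q ^ 2} {N} (qᵏ-nilpotent 1) N) cancelled) ⟩
    A ^ 3 * B ^ 2 - C * D * E ∎
    where
    cancelled : P * (ι (+ 6) * S + C * D * E) ≈ P * (A ^ 3 * B ^ 2)
    cancelled = begin
      P * (ι (+ 6) * S + C * D * E)
        ≈⟨ solve 3 (λ P s x → P :* (con (+ 6) :* s :+ x)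
             := :- (:- (con (+ 3) :* P) :* s :+ (:- (con (+ 3) :* P) :* s :+ :- P :* x))) refl _ _ _ ⟩
      - (- (ι (+ 3) * P) * S + (- (ι (+ 3) * P) * S + - P * (C * D * E)))
        ≈⟨ -‿cong (⇓-unique
             (⇓-+ (⇓-*ˡ (- (ι (+ 3) * P)) (⇓-neg ∑h)) (⇓-+ (⇓-*ˡ (- (ι (+ 3) * P)) ∑h) (⇓-*ˡ (- P) ∑z)))
             (⇓-cong trisected refl (⇓-trisect ∑c))) ⟩
      - (- (A ^ 3) * (B * B * P))
        ≈⟨ solve 3 (λ a b P → :- (:- a :* (b :* b :* P)) := P :* (a :* (b :* (b :* con (+ 1))))) refl _ _ _ ⟩
      P * (A ^ 3 * B ^ 2) ∎

-- Rational estimates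

module ℚ-Lemmas where
  open import Data.Rational using (_+_; _*_; _-_; _/_; _≤_; _<_; ∣_∣)
  open ℚ-Solver.+-*-Solver
  open Exp (CommutativeRing.commutativeSemiring ℚ.+-*-commutativeRing) public using (_^_)
  open IntegerMultiples ℚ.+-*-commutativeRing public using (ι; ι-+)
  open Sums ℚ.+-*-commutativeRing public using (∑; ∏)
  open ℚ.≤-Reasoning

  0≤* : ∀ {a b} → 0ℚ ≤ a → 0ℚ ≤ b → 0ℚ ≤ a * b
  0≤* {a} {b} 0≤a 0≤b =
    ℚ.nonNegative⁻¹ _ {{ℚ.nonNeg*nonNeg⇒nonNeg a {{ℚ.nonNegative 0≤a}} b {{ℚ.nonNegative 0≤b}}}}

  0<* : ∀ {a b} → 0ℚ < a → 0ℚ < b → 0ℚ < a * b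
  0<* {a} {b} 0<a 0<b =
    ℚ.positive⁻¹ _ {{ℚ.pos*pos⇒pos a {{ℚ.positive 0<a}} b {{ℚ.positive 0<b}}}}

  0≤+ : ∀ {a b} → 0ℚ ≤ a → 0ℚ ≤ b → 0ℚ ≤ a + b
  0≤+ = ℚ.+-mono-≤

  *-mono-≤ : ∀ {a b c d} → 0ℚ ≤ a → 0ℚ ≤ d → a ≤ b → c ≤ d → a * c ≤ b * d
  *-mono-≤ {a} {b} {c} {d} 0≤a 0≤d a≤b c≤d = ℚ.≤-trans
    (ℚ.*-monoˡ-≤-nonNeg a {{ℚ.nonNegative 0≤a}} c≤d)
    (ℚ.*-monoʳ-≤-nonNeg d {{ℚ.nonNegative 0≤d}} a≤b)

  *-monoˡ-≤ : ∀ {a c d} → 0ℚ ≤ a → c ≤ d → a * c ≤ a * d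
  *-monoˡ-≤ {a} 0≤a = ℚ.*-monoˡ-≤-nonNeg a {{ℚ.nonNegative 0≤a}}

  ≤-from-difference : ∀ {a b} → 0ℚ ≤ b - a → a ≤ b
  ≤-from-difference {a} {b} h = begin
    a            ≡⟨ ℚ.+-identityˡ a ⟨
    0ℚ + a       ≤⟨ ℚ.+-monoˡ-≤ a h ⟩
    (b - a) + a  ≡⟨ solve 2 (λ a b → (b :- a) :+ a := b) ≡.refl a b ⟩
    b            ∎

  difference-≥0 : ∀ {a b} → a ≤ b → 0ℚ ≤ b - a
  difference-≥0 {a} {b} a≤b = begin
    0ℚ     ≡⟨ ℚ.+-inverseʳ a ⟨
    a - a  ≤⟨ ℚ.+-monoˡ-≤ (ℚ.- a) a≤b ⟩
    b - a  ∎

  difference->0 : ∀ {a b} → a < b → 0ℚ < b - a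
  difference->0 {a} {b} a<b = begin-strict
    0ℚ     ≡⟨ ℚ.+-inverseʳ a ⟨
    a - a  <⟨ ℚ.+-monoˡ-< (ℚ.- a) a<b ⟩
    b - a  ∎

  0≤square : ∀ a → 0ℚ ≤ a * a
  0≤square a with ℚ.≤-total 0ℚ a
  ... | inj₁ 0≤a = 0≤* 0≤a 0≤a
  ... | inj₂ a≤0 = ≡.subst (0ℚ ≤_) (solve 1 (λ a → (:- a) :* (:- a) := a :* a) ≡.refl a)
                     (0≤* (ℚ.neg-antimono-≤ a≤0) (ℚ.neg-antimono-≤ a≤0))

  square-cancel-≤ : ∀ {a b} → 0ℚ ≤ b → a * a ≤ b * b → a ≤ b
  square-cancel-≤ {a} {b} 0≤b aa≤bb with a ℚ.≤? b
  ... | yes a≤b = a≤b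
  ... | no  a≰b = ⊥-elim (ℚ.<-irrefl ≡.refl (begin-strict
    b * b  ≤⟨ *-monoˡ-≤ 0≤b (ℚ.<⇒≤ b<a) ⟩
    b * a  <⟨ ℚ.*-monoˡ-<-pos a {{ℚ.positive (ℚ.≤-<-trans 0≤b b<a)}} b<a ⟩
    a * a  ≤⟨ aa≤bb ⟩
    b * b  ∎))
    where b<a = ℚ.≰⇒> a≰b

  -- The triangle inequality for the complex modulus, stated for squares because a rational modulus
  -- may not exist.
  magnitude-+ : ∀ {a b c d r s} → 0ℚ ≤ r → 0ℚ ≤ s →
    a * a + b * b ≤ r * r → c * c + d * d ≤ s * s →
    (a + c) * (a + c) + (b + d) * (b + d) ≤ (r + s) * (r + s)
  magnitude-+ {a} {b} {c} {d} {r} {s} 0≤r 0≤s p q = begin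
    (a + c) * (a + c) + (b + d) * (b + d)
      ≡⟨ solve 4 (λ a b c d → (a :+ c) :* (a :+ c) :+ (b :+ d) :* (b :+ d)
           := (a :* a :+ b :* b) :+ (c :* c :+ d :* d) :+ ((a :* c :+ b :* d) :+ (a :* c :+ b :* d))) ≡.refl a b c d ⟩
    (a * a + b * b) + (c * c + d * d) + ((a * c + b * d) + (a * c + b * d))
      ≤⟨ ℚ.+-mono-≤ (ℚ.+-mono-≤ p q) (ℚ.+-mono-≤ cauchy-schwarz cauchy-schwarz) ⟩
    r * r + s * s + (r * s + r * s)
      ≡⟨ solve 2 (λ r s → r :* r :+ s :* s :+ (r :* s :+ r :* s) := (r :+ s) :* (r :+ s)) ≡.refl r s ⟩
    (r + s) * (r + s) ∎
    where
    cauchy-schwarz : a * c + b * d ≤ r * s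
    cauchy-schwarz = square-cancel-≤ (0≤* 0≤r 0≤s) (begin
      (a * c + b * d) * (a * c + b * d)
        ≡⟨ ℚ.+-identityʳ _ ⟨
      (a * c + b * d) * (a * c + b * d) + 0ℚ
        -- Lagrange's identity: the added square `(ad - bc)²` completes the left side to the product
        -- of the squared moduli.
        ≤⟨ ℚ.+-monoʳ-≤ ((a * c + b * d) * (a * c + b * d)) (0≤square (a * d - b * c)) ⟩
      (a * c + b * d) * (a * c + b * d) + (a * d - b * c) * (a * d - b * c)
        ≡⟨ solve 4 (λ a b c d → (a :* c :+ b :* d) :* (a :* c :+ b :* d) :+ (a :* d :- b :* c) :* (a :* d :- b :* c)
             := (a :* a :+ b :* b) :* (c :* c :+ d :* d)) ≡.refl a b c d ⟩
      (a * a + b * b) * (c * c + d * d)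
        ≤⟨ *-mono-≤ (0≤+ (0≤square a) (0≤square b)) (0≤square s) p q ⟩
      (r * r) * (s * s)
        ≡⟨ solve 2 (λ r s → (r :* r) :* (s :* s) := (r :* s) :* (r :* s)) ≡.refl r s ⟩
      (r * s) * (r * s) ∎)

  -- Multiplicativity of the squared modulus, the two-squares identity of Brahmagupta.
  magnitude-* : ∀ {a b c d r s} →
    a * a + b * b ≤ r * r → c * c + d * d ≤ s * s →
    (a * c - b * d) * (a * c - b * d) + (a * d + b * c) * (a * d + b * c) ≤ (r * s) * (r * s)
  magnitude-* {a} {b} {c} {d} {r} {s} p q = begin
    (a * c - b * d) * (a * c - b * d) + (a * d + b * c) * (a * d + b * c)
      ≡⟨ solve 4 (λ a b c d → (a :* c :- b :* d) :* (a :* c :- b :* d) :+ (a :* d :+ b :* c) :* (a :* d :+ b :* c)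
           := (a :* a :+ b :* b) :* (c :* c :+ d :* d)) ≡.refl a b c d ⟩
    (a * a + b * b) * (c * c + d * d)
      ≤⟨ *-mono-≤ (0≤+ (0≤square a) (0≤square b)) (0≤square s) p q ⟩
    (r * r) * (s * s)
      ≡⟨ solve 2 (λ r s → (r :* r) :* (s :* s) := (r :* s) :* (r :* s)) ≡.refl r s ⟩
    (r * s) * (r * s) ∎

  square-∣∣ : ∀ a → ∣ a ∣ * ∣ a ∣ ≡ a * a
  square-∣∣ a = ≡.trans (≡.sym (ℚ.∣p*q∣≡∣p∣*∣q∣ a a)) (ℚ.0≤p⇒∣p∣≡p (0≤square a))

  component-≤ : ∀ {a b c} → 0ℚ ≤ c → a * a + b * b ≤ c * c → ∣ a ∣ ≤ c × ∣ b ∣ ≤ c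
  component-≤ {a} {b} {c} 0≤c p =
      square-cancel-≤ 0≤c (begin
        ∣ a ∣ * ∣ a ∣  ≡⟨ ≡.trans (square-∣∣ a) (≡.sym (ℚ.+-identityʳ _)) ⟩
        a * a + 0ℚ     ≤⟨ ℚ.+-monoʳ-≤ (a * a) (0≤square b) ⟩
        a * a + b * b  ≤⟨ p ⟩
        c * c          ∎)
    , square-cancel-≤ 0≤c (begin
        ∣ b ∣ * ∣ b ∣  ≡⟨ ≡.trans (square-∣∣ b) (≡.sym (ℚ.+-identityˡ _)) ⟩
        0ℚ + b * b     ≤⟨ ℚ.+-monoˡ-≤ (b * b) (0≤square a) ⟩
        a * a + b * b  ≤⟨ p ⟩
        c * c          ∎)

  divide-≤ : ∀ {d a b} → 0ℚ < d → d * a ≤ b → ∃ λ c → d * c ≡ b × a ≤ c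
  divide-≤ {d} {a} {b} 0<d da≤b = ℚ.1/ d * b , dc≡b ,
    ℚ.*-cancelˡ-≤-pos d (≡.subst (d * a ≤_) (≡.sym dc≡b) da≤b)
    where
    instance
      d-positive : ℚ.Positive d
      d-positive = ℚ.positive 0<d
      d-nonZero : ℚ.NonZero d
      d-nonZero = ℚ.pos⇒nonZero d
    dc≡b : d * (ℚ.1/ d * b) ≡ b
    dc≡b = ≡.trans (≡.sym (ℚ.*-assoc d (ℚ.1/ d) b))
      (≡.trans (≡.cong (_* b) (ℚ.*-inverseʳ d)) (ℚ.*-identityˡ b))

  0<½* : ∀ {ε} → 0ℚ < ε → 0ℚ < ½ * ε
  0<½* = 0<* (ℚ.positive⁻¹ ½)

  -- `i / 1` normalises through a gcd and is stuck for a variable `i`; this is its reduced form.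
  fromℤ : ℤ → ℚ
  fromℤ i = mkℚ i 0 (Coprime.sym (Coprime.1-coprimeTo ℤ.∣ i ∣))

  /1≡fromℤ : ∀ i → i / 1 ≡ fromℤ i
  /1≡fromℤ i = ℚ.↥p/↧p≡p (fromℤ i)

  /1-+ : ∀ i j → (i ℤ.+ j) / 1 ≡ i / 1 + j / 1
  /1-+ i j = ≡.trans
    (≡.sym (≡.cong (_/ 1) (≡.cong₂ ℤ._+_ (ℤ.*-identityʳ i) (ℤ.*-identityʳ j))))
    (≡.sym (≡.cong₂ _+_ (/1≡fromℤ i) (/1≡fromℤ j)))

  ι≡/1 : ∀ i → i / 1 ≡ ι i
  ι≡/1 = IntegerMultiples.ι-unique ℚ.+-*-commutativeRing (_/ 1) ≡.refl /1-+

  archimedean : ∀ p → ∃ λ n → p ≤ ι (+ n)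
  archimedean p@(mkℚ i d _) = ℤ.∣ i ∣ ,
    ≡.subst (p ≤_) (≡.trans (≡.sym (/1≡fromℤ (+ ℤ.∣ i ∣))) (ι≡/1 (+ ℤ.∣ i ∣)))
      (ℚ.*≤* (ℤ.≤-trans (ℤ.≤-reflexive (ℤ.*-identityʳ i)) (ℤ.≤-trans (i≤∣i∣ i)
        (ℤ.≤-trans (ℤ.+≤+ (ℕ.m≤m*n ℤ.∣ i ∣ (suc d))) (ℤ.≤-reflexive (ℤ.pos-* ℤ.∣ i ∣ (suc d)))))))
    where
    i≤∣i∣ : ∀ i → i ℤ.≤ + ℤ.∣ i ∣
    i≤∣i∣ (+ n)    = ℤ.≤-refl
    i≤∣i∣ -[1+ n ] = ℤ.-≤+

  0≤ι : ∀ n → 0ℚ ≤ ι (+ n)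
  0≤ι zero    = ℚ.≤-refl
  0≤ι (suc n) = ≡.subst (0ℚ ≤_) (≡.sym (ι-+ (+ 1) (+ n))) (0≤+ (ℚ.nonNegative⁻¹ 1ℚ) (0≤ι n))

  module Geometric (r : ℚ) (0<r : 0ℚ < r) (r<1 : r < 1ℚ) where
    0≤r : 0ℚ ≤ r
    0≤r = ℚ.<⇒≤ 0<r

    0<1-r : 0ℚ < 1ℚ - r
    0<1-r = difference->0 r<1

    0≤r^ : ∀ n → 0ℚ ≤ r ^ n
    0≤r^ zero    = ℚ.nonNegative⁻¹ 1ℚ
    0≤r^ (suc n) = 0≤* 0≤r (0≤r^ n)

    r^-suc : ∀ n → r ^ suc n ≤ r ^ n
    r^-suc n = ≡.subst (r * r ^ n ≤_) (ℚ.*-identityˡ (r ^ n))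
      (ℚ.*-monoʳ-≤-nonNeg (r ^ n) {{ℚ.nonNegative (0≤r^ n)}} (ℚ.<⇒≤ r<1))

    r^-antitone : ∀ {m n} → m ℕ.≤ n → r ^ n ≤ r ^ m
    r^-antitone m≤n = go (ℕ.≤⇒≤′ m≤n)
      where
      go : ∀ {m n} → m ℕ.≤′ n → r ^ n ≤ r ^ m
      go ℕ.≤′-refl           = ℚ.≤-refl
      go (ℕ.≤′-step {n} m≤n) = ℚ.≤-trans (r^-suc n) (go m≤n)

    geometric-sum : ∀ m n → (1ℚ - r) * ∑ n (λ k → r ^ (m ℕ.+ k)) + r ^ (m ℕ.+ n) ≡ r ^ m
    geometric-sum m zero = ≡.trans
      (solve 2 (λ r x → (con 1ℚ :- r) :* con 0ℚ :+ x := x) ≡.refl r (r ^ (m ℕ.+ 0)))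
      (≡.cong (r ^_) (ℕ.+-identityʳ m))
    geometric-sum m (suc n) = ≡.trans
      (≡.cong (λ k → (1ℚ - r) * ∑ (suc n) (λ k → r ^ (m ℕ.+ k)) + r ^ k) (ℕ.+-suc m n))
      (≡.trans (solve 3 (λ r s x → (con 1ℚ :- r) :* (s :+ x) :+ r :* x := (con 1ℚ :- r) :* s :+ x) ≡.refl
                 r (∑ n (λ k → r ^ (m ℕ.+ k))) (r ^ (m ℕ.+ n)))
        (geometric-sum m n))

    geometric-≤ : ∀ m n → (1ℚ - r) * ∑ n (λ k → r ^ (m ℕ.+ k)) ≤ r ^ m
    geometric-≤ m n = begin
      (1ℚ - r) * ∑ n (λ k → r ^ (m ℕ.+ k))                     ≡⟨ ℚ.+-identityʳ _ ⟨
      (1ℚ - r) * ∑ n (λ k → r ^ (m ℕ.+ k)) + 0ℚ                ≤⟨ ℚ.+-monoʳ-≤ ((1ℚ - r) * ∑ n (λ k → r ^ (m ℕ.+ k))) (0≤r^ (m ℕ.+ n)) ⟩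
      (1ℚ - r) * ∑ n (λ k → r ^ (m ℕ.+ k)) + r ^ (m ℕ.+ n)     ≡⟨ geometric-sum m n ⟩
      r ^ m ∎

    weighted-sum : ∀ n →
      (1ℚ - r) * ∑ n (λ k → ι (+ k) * r ^ k) + ι (+ n) * r ^ n ≡ r * ∑ n (λ k → r ^ k)
    weighted-sum zero = solve 1 (λ r → (con 1ℚ :- r) :* con 0ℚ :+ con 0ℚ :* con 1ℚ := r :* con 0ℚ) ≡.refl r
    weighted-sum (suc n) = ≡.trans
      (≡.cong (λ k → (1ℚ - r) * ∑ (suc n) (λ k → ι (+ k) * r ^ k) + k * (r * r ^ n)) (ι-+ (+ 1) (+ n)))
      (≡.trans (solve 4 (λ r s k x → (con 1ℚ :- r) :* (s :+ k :* x) :+ (con 1ℚ :+ k) :* (r :* x)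
                 := ((con 1ℚ :- r) :* s :+ k :* x) :+ r :* x) ≡.refl
                 r (∑ n (λ k → ι (+ k) * r ^ k)) (ι (+ n)) (r ^ n))
        (≡.trans (≡.cong (_+ r * r ^ n) (weighted-sum n)) (≡.sym (ℚ.*-distribˡ-+ r _ _))))

    0≤weighted : ∀ n → 0ℚ ≤ ∑ n (λ k → ι (+ k) * r ^ k)
    0≤weighted zero    = ℚ.≤-refl
    0≤weighted (suc n) = 0≤+ (0≤weighted n) (0≤* (0≤ι n) (0≤r^ n))

    private
      d = 1ℚ - r
      0≤d = ℚ.<⇒≤ 0<1-r

      -- Both summands in the bracket are nonnegative, so each is bounded: the first bounds
      -- `∑ k r^k`, the second gives `n r^n = O(1)` and hence `r^n → 0`.
      weighted-total : ∀ n → d * (d * ∑ n (λ k → ι (+ k) * r ^ k) + ι (+ n) * r ^ n) ≤ 1ℚ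
      weighted-total n = begin
        d * (d * ∑ n (λ k → ι (+ k) * r ^ k) + ι (+ n) * r ^ n)  ≡⟨ ≡.cong (d *_) (weighted-sum n) ⟩
        d * (r * ∑ n (λ k → r ^ k))
          ≡⟨ solve 3 (λ d r s → d :* (r :* s) := r :* (d :* s)) ≡.refl d r (∑ n (λ k → r ^ k)) ⟩
        r * (d * ∑ n (λ k → r ^ k))
          ≤⟨ *-monoˡ-≤ 0≤r (geometric-≤ 0 n) ⟩
        r * 1ℚ                       ≡⟨ ℚ.*-identityʳ r ⟩
        r                            <⟨ r<1 ⟩
        1ℚ ∎

    weighted-bound : ∃ λ C → ∀ n → ∑ n (λ k → ι (+ k) * r ^ k) ≤ C
    weighted-bound = proj₁ bound , λ n → ℚ.*-cancelˡ-≤-pos (d * d) {{ℚ.positive 0<dd}}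
        (≡.subst (d * d * ∑ n (λ k → ι (+ k) * r ^ k) ≤_) (≡.sym (proj₁ (proj₂ bound))) (estimate n))
      where
      0<dd = 0<* 0<1-r 0<1-r
      estimate : ∀ n → d * d * ∑ n (λ k → ι (+ k) * r ^ k) ≤ 1ℚ
      estimate n = begin
        d * d * ∑ n (λ k → ι (+ k) * r ^ k)
          ≡⟨ solve 2 (λ d s → d :* d :* s := d :* (d :* s :+ con 0ℚ)) ≡.refl d (∑ n (λ k → ι (+ k) * r ^ k)) ⟩
        d * (d * ∑ n (λ k → ι (+ k) * r ^ k) + 0ℚ)
          ≤⟨ *-monoˡ-≤ 0≤d (ℚ.+-monoʳ-≤ (d * ∑ n (λ k → ι (+ k) * r ^ k)) (0≤* (0≤ι n) (0≤r^ n))) ⟩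
        d * (d * ∑ n (λ k → ι (+ k) * r ^ k) + ι (+ n) * r ^ n)
          ≤⟨ weighted-total n ⟩
        1ℚ ∎
      bound : ∃ λ c → d * d * c ≡ 1ℚ × 0ℚ ≤ c
      bound = divide-≤ {a = 0ℚ} 0<dd (≡.subst (_≤ 1ℚ) (≡.sym (ℚ.*-zeroʳ (d * d))) (ℚ.nonNegative⁻¹ 1ℚ))

    power-small : ∀ {ε} → 0ℚ < ε → ∃ λ N → ∀ n → N ℕ.≤ n → r ^ n ≤ ε
    -- `N` is at least `1 / (d ε)`, so `d (N + 1) r^(N+1) ≤ 1 ≤ d ε (N + 1)`, and `d (N + 1)`
    -- cancels. The successor keeps that factor positive.
    power-small {ε} 0<ε = suc N , λ n N≤n → ℚ.≤-trans (r^-antitone N≤n)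
      (ℚ.*-cancelˡ-≤-pos (d * ι (+ suc N)) {{ℚ.positive (0<* 0<1-r 0<ι)}} (begin
        d * ι (+ suc N) * r ^ suc N
          ≡⟨ solve 3 (λ d n x → d :* n :* x := d :* (con 0ℚ :+ n :* x)) ≡.refl d (ι (+ suc N)) (r ^ suc N) ⟩
        d * (0ℚ + ι (+ suc N) * r ^ suc N)
          ≤⟨ *-monoˡ-≤ 0≤d (ℚ.+-monoˡ-≤ (ι (+ suc N) * r ^ suc N) (0≤* 0≤d (0≤weighted (suc N)))) ⟩
        d * (d * ∑ (suc N) (λ k → ι (+ k) * r ^ k) + ι (+ suc N) * r ^ suc N)
          ≤⟨ weighted-total (suc N) ⟩
        1ℚ
          ≡⟨ proj₁ (proj₂ inverse) ⟨
        (d * ε) * proj₁ inverse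
          ≤⟨ *-monoˡ-≤ (ℚ.<⇒≤ (0<* 0<1-r 0<ε)) (ℚ.≤-trans (proj₂ (archimedean (proj₁ inverse))) N≤1+N) ⟩
        (d * ε) * ι (+ suc N)
          ≡⟨ solve 3 (λ d e n → (d :* e) :* n := d :* n :* e) ≡.refl d ε (ι (+ suc N)) ⟩
        d * ι (+ suc N) * ε ∎))
      where
      inverse : ∃ λ c → d * ε * c ≡ 1ℚ × 0ℚ ≤ c
      inverse = divide-≤ {a = 0ℚ} (0<* 0<1-r 0<ε)
        (≡.subst (_≤ 1ℚ) (≡.sym (ℚ.*-zeroʳ (d * ε))) (ℚ.nonNegative⁻¹ 1ℚ))
      N = proj₁ (archimedean (proj₁ inverse))
      N≤1+N : ι (+ N) ≤ ι (+ suc N)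
      N≤1+N = ≡.subst₂ _≤_ (ℚ.+-identityˡ (ι (+ N))) (≡.sym (ι-+ (+ 1) (+ N)))
        (ℚ.+-monoˡ-≤ (ι (+ N)) (ℚ.nonNegative⁻¹ 1ℚ))
      0<ι : 0ℚ < ι (+ suc N)
      0<ι = ≡.subst (0ℚ <_) (≡.sym (ι-+ (+ 1) (+ N)))
        (ℚ.+-mono-<-≤ (ℚ.positive⁻¹ 1ℚ) (0≤ι N))

    -- A majorant of all the products: a factor `1 - a p^j` has norm at most `1 + r^j` when `a` has
    -- norm at most 1 and `p` at most `r`.
    G : ℕ → ℚ
    G n = ∏ n (λ j → 1ℚ + r ^ j)

    0≤G : ∀ n → 0ℚ ≤ G n
    0≤G zero    = ℚ.nonNegative⁻¹ 1ℚ
    0≤G (suc n) = 0≤* (0≤G n) (0≤+ (ℚ.nonNegative⁻¹ 1ℚ) (0≤r^ n))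

    G-suc : ∀ n → G n ≤ G (suc n)
    G-suc n = ≡.subst (_≤ G (suc n)) (ℚ.*-identityʳ (G n))
      (*-monoˡ-≤ (0≤G n) (≡.subst (_≤ 1ℚ + r ^ n) (ℚ.+-identityʳ 1ℚ) (ℚ.+-monoʳ-≤ 1ℚ (0≤r^ n))))

    G-monotone : ∀ {m n} → m ℕ.≤ n → G m ≤ G n
    G-monotone m≤n = go (ℕ.≤⇒≤′ m≤n)
      where
      go : ∀ {m n} → m ℕ.≤′ n → G m ≤ G n
      go ℕ.≤′-refl           = ℚ.≤-refl
      go (ℕ.≤′-step {n} m≤n) = ℚ.≤-trans (go m≤n) (G-suc n)

    -- ∏ (1 + xⱼ) · (1 - ∑ xⱼ) ≤ 1
    G-tail : ∀ J n → G (J ℕ.+ n) * (1ℚ - ∑ n (λ k → r ^ (J ℕ.+ k))) ≤ G J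
    G-tail J zero = ℚ.≤-reflexive (≡.trans (≡.cong (λ n → G n * (1ℚ - 0ℚ)) (ℕ.+-identityʳ J)) (ℚ.*-identityʳ (G J)))
    G-tail J (suc n) = begin
      G (J ℕ.+ suc n) * (1ℚ - (s + x))
        ≡⟨ ≡.cong (λ k → G k * (1ℚ - (s + x))) (ℕ.+-suc J n) ⟩
      g * (1ℚ + x) * (1ℚ - (s + x))
        ≤⟨ ≤-from-difference (≡.subst (0ℚ ≤_)
             (solve 3 (λ g s x → g :* (x :* (s :+ x)) := g :* (con 1ℚ :- s) :- g :* (con 1ℚ :+ x) :* (con 1ℚ :- (s :+ x))) ≡.refl g s x)
             (0≤* (0≤G (J ℕ.+ n)) (0≤* (0≤r^ (J ℕ.+ n)) (0≤+ (0≤s n) (0≤r^ (J ℕ.+ n)))))) ⟩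
      g * (1ℚ - s)
        ≤⟨ G-tail J n ⟩
      G J ∎
      where
      g = G (J ℕ.+ n)
      s = ∑ n (λ k → r ^ (J ℕ.+ k))
      x = r ^ (J ℕ.+ n)
      0≤s : ∀ n → 0ℚ ≤ ∑ n (λ k → r ^ (J ℕ.+ k))
      0≤s zero    = ℚ.≤-refl
      0≤s (suc n) = 0≤+ (0≤s n) (0≤r^ (J ℕ.+ n))

    G-bound : ∃ λ C → ∀ n → G n ≤ C
    G-bound = G J + G J , λ n → ℚ.≤-trans (G-monotone (ℕ.m≤n+m n J)) (ℚ.*-cancelˡ-≤-pos ½ (begin
      ½ * G (J ℕ.+ n)
        ≡⟨ ℚ.*-comm ½ (G (J ℕ.+ n)) ⟩
      G (J ℕ.+ n) * ½
        ≤⟨ *-monoˡ-≤ (0≤G (J ℕ.+ n)) (≤-from-difference (≡.subst (0ℚ ≤_)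
             (solve 1 (λ s → con ½ :- s := (con 1ℚ :- s) :- con ½) ≡.refl (∑ n (λ k → r ^ (J ℕ.+ k))))
             (difference-≥0 (tail-≤ n)))) ⟩
      G (J ℕ.+ n) * (1ℚ - ∑ n (λ k → r ^ (J ℕ.+ k)))
        ≤⟨ G-tail J n ⟩
      G J
        ≡⟨ solve 1 (λ g → g := con ½ :* (g :+ g)) ≡.refl (G J) ⟩
      ½ * (G J + G J) ∎))
      where
      -- With `r^J ≤ d / 2` every tail sum is at most `r^J / d ≤ ½`, so that `G-tail` gives
      -- `G (J + n) ≤ 2 G J`.
      small : ∃ λ N → ∀ n → N ℕ.≤ n → r ^ n ≤ ½ * d
      small = power-small (0<½* 0<1-r)
      J = proj₁ small
      tail-≤ : ∀ n → ∑ n (λ k → r ^ (J ℕ.+ k)) ≤ ½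
      tail-≤ n = ℚ.*-cancelˡ-≤-pos d {{ℚ.positive 0<1-r}}
        (ℚ.≤-trans (geometric-≤ J n) (ℚ.≤-trans (proj₂ small J ℕ.≤-refl) (ℚ.≤-reflexive (ℚ.*-comm ½ d))))

open ≡ using (refl; sym; trans; cong; cong₂; subst; subst₂)

-- Polynomials modulo a power of x

module Convolution where
  open import Data.Rational using (_+_; _*_)
  open ℚ-Solver.+-*-Solver
  open ≡.≡-Reasoning

  Coefficients : Set
  Coefficients = ℕ → ℚ

  tail : Coefficients → Coefficients
  tail f n = f (suc n)

  infixl 7 _⋆_
  _⋆_ : Coefficients → Coefficients → Coefficients
  (f ⋆ g) zero    = f 0 * g 0
  (f ⋆ g) (suc n) = f 0 * g (suc n) + (tail f ⋆ g) n

  -- A coefficient of a product depends only on coefficients of no larger index; hence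
  -- multiplication respects agreement modulo a power of x.
  ⋆-cong≤ : ∀ {f f′ g g′} n → (∀ i → i ℕ.≤ n → f i ≡ f′ i) → (∀ i → i ℕ.≤ n → g i ≡ g′ i) →
    (f ⋆ g) n ≡ (f′ ⋆ g′) n
  ⋆-cong≤ zero    e h = cong₂ _*_ (e 0 ℕ.z≤n) (h 0 ℕ.z≤n)
  ⋆-cong≤ (suc n) e h = cong₂ _+_ (cong₂ _*_ (e 0 ℕ.z≤n) (h (suc n) ℕ.≤-refl))
    (⋆-cong≤ n (λ i i≤n → e (suc i) (ℕ.s≤s i≤n)) (λ i i≤n → h i (ℕ.m≤n⇒m≤1+n i≤n)))

  ⋆-cong : ∀ {f f′ g g′} → (∀ i → f i ≡ f′ i) → (∀ i → g i ≡ g′ i) → ∀ n → (f ⋆ g) n ≡ (f′ ⋆ g′) n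
  ⋆-cong e h n = ⋆-cong≤ n (λ i _ → e i) (λ i _ → h i)

  ⋆-zeroˡ : ∀ f g → (∀ i → f i ≡ 0ℚ) → ∀ n → (f ⋆ g) n ≡ 0ℚ
  ⋆-zeroˡ f g z zero    = trans (cong (_* g 0) (z 0)) (ℚ.*-zeroˡ (g 0))
  ⋆-zeroˡ f g z (suc n) = cong₂ _+_ (trans (cong (_* g (suc n)) (z 0)) (ℚ.*-zeroˡ (g (suc n))))
    (⋆-zeroˡ (tail f) g (λ i → z (suc i)) n)

  ⋆-distribʳ : ∀ f g h n → ((λ i → f i + g i) ⋆ h) n ≡ (f ⋆ h) n + (g ⋆ h) n
  ⋆-distribʳ f g h zero    = ℚ.*-distribʳ-+ (h 0) (f 0) (g 0)
  ⋆-distribʳ f g h (suc n) = trans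
    (cong (λ x → (f 0 + g 0) * h (suc n) + x) (⋆-distribʳ (tail f) (tail g) h n))
    (solve 5 (λ f g h x y → (f :+ g) :* h :+ (x :+ y) := (f :* h :+ x) :+ (g :* h :+ y)) refl
      (f 0) (g 0) (h (suc n)) _ _)

  ⋆-scaleˡ : ∀ c f g n → ((λ i → c * f i) ⋆ g) n ≡ c * (f ⋆ g) n
  ⋆-scaleˡ c f g zero    = ℚ.*-assoc c (f 0) (g 0)
  ⋆-scaleˡ c f g (suc n) = trans (cong (λ x → c * f 0 * g (suc n) + x) (⋆-scaleˡ c (tail f) g n))
    (solve 4 (λ c f g x → c :* f :* g :+ c :* x := c :* (f :* g :+ x)) refl c (f 0) (g (suc n)) _)

  ⋆-sucʳ : ∀ f g n → (f ⋆ g) (suc n) ≡ (f ⋆ tail g) n + f (suc n) * g 0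
  ⋆-sucʳ f g zero    = refl
  ⋆-sucʳ f g (suc n) = trans (cong (λ x → f 0 * g (suc (suc n)) + x) (⋆-sucʳ (tail f) g n))
    (sym (ℚ.+-assoc (f 0 * g (suc (suc n))) _ _))

  ⋆-comm : ∀ f g n → (f ⋆ g) n ≡ (g ⋆ f) n
  ⋆-comm f g zero    = ℚ.*-comm (f 0) (g 0)
  ⋆-comm f g (suc n) = begin
    f 0 * g (suc n) + (tail f ⋆ g) n  ≡⟨ ℚ.+-comm (f 0 * g (suc n)) _ ⟩
    (tail f ⋆ g) n + f 0 * g (suc n)  ≡⟨ cong₂ _+_ (⋆-comm (tail f) g n) (ℚ.*-comm (f 0) (g (suc n))) ⟩
    (g ⋆ tail f) n + g (suc n) * f 0  ≡⟨ ⋆-sucʳ g f n ⟨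
    (g ⋆ f) (suc n)                   ∎

  ⋆-assoc : ∀ f g h n → ((f ⋆ g) ⋆ h) n ≡ (f ⋆ (g ⋆ h)) n
  ⋆-assoc f g h zero    = ℚ.*-assoc (f 0) (g 0) (h 0)
  ⋆-assoc f g h (suc n) = begin
    f 0 * g 0 * h (suc n) + ((λ i → f 0 * g (suc i) + (tail f ⋆ g) i) ⋆ h) n
      ≡⟨ cong (λ x → f 0 * g 0 * h (suc n) + x) (⋆-distribʳ (λ i → f 0 * g (suc i)) (tail f ⋆ g) h n) ⟩
    f 0 * g 0 * h (suc n) + (((λ i → f 0 * g (suc i)) ⋆ h) n + ((tail f ⋆ g) ⋆ h) n)
      ≡⟨ cong₂ (λ x y → f 0 * g 0 * h (suc n) + (x + y)) (⋆-scaleˡ (f 0) (tail g) h n) (⋆-assoc (tail f) g h n) ⟩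
    f 0 * g 0 * h (suc n) + (f 0 * (tail g ⋆ h) n + (tail f ⋆ (g ⋆ h)) n)
      ≡⟨ solve 5 (λ f g h x y → f :* g :* h :+ (f :* x :+ y) := f :* (g :* h :+ x) :+ y) refl
           (f 0) (g 0) (h (suc n)) _ _ ⟩
    f 0 * (g 0 * h (suc n) + (tail g ⋆ h) n) + (tail f ⋆ (g ⋆ h)) n ∎

  infixl 6 _⊕_
  infixl 7 _⊗_
  _⊕_ _⊗_ : List ℚ → List ℚ → List ℚ
  []      ⊕ q       = q
  (a ∷ p) ⊕ []      = a ∷ p
  (a ∷ p) ⊕ (b ∷ q) = a + b ∷ p ⊕ q

  scale : ℚ → List ℚ → List ℚ
  scale c = map (c *_)

  []      ⊗ q = []
  (a ∷ p) ⊗ q = scale a q ⊕ (0ℚ ∷ p ⊗ q)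

  ⊖_ : List ℚ → List ℚ
  ⊖_ = map (λ a → ℚ.- a)

  coefficient : List ℚ → Coefficients
  coefficient []      n       = 0ℚ
  coefficient (a ∷ p) zero    = a
  coefficient (a ∷ p) (suc n) = coefficient p n

  coefficient-⊕ : ∀ p q n → coefficient (p ⊕ q) n ≡ coefficient p n + coefficient q n
  coefficient-⊕ []      q       n       = sym (ℚ.+-identityˡ _)
  coefficient-⊕ (a ∷ p) []      n       = sym (ℚ.+-identityʳ _)
  coefficient-⊕ (a ∷ p) (b ∷ q) zero    = refl
  coefficient-⊕ (a ∷ p) (b ∷ q) (suc n) = coefficient-⊕ p q n

  coefficient-scale : ∀ c p n → coefficient (scale c p) n ≡ c * coefficient p n
  coefficient-scale c []      n       = sym (ℚ.*-zeroʳ c)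
  coefficient-scale c (a ∷ p) zero    = refl
  coefficient-scale c (a ∷ p) (suc n) = coefficient-scale c p n

  coefficient-⊖ : ∀ p n → coefficient (⊖ p) n ≡ ℚ.- coefficient p n
  coefficient-⊖ []      n       = refl
  coefficient-⊖ (a ∷ p) zero    = refl
  coefficient-⊖ (a ∷ p) (suc n) = coefficient-⊖ p n

  coefficient-⊗ : ∀ p q n → coefficient (p ⊗ q) n ≡ (coefficient p ⋆ coefficient q) n
  coefficient-⊗ []      q n       = sym (⋆-zeroˡ (λ _ → 0ℚ) (coefficient q) (λ _ → refl) n)
  coefficient-⊗ (a ∷ p) q zero    = trans (coefficient-⊕ (scale a q) (0ℚ ∷ p ⊗ q) 0)
    (trans (ℚ.+-identityʳ _) (coefficient-scale a q 0))
  coefficient-⊗ (a ∷ p) q (suc n) = trans (coefficient-⊕ (scale a q) (0ℚ ∷ p ⊗ q) (suc n))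
    (cong₂ _+_ (coefficient-scale a q (suc n)) (coefficient-⊗ p q n))

open Convolution using (_⊕_; _⊗_; ⊖_; scale; coefficient) public

-- Only the equality depends on `N`: the carrier and the operations are those of polynomials, so one
-- list can be read modulo several powers of x. Being a record, it lets `p` and `q` be inferred.
record Agree (N : ℕ) (p q : List ℚ) : Set where
  constructor agree
  field below : ∀ n → n ℕ.< N → coefficient p n ≡ coefficient q n

open Agree public

ℚ[x]/x^ : ℕ → CommutativeRing 0ℓ 0ℓ
ℚ[x]/x^ N = CommutativeRingLaws.commutativeRing (Agree N) _⊕_ _⊗_ ⊖_ [] (1ℚ ∷ [])
  (record { refl = agree λ _ _ → refl
          ; sym = λ e → agree λ n n< → sym (below e n n<)
          ; trans = λ e f → agree λ n n< → trans (below e n n<) (below f n n<) })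
  (λ {p} {p′} {q} {q′} e f → agree λ n n< → trans (coefficient-⊕ p q n)
    (trans (cong₂ ℚ._+_ (below e n n<) (below f n n<)) (sym (coefficient-⊕ p′ q′ n))))
  (λ {p} {p′} {q} {q′} e f → agree λ n n< → trans (coefficient-⊗ p q n)
    (trans (⋆-cong≤ n (λ i i≤n → below e i (ℕ.≤-<-trans i≤n n<)) (λ i i≤n → below f i (ℕ.≤-<-trans i≤n n<)))
      (sym (coefficient-⊗ p′ q′ n))))
  (λ {p} {q} e → agree λ n n< → trans (coefficient-⊖ p n) (trans (cong (λ a → ℚ.- a) (below e n n<)) (sym (coefficient-⊖ q n))))
  (λ p q s → always λ n → begin
    coefficient ((p ⊕ q) ⊕ s) n
      ≡⟨ trans (coefficient-⊕ (p ⊕ q) s n) (cong (ℚ._+ coefficient s n) (coefficient-⊕ p q n)) ⟩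
    (coefficient p n ℚ.+ coefficient q n) ℚ.+ coefficient s n
      ≡⟨ ℚ.+-assoc (coefficient p n) (coefficient q n) (coefficient s n) ⟩
    coefficient p n ℚ.+ (coefficient q n ℚ.+ coefficient s n)
      ≡⟨ trans (coefficient-⊕ p (q ⊕ s) n) (cong (coefficient p n ℚ.+_) (coefficient-⊕ q s n)) ⟨
    coefficient (p ⊕ (q ⊕ s)) n ∎)
  (λ p q → always λ n → trans (coefficient-⊕ p q n)
    (trans (ℚ.+-comm (coefficient p n) (coefficient q n)) (sym (coefficient-⊕ q p n))))
  (λ p → always λ n → refl)
  (λ p → always λ n → trans (coefficient-⊕ (⊖ p) p n)
    (trans (cong (ℚ._+ coefficient p n) (coefficient-⊖ p n)) (ℚ.+-inverseˡ (coefficient p n))))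
  (λ p q s → always λ n → begin
    coefficient ((p ⊗ q) ⊗ s) n
      ≡⟨ coefficient-⊗ (p ⊗ q) s n ⟩
    (coefficient (p ⊗ q) ⋆ coefficient s) n
      ≡⟨ ⋆-cong {g = coefficient s} (coefficient-⊗ p q) (λ _ → refl) n ⟩
    ((coefficient p ⋆ coefficient q) ⋆ coefficient s) n
      ≡⟨ ⋆-assoc (coefficient p) (coefficient q) (coefficient s) n ⟩
    (coefficient p ⋆ (coefficient q ⋆ coefficient s)) n
      ≡⟨ ⋆-cong {coefficient p} (λ _ → refl) (coefficient-⊗ q s) n ⟨
    (coefficient p ⋆ coefficient (q ⊗ s)) n
      ≡⟨ coefficient-⊗ p (q ⊗ s) n ⟨
    coefficient (p ⊗ (q ⊗ s)) n ∎)
  (λ p q → always λ n → trans (coefficient-⊗ p q n)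
    (trans (⋆-comm (coefficient p) (coefficient q) n) (sym (coefficient-⊗ q p n))))
  (λ p → always λ n → trans (coefficient-⊗ (1ℚ ∷ []) p n) (one-⋆ p n))
  (λ s p q → always λ n → begin
    coefficient ((p ⊕ q) ⊗ s) n
      ≡⟨ coefficient-⊗ (p ⊕ q) s n ⟩
    (coefficient (p ⊕ q) ⋆ coefficient s) n
      ≡⟨ ⋆-cong {g = coefficient s} (coefficient-⊕ p q) (λ _ → refl) n ⟩
    ((λ i → coefficient p i ℚ.+ coefficient q i) ⋆ coefficient s) n
      ≡⟨ ⋆-distribʳ (coefficient p) (coefficient q) (coefficient s) n ⟩
    (coefficient p ⋆ coefficient s) n ℚ.+ (coefficient q ⋆ coefficient s) n
      ≡⟨ cong₂ ℚ._+_ (coefficient-⊗ p s n) (coefficient-⊗ q s n) ⟨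
    coefficient (p ⊗ s) n ℚ.+ coefficient (q ⊗ s) n
      ≡⟨ coefficient-⊕ (p ⊗ s) (q ⊗ s) n ⟨
    coefficient (p ⊗ s ⊕ q ⊗ s) n ∎)
  where
  open Convolution
  open ≡.≡-Reasoning
  always : ∀ {p q} → (∀ n → coefficient p n ≡ coefficient q n) → Agree N p q
  always e = agree λ n _ → e n
  one-⋆ : ∀ p n → (coefficient (1ℚ ∷ []) ⋆ coefficient p) n ≡ coefficient p n
  one-⋆ p zero    = ℚ.*-identityˡ _
  one-⋆ p (suc n) = trans (cong₂ ℚ._+_ (ℚ.*-identityˡ (coefficient p (suc n)))
    (⋆-zeroˡ (λ _ → 0ℚ) (coefficient p) (λ _ → refl) n)) (ℚ.+-identityʳ (coefficient p (suc n)))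

x̂ : List ℚ
x̂ = 0ℚ ∷ 1ℚ ∷ []

coefficient-x̂-zero : ∀ p → coefficient (x̂ ⊗ p) 0 ≡ 0ℚ
coefficient-x̂-zero p = trans (coefficient-⊗ x̂ p 0) (ℚ.*-zeroˡ (coefficient p 0))
  where open Convolution

coefficient-x̂-suc : ∀ p n → coefficient (x̂ ⊗ p) (suc n) ≡ coefficient p n
coefficient-x̂-suc p n = trans (coefficient-⊗ x̂ p (suc n)) (trans
  (cong₂ ℚ._+_ (ℚ.*-zeroˡ (coefficient p (suc n))) (sym (coefficient-⊗ (1ℚ ∷ []) p n)))
  (trans (ℚ.+-identityˡ _) (below (CommutativeRing.*-identityˡ (ℚ[x]/x^ (suc n)) p) n ℕ.≤-refl)))
  where open Convolution

x̂-nilpotent : ∀ N → let open CommutativeRing (ℚ[x]/x^ N) in Exp._^_ commutativeSemiring x̂ N ≈ 0#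
x̂-nilpotent N = agree (vanish N)
  where
  x̂^ : ℕ → List ℚ
  x̂^ = Exp._^_ (CommutativeRing.commutativeSemiring (ℚ[x]/x^ N)) x̂
  vanish : ∀ k n → n ℕ.< k → coefficient (x̂^ k) n ≡ 0ℚ
  vanish (suc k) zero    _           = coefficient-x̂-zero (x̂^ k)
  vanish (suc k) (suc n) (ℕ.s≤s n<k) = trans (coefficient-x̂-suc (x̂^ k) n) (vanish k n n<k)

-- Evaluation of polynomials and the weighted coefficient norm

record PolynomialEvaluation (K : CommutativeRing 0ℓ 0ℓ) : Set where
  open CommutativeRing K hiding (zero) renaming (refl to ≈-refl; sym to ≈-sym; trans to ≈-trans)
  field
    q      : Carrier
    const  : ℚ → Carrier
    eval   : List ℚ → Carrier
    const-0 : const 0ℚ ≈ 0#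
    const-1 : const 1ℚ ≈ 1#
    const-+ : ∀ a b → const (a ℚ.+ b) ≈ const a + const b
    const-* : ∀ a b → const (a ℚ.* b) ≈ const a * const b
    const-neg : ∀ a → const (ℚ.- a) ≈ - const a
    eval-[] : eval [] ≈ 0#
    eval-∷  : ∀ a p → eval (a ∷ p) ≈ const a + q * eval p

  open IntegerMultiples K
  open Solver
  open import Relation.Binary.Reasoning.Setoid setoid

  -- Evaluation does not respect agreement modulo `x^N`, so it is no homomorphism on the quotient
  -- ring. Its compatibility is proved for the operations on lists, which the quotient shares.
  eval-⊕ : ∀ p s → eval (p ⊕ s) ≈ eval p + eval s
  eval-⊕ []      s       = ≈-sym (≈-trans (+-congʳ eval-[]) (+-identityˡ (eval s)))
  eval-⊕ (a ∷ p) []      = ≈-sym (≈-trans (+-congˡ eval-[]) (+-identityʳ (eval (a ∷ p))))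
  eval-⊕ (a ∷ p) (b ∷ s) = begin
    eval (a ℚ.+ b ∷ p ⊕ s)
      ≈⟨ eval-∷ (a ℚ.+ b) (p ⊕ s) ⟩
    const (a ℚ.+ b) + q * eval (p ⊕ s)
      ≈⟨ +-cong (const-+ a b) (*-congˡ (eval-⊕ p s)) ⟩
    (const a + const b) + q * (eval p + eval s)
      ≈⟨ solve 5 (λ a b q x y → (a :+ b) :+ q :* (x :+ y) := (a :+ q :* x) :+ (b :+ q :* y)) ≈-refl
           (const a) (const b) q (eval p) (eval s) ⟩
    (const a + q * eval p) + (const b + q * eval s)
      ≈⟨ +-cong (eval-∷ a p) (eval-∷ b s) ⟨
    eval (a ∷ p) + eval (b ∷ s) ∎

  eval-scale : ∀ c p → eval (scale c p) ≈ const c * eval p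
  eval-scale c []      = ≈-trans eval-[] (≈-sym (≈-trans (*-congˡ eval-[]) (zeroʳ (const c))))
  eval-scale c (a ∷ p) = begin
    eval (c ℚ.* a ∷ scale c p)
      ≈⟨ eval-∷ (c ℚ.* a) (scale c p) ⟩
    const (c ℚ.* a) + q * eval (scale c p)
      ≈⟨ +-cong (const-* c a) (*-congˡ (eval-scale c p)) ⟩
    const c * const a + q * (const c * eval p)
      ≈⟨ solve 4 (λ c a q x → c :* a :+ q :* (c :* x) := c :* (a :+ q :* x)) ≈-refl
           (const c) (const a) q (eval p) ⟩
    const c * (const a + q * eval p)
      ≈⟨ *-congˡ (eval-∷ a p) ⟨
    const c * eval (a ∷ p) ∎

  eval-⊗ : ∀ p s → eval (p ⊗ s) ≈ eval p * eval s
  eval-⊗ []      s = ≈-trans eval-[] (≈-sym (≈-trans (*-congʳ eval-[]) (zeroˡ (eval s))))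
  eval-⊗ (a ∷ p) s = begin
    eval (scale a s ⊕ (0ℚ ∷ p ⊗ s))
      ≈⟨ eval-⊕ (scale a s) (0ℚ ∷ p ⊗ s) ⟩
    eval (scale a s) + eval (0ℚ ∷ p ⊗ s)
      ≈⟨ +-cong (eval-scale a s) (≈-trans (eval-∷ 0ℚ (p ⊗ s)) (+-cong const-0 (*-congˡ (eval-⊗ p s)))) ⟩
    const a * eval s + (0# + q * (eval p * eval s))
      ≈⟨ solve 4 (λ a s q p → a :* s :+ (con (+ 0) :+ q :* (p :* s)) := (a :+ q :* p) :* s) ≈-refl
           (const a) (eval s) q (eval p) ⟩
    (const a + q * eval p) * eval s
      ≈⟨ *-congʳ (eval-∷ a p) ⟨
    eval (a ∷ p) * eval s ∎

  eval-⊖ : ∀ p → eval (⊖ p) ≈ - eval p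
  eval-⊖ []      = ≈-trans eval-[] (≈-sym (≈-trans (-‿cong eval-[]) (solve 0 (:- con (+ 0) := con (+ 0)) ≈-refl)))
  eval-⊖ (a ∷ p) = begin
    eval (ℚ.- a ∷ ⊖ p)
      ≈⟨ eval-∷ (ℚ.- a) (⊖ p) ⟩
    const (ℚ.- a) + q * eval (⊖ p)
      ≈⟨ +-cong (const-neg a) (*-congˡ (eval-⊖ p)) ⟩
    - const a + q * (- eval p)
      ≈⟨ solve 3 (λ a q p → :- a :+ q :* (:- p) := :- (a :+ q :* p)) ≈-refl (const a) q (eval p) ⟩
    - (const a + q * eval p)
      ≈⟨ -‿cong (eval-∷ a p) ⟨
    - eval (a ∷ p) ∎

  eval-1 : eval (1ℚ ∷ []) ≈ 1#
  eval-1 = begin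
    eval (1ℚ ∷ [])            ≈⟨ eval-∷ 1ℚ [] ⟩
    const 1ℚ + q * eval []    ≈⟨ +-cong const-1 (*-congˡ eval-[]) ⟩
    1# + q * 0#               ≈⟨ solve 1 (λ q → con (+ 1) :+ q :* con (+ 0) := con (+ 1)) ≈-refl q ⟩
    1#                        ∎

  eval-x̂ : eval x̂ ≈ q
  eval-x̂ = begin
    eval x̂                         ≈⟨ eval-∷ 0ℚ (1ℚ ∷ []) ⟩
    const 0ℚ + q * eval (1ℚ ∷ [])  ≈⟨ +-cong const-0 (*-congˡ eval-1) ⟩
    0# + q * 1#                    ≈⟨ solve 1 (λ q → con (+ 0) :+ q :* con (+ 1) := q) ≈-refl q ⟩
    q                              ∎

  module _ (N : ℕ) where
    private
      module R = CommutativeRing (ℚ[x]/x^ N)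
      module RE = Exp R.commutativeSemiring
      module RS = Sums (ℚ[x]/x^ N)
      module RT = TripleProduct (ℚ[x]/x^ N)
      module RI = IntegerMultiples (ℚ[x]/x^ N)
      module KS = Sums K
      module KT = TripleProduct K
      module KE = Exp commutativeSemiring

    eval-^ : ∀ p n → eval (p RE.^ n) ≈ eval p KE.^ n
    eval-^ p zero    = eval-1
    eval-^ p (suc n) = ≈-trans (eval-⊗ p (p RE.^ n)) (*-congˡ (eval-^ p n))

    eval-⟨⟩ : ∀ a p n → eval (RT.⟨ a ⨾ p ⟩ n) ≈ KT.⟨ eval a ⨾ eval p ⟩ n
    eval-⟨⟩ a p zero    = eval-1
    eval-⟨⟩ a p (suc n) = ≈-trans (eval-⊗ (RT.⟨ a ⨾ p ⟩ n) (R.1# ⊕ ⊖ (a ⊗ (p RE.^ n))))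
      (*-cong (eval-⟨⟩ a p n)
        (≈-trans (eval-⊕ R.1# (⊖ (a ⊗ (p RE.^ n)))) (+-cong eval-1
          (≈-trans (eval-⊖ (a ⊗ (p RE.^ n))) (-‿cong
            (≈-trans (eval-⊗ a (p RE.^ n)) (*-congˡ (eval-^ p n))))))))

    eval-∑ : ∀ n f → eval (RS.∑ n f) ≈ KS.∑ n (λ k → eval (f k))
    eval-∑ zero    f = eval-[]
    eval-∑ (suc n) f = ≈-trans (eval-⊕ (RS.∑ n f) (f n)) (+-congʳ (eval-∑ n f))

    eval-∑ℤ : ∀ a b f → eval (RS.∑ℤ a b f) ≈ KS.∑ℤ a b (λ k → eval (f k))
    eval-∑ℤ a b f = ≈-trans (eval-⊕ (RS.∑ a (λ k → f -[1+ k ])) (RS.∑ b (λ k → f (+ k))))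
      (+-cong (eval-∑ a (λ k → f -[1+ k ])) (eval-∑ b (λ k → f (+ k))))

    eval-ι : ∀ n → eval (RI.ι n) ≈ ι n
    eval-ι (+ n)    = pos n
      where
      pos : ∀ n → eval (RI.ι (+ n)) ≈ ι (+ n)
      pos 0             = eval-[]
      pos 1             = eval-1
      pos (suc (suc n)) = ≈-trans (eval-⊕ (RI.ι (+ suc n)) (1ℚ ∷ [])) (+-cong (pos (suc n)) eval-1)
    eval-ι -[1+ n ] = ≈-trans (eval-⊖ (RI.ι (+ suc n))) (-‿cong (eval-ι (+ suc n)))

module Norm (r : ℚ) (0≤r : 0ℚ ℚ.≤ r) where
  open import Data.Rational using (_≤_; ∣_∣)
  open ℚ-Lemmas using (0≤+; 0≤*; *-mono-≤; *-monoˡ-≤) renaming (_^_ to _^ℚ_; ι to ιℚ; ∏ to ∏ℚ; ∑ to ∑ℚ)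
  open ℚ-Solver.+-*-Solver
  open ℚ.≤-Reasoning

  -- The sum `∑ ∣aₙ∣ rⁿ` in Horner form. It belongs to the representative, not to its class modulo a
  -- power of x.
  norm : List ℚ → ℚ
  norm []      = 0ℚ
  norm (a ∷ p) = ∣ a ∣ ℚ.+ r ℚ.* norm p

  0≤norm : ∀ p → 0ℚ ≤ norm p
  0≤norm []      = ℚ.≤-refl
  0≤norm (a ∷ p) = 0≤+ (ℚ.0≤∣p∣ a) (0≤* 0≤r (0≤norm p))

  norm-⊕ : ∀ p s → norm (p ⊕ s) ≤ norm p ℚ.+ norm s
  norm-⊕ []      s       = ℚ.≤-reflexive (sym (ℚ.+-identityˡ (norm s)))
  norm-⊕ (a ∷ p) []      = ℚ.≤-reflexive (sym (ℚ.+-identityʳ (norm (a ∷ p))))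
  norm-⊕ (a ∷ p) (b ∷ s) = begin
    ∣ a ℚ.+ b ∣ ℚ.+ r ℚ.* norm (p ⊕ s)
      ≤⟨ ℚ.+-mono-≤ (ℚ.∣p+q∣≤∣p∣+∣q∣ a b) (*-monoˡ-≤ 0≤r (norm-⊕ p s)) ⟩
    (∣ a ∣ ℚ.+ ∣ b ∣) ℚ.+ r ℚ.* (norm p ℚ.+ norm s)
      ≡⟨ solve 5 (λ a b r x y → (a :+ b) :+ r :* (x :+ y) := (a :+ r :* x) :+ (b :+ r :* y)) refl
           ∣ a ∣ ∣ b ∣ r (norm p) (norm s) ⟩
    norm (a ∷ p) ℚ.+ norm (b ∷ s) ∎

  norm-scale : ∀ c p → norm (scale c p) ≡ ∣ c ∣ ℚ.* norm p
  norm-scale c []      = sym (ℚ.*-zeroʳ ∣ c ∣)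
  norm-scale c (a ∷ p) = trans (cong₂ (λ x y → x ℚ.+ r ℚ.* y) (ℚ.∣p*q∣≡∣p∣*∣q∣ c a) (norm-scale c p))
    (solve 4 (λ c a r x → c :* a :+ r :* (c :* x) := c :* (a :+ r :* x)) refl ∣ c ∣ ∣ a ∣ r (norm p))

  norm-⊖ : ∀ p → norm (⊖ p) ≡ norm p
  norm-⊖ []      = refl
  norm-⊖ (a ∷ p) = cong₂ (λ x y → x ℚ.+ r ℚ.* y) (ℚ.∣-p∣≡∣p∣ a) (norm-⊖ p)

  norm-⊗ : ∀ p s → norm (p ⊗ s) ≤ norm p ℚ.* norm s
  norm-⊗ []      s = ℚ.≤-reflexive (sym (ℚ.*-zeroˡ (norm s)))
  norm-⊗ (a ∷ p) s = begin
    norm (scale a s ⊕ (0ℚ ∷ p ⊗ s))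
      ≤⟨ norm-⊕ (scale a s) (0ℚ ∷ p ⊗ s) ⟩
    norm (scale a s) ℚ.+ (0ℚ ℚ.+ r ℚ.* norm (p ⊗ s))
      ≤⟨ ℚ.+-mono-≤ (ℚ.≤-reflexive (norm-scale a s)) (ℚ.+-monoʳ-≤ 0ℚ (*-monoˡ-≤ 0≤r (norm-⊗ p s))) ⟩
    ∣ a ∣ ℚ.* norm s ℚ.+ (0ℚ ℚ.+ r ℚ.* (norm p ℚ.* norm s))
      ≡⟨ solve 4 (λ a s r p → a :* s :+ (con 0ℚ :+ r :* (p :* s)) := (a :+ r :* p) :* s) refl
           ∣ a ∣ (norm s) r (norm p) ⟩
    norm (a ∷ p) ℚ.* norm s ∎

  norm-⊗-≤ : ∀ {p s a b} → norm p ≤ a → norm s ≤ b → norm (p ⊗ s) ≤ a ℚ.* b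
  norm-⊗-≤ {p} {s} p≤a s≤b = ℚ.≤-trans (norm-⊗ p s)
    (*-mono-≤ (0≤norm p) (ℚ.≤-trans (0≤norm s) s≤b) p≤a s≤b)

  norm-⊕-≤ : ∀ {p s a b} → norm p ≤ a → norm s ≤ b → norm (p ⊕ s) ≤ a ℚ.+ b
  norm-⊕-≤ {p} {s} p≤a s≤b = ℚ.≤-trans (norm-⊕ p s) (ℚ.+-mono-≤ p≤a s≤b)

  norm-⊖-≤ : ∀ {p a} → norm p ≤ a → norm (⊖ p) ≤ a
  norm-⊖-≤ {p} = subst (_≤ _) (sym (norm-⊖ p))

  norm-1 : norm (1ℚ ∷ []) ≤ 1ℚ
  norm-1 = ℚ.≤-reflexive (solve 1 (λ r → con 1ℚ :+ r :* con 0ℚ := con 1ℚ) refl r)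

  norm-x̂ : norm x̂ ≤ r
  norm-x̂ = ℚ.≤-reflexive (solve 1 (λ r → con 0ℚ :+ r :* (con 1ℚ :+ r :* con 0ℚ) := r) refl r)

  module _ (N : ℕ) where
    private
      module R = CommutativeRing (ℚ[x]/x^ N)
      module RE = Exp R.commutativeSemiring
      module RS = Sums (ℚ[x]/x^ N)
      module RT = TripleProduct (ℚ[x]/x^ N)
      module RI = IntegerMultiples (ℚ[x]/x^ N)

    norm-^ : ∀ {p b} n → norm p ≤ b → norm (p RE.^ n) ≤ b ^ℚ n
    norm-^     zero    p≤b = norm-1
    norm-^ {p} (suc n) p≤b = norm-⊗-≤ {p} {p RE.^ n} p≤b (norm-^ n p≤b)

    norm-⟨⟩ : ∀ {a p} → norm a ≤ 1ℚ → norm p ≤ r → ∀ n → norm (RT.⟨ a ⨾ p ⟩ n) ≤ ∏ℚ n (λ j → 1ℚ ℚ.+ r ^ℚ j)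
    norm-⟨⟩         a≤1 p≤r zero    = norm-1
    norm-⟨⟩ {a} {p} a≤1 p≤r (suc n) = norm-⊗-≤ {RT.⟨ a ⨾ p ⟩ n} {R.1# ⊕ ⊖ (a ⊗ (p RE.^ n))} (norm-⟨⟩ {a} {p} a≤1 p≤r n)
      (norm-⊕-≤ {R.1#} {⊖ (a ⊗ (p RE.^ n))} norm-1 (norm-⊖-≤ {a ⊗ (p RE.^ n)}
        (subst (norm (a ⊗ (p RE.^ n)) ≤_) (ℚ.*-identityˡ (r ^ℚ n))
          (norm-⊗-≤ {a} {p RE.^ n} a≤1 (norm-^ n p≤r)))))

    norm-∑ : ∀ n {f g} → (∀ k → norm (f k) ≤ g k) → norm (RS.∑ n f) ≤ ∑ℚ n g
    norm-∑ zero        e = ℚ.≤-refl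
    norm-∑ (suc n) {f} e = norm-⊕-≤ {RS.∑ n f} {f n} (norm-∑ n e) (e n)

    norm-ι : ∀ n → norm (RI.ι n) ≤ ιℚ (+ ℤ.∣ n ∣)
    norm-ι (+ n)    = pos n
      where
      pos : ∀ n → norm (RI.ι (+ n)) ≤ ιℚ (+ n)
      pos 0             = ℚ.≤-refl
      pos 1             = norm-1
      pos (suc (suc n)) = norm-⊕-≤ {RI.ι (+ suc n)} {1ℚ ∷ []} (pos (suc n)) norm-1
    norm-ι -[1+ n ] = norm-⊖-≤ {RI.ι (+ suc n)} (norm-ι (+ suc n))

-- Convergence

import Defs
open Defs using (ℂ; mkℝ; re; im; approx; cauchy; Cauchy)

-- Gaussian rationals as approximations of complex numbers

module ℚ[i] where
  open ℚ-Solver.+-*-Solver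
  open ℚ-Lemmas using (magnitude-+; magnitude-*)

  𝔾 : Set
  𝔾 = ℚ × ℚ

  infixl 6 _+_
  infixl 7 _*_

  -- Opaque, because conversion checking explodes once rational arithmetic is unfolded.
  opaque
    _+_ _*_ : 𝔾 → 𝔾 → 𝔾
    (a , b) + (c , d) = a ℚ.+ c , b ℚ.+ d
    (a , b) * (c , d) = a ℚ.* c ℚ.- b ℚ.* d , a ℚ.* d ℚ.+ b ℚ.* c

    neg : 𝔾 → 𝔾
    neg (a , b) = ℚ.- a , ℚ.- b

    +-assoc : ∀ x y z → (x + y) + z ≡ x + (y + z)
    +-assoc (a , b) (c , d) (e , f) = cong₂ _,_ (ℚ.+-assoc a c e) (ℚ.+-assoc b d f)

    +-comm : ∀ x y → x + y ≡ y + x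
    +-comm (a , b) (c , d) = cong₂ _,_ (ℚ.+-comm a c) (ℚ.+-comm b d)

    +-identityˡ : ∀ x → (0ℚ , 0ℚ) + x ≡ x
    +-identityˡ (a , b) = cong₂ _,_ (ℚ.+-identityˡ a) (ℚ.+-identityˡ b)

    +-inverseˡ : ∀ x → neg x + x ≡ (0ℚ , 0ℚ)
    +-inverseˡ (a , b) = cong₂ _,_ (ℚ.+-inverseˡ a) (ℚ.+-inverseˡ b)

    *-assoc : ∀ x y z → (x * y) * z ≡ x * (y * z)
    *-assoc (a , b) (c , d) (e , f) = cong₂ _,_
      (solve 6 (λ a b c d e f → (a :* c :- b :* d) :* e :- (a :* d :+ b :* c) :* f
        := a :* (c :* e :- d :* f) :- b :* (c :* f :+ d :* e)) refl a b c d e f)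
      (solve 6 (λ a b c d e f → (a :* c :- b :* d) :* f :+ (a :* d :+ b :* c) :* e
        := a :* (c :* f :+ d :* e) :+ b :* (c :* e :- d :* f)) refl a b c d e f)

    *-comm : ∀ x y → x * y ≡ y * x
    *-comm (a , b) (c , d) = cong₂ _,_
      (solve 4 (λ a b c d → a :* c :- b :* d := c :* a :- d :* b) refl a b c d)
      (solve 4 (λ a b c d → a :* d :+ b :* c := c :* b :+ d :* a) refl a b c d)

    *-identityˡ : ∀ x → (1ℚ , 0ℚ) * x ≡ x
    *-identityˡ (a , b) = cong₂ _,_
      (solve 2 (λ a b → con 1ℚ :* a :- con 0ℚ :* b := a) refl a b)
      (solve 2 (λ a b → con 1ℚ :* b :+ con 0ℚ :* a := b) refl a b)

    distribʳ : ∀ x y z → (y + z) * x ≡ y * x + z * x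
    distribʳ (a , b) (c , d) (e , f) = cong₂ _,_
      (solve 6 (λ a b c d e f → (c :+ e) :* a :- (d :+ f) :* b
        := (c :* a :- d :* b) :+ (e :* a :- f :* b)) refl a b c d e f)
      (solve 6 (λ a b c d e f → (c :+ e) :* b :+ (d :+ f) :* a
        := (c :* b :+ d :* a) :+ (e :* b :+ f :* a)) refl a b c d e f)

    const-+ : ∀ a b → (a ℚ.+ b , 0ℚ) ≡ (a , 0ℚ) + (b , 0ℚ)
    const-+ a b = refl

    const-* : ∀ a b → (a ℚ.* b , 0ℚ) ≡ (a , 0ℚ) * (b , 0ℚ)
    const-* a b = cong₂ _,_
      (solve 2 (λ a b → a :* b := a :* b :- con 0ℚ :* con 0ℚ) refl a b)
      (solve 2 (λ a b → con 0ℚ := a :* con 0ℚ :+ con 0ℚ :* b) refl a b)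

    const-neg : ∀ a → (ℚ.- a , 0ℚ) ≡ neg (a , 0ℚ)
    const-neg a = refl

  ring : CommutativeRing 0ℓ 0ℓ
  ring = CommutativeRingLaws.commutativeRing _≡_ _+_ _*_ neg (0ℚ , 0ℚ) (1ℚ , 0ℚ) ≡.isEquivalence
    (cong₂ _+_) (cong₂ _*_) (cong neg) +-assoc +-comm +-identityˡ +-inverseˡ
    *-assoc *-comm *-identityˡ distribʳ

  record Bounded (x : 𝔾) (c : ℚ) : Set where
    constructor bounded
    field
      nonneg    : 0ℚ ℚ.≤ c
      magnitude : proj₁ x ℚ.* proj₁ x ℚ.+ proj₂ x ℚ.* proj₂ x ℚ.≤ c ℚ.* c

  opaque
    unfolding _+_

    bounded-+ : ∀ {x y c d} → Bounded x c → Bounded y d → Bounded (x + y) (c ℚ.+ d)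
    bounded-+ {a , b} {c , d} (bounded 0≤r p) (bounded 0≤s q) = bounded (ℚ-Lemmas.0≤+ 0≤r 0≤s)
      (magnitude-+ {a} {b} {c} {d} 0≤r 0≤s p q)

    bounded-* : ∀ {x y c d} → Bounded x c → Bounded y d → Bounded (x * y) (c ℚ.* d)
    bounded-* {a , b} {c , d} {r} {s} (bounded 0≤r p) (bounded 0≤s q) = bounded (ℚ-Lemmas.0≤* 0≤r 0≤s)
      (magnitude-* {a} {b} {c} {d} {r} {s} p q)

  bounded-const : ∀ a → Bounded (a , 0ℚ) ℚ.∣ a ∣
  bounded-const a = bounded (ℚ.0≤∣p∣ a) (ℚ.≤-reflexive (trans
    (solve 1 (λ a → a :* a :+ con 0ℚ :* con 0ℚ := a :* a) refl a) (sym (ℚ-Lemmas.square-∣∣ a))))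

  bounded-weaken : ∀ {x c d} → Bounded x c → c ℚ.≤ d → Bounded x d
  bounded-weaken (bounded 0≤c p) c≤d = bounded (ℚ.≤-trans 0≤c c≤d)
    (ℚ.≤-trans p (ℚ-Lemmas.*-mono-≤ 0≤c (ℚ.≤-trans 0≤c c≤d) c≤d c≤d))

  opaque
    -- Operations on ℂ act pointwise on approximating sequences, so `value i` commutes with them
    -- exactly; no error terms arise.
    value : ℕ → ℂ → 𝔾
    value i z = approx (re z) i , approx (im z) i

  opaque
    unfolding _+_ value

    value-def : ∀ i z → value i z ≡ (approx (re z) i , approx (im z) i)
    value-def i z = refl

    value-0 : ∀ i → value i Defs.0ℂ ≡ (0ℚ , 0ℚ)
    value-0 i = refl

    value-1 : ∀ i → value i Defs.1ℂ ≡ (1ℚ , 0ℚ)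
    value-1 i = refl

    value-+ : ∀ i z w → value i (z Defs.+ w) ≡ value i z + value i w
    value-+ i z w = refl

    value-* : ∀ i z w → value i (z Defs.* w) ≡ value i z * value i w
    value-* i z w = refl

    value-neg : ∀ i z → value i (Defs.- z) ≡ neg (value i z)
    value-neg i z = refl

    value-const : ∀ i a → value i (Defs.fromℚ a Defs.+i Defs.0ℝ) ≡ (a , 0ℚ)
    value-const i a = refl

  module Eval (g : 𝔾) where
    eval : List ℚ → 𝔾
    eval []      = 0ℚ , 0ℚ
    eval (a ∷ p) = (a , 0ℚ) + g * eval p

    evaluation : PolynomialEvaluation ring
    evaluation = record
      { q = g ; const = λ a → a , 0ℚ ; eval = eval ; const-0 = refl ; const-1 = refl
      ; const-+ = const-+ ; const-* = const-* ; const-neg = const-neg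
      ; eval-[] = refl ; eval-∷ = λ _ _ → refl }

    open PolynomialEvaluation evaluation public
      using (eval-⊕; eval-⊗; eval-⊖; eval-1; eval-x̂; eval-^; eval-⟨⟩; eval-∑ℤ; eval-ι)

  open CommutativeRing ring using (_-_)
  open Exp (CommutativeRing.commutativeSemiring ring) using (_^_)
  open IntegerMultiples ring using (ι; ι-unique)
  open Sums ring using (∑; ∏; ∑ℤ; ∏-cong)
  open TripleProduct ring using (⟨_⨾_⟩)

  value-- : ∀ i z w → value i (z Defs.- w) ≡ value i z - value i w
  value-- i z w = trans (value-+ i z (Defs.- w)) (cong (λ x → value i z + x) (value-neg i w))

  open RawMonoid (RawSemiring.*-rawMonoid Defs.ℂ-rawSemiring) using () renaming (_×_ to _×ℂ_)

  value-^ : ∀ i z n → value i (z Defs.^ n) ≡ value i z ^ n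
  value-^ i z zero    = value-1 i
  value-^ i z (suc n) = trans (value-* i z (n ×ℂ z)) (cong (λ x → value i z * x) (value-^ i z n))

  value-∏ : ∀ i n f → value i (Defs.∏< n f) ≡ ∏ n (λ k → value i (f k))
  value-∏ i zero    f = value-1 i
  value-∏ i (suc n) f = trans (value-* i (Defs.∏< n f) (f n)) (cong (λ x → x * value i (f n)) (value-∏ i n f))

  factor : ℂ → ℂ → ℕ → ℂ
  factor a p j = Defs.1ℂ Defs.- a Defs.* p Defs.^ j

  value-factor : ∀ i a p j → value i (factor a p j) ≡ (1ℚ , 0ℚ) - value i a * value i p ^ j
  value-factor i a p j = trans (value-- i Defs.1ℂ (a Defs.* p Defs.^ j))
    (cong₂ _-_ (value-1 i)
      (trans (value-* i a (p Defs.^ j)) (cong (λ x → value i a * x) (value-^ i p j))))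

  value-⟨⟩ : ∀ i n a p → value i (Defs.∏< n (factor a p)) ≡ ⟨ value i a ⨾ value i p ⟩ n
  value-⟨⟩ i n a p = trans (value-∏ i n (factor a p))
    (∏-cong n {λ j → value i (factor a p j)} {λ j → (1ℚ , 0ℚ) - value i a * value i p ^ j} (value-factor i a p))

  value-∑ : ∀ i n f → value i (Defs.∑< n f) ≡ ∑ n (λ k → value i (f k))
  value-∑ i zero    f = value-0 i
  value-∑ i (suc n) f = trans (value-+ i (Defs.∑< n f) (f n)) (cong (λ x → x + value i (f n)) (value-∑ i n f))

  value-∑ℤ : ∀ i a b f → value i (Defs.∑-between a b f) ≡ ∑ℤ a b (λ k → value i (f k))
  value-∑ℤ i a b f = trans (value-+ i (Defs.∑< a (λ k → f -[1+ k ])) (Defs.∑< b (λ k → f (+ k))))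
    (cong₂ _+_ (value-∑ i a (λ k → f -[1+ k ])) (value-∑ i b (λ k → f (+ k))))

  value-fromℤ : ∀ i n → value i (Defs.fromℤ n) ≡ ι n
  value-fromℤ i = ι-unique (λ n → value i (Defs.fromℤ n)) (value-const i 1ℚ)
    (λ m n → trans (value-const i ((m ℤ.+ n) ℚ./ 1)) (trans (cong (_, 0ℚ) (ℚ-Lemmas./1-+ m n))
      (trans (const-+ (m ℚ./ 1) (n ℚ./ 1)) (sym (cong₂ _+_ (value-const i (m ℚ./ 1)) (value-const i (n ℚ./ 1)))))))

module Closeness where
  open ℚ[i] using (ring; value; value-def; Bounded; bounded)
  open CommutativeRing ring using (_+_; _-_)
  open import Data.Rational using (∣_∣; _≤_; _<_)
  open ℚ.≤-Reasoning
  open ℚ-Solver.+-*-Solver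
  open ℚ-Lemmas using (0<*; 0<½*)

  halves : ∀ ε → ½ ℚ.* ε ℚ.+ ½ ℚ.* ε ≡ ε
  halves = solve 1 (λ ε → con ½ :* ε :+ con ½ :* ε := ε) refl

  ½*< : ∀ {ε} → 0ℚ < ε → ½ ℚ.* ε < ε
  ½*< {ε} 0<ε = subst₂ _<_ (ℚ.+-identityʳ (½ ℚ.* ε)) (halves ε)
    (ℚ.+-monoʳ-< (½ ℚ.* ε) (0<½* 0<ε))

  opaque
    unfolding ℚ[i]._+_

    bounded-difference : ∀ {x y c} → Bounded (x - y) c →
      ∣ proj₁ x ℚ.- proj₁ y ∣ ≤ c × ∣ proj₂ x ℚ.- proj₂ y ∣ ≤ c
    bounded-difference {a , b} {c , d} (bounded 0≤c p) = ℚ-Lemmas.component-≤ {a ℚ.- c} {b ℚ.- d} 0≤c p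

  modulus-approx : ∀ w i → approx Defs.∣ w ∣² i
    ≡ approx (re w) i ℚ.* approx (re w) i ℚ.+ approx (im w) i ℚ.* approx (im w) i
  modulus-approx w i = refl

  bounded⇒∣∣< : ∀ w {ε} → 0ℚ < ε → (∃ λ N → ∀ i → N ℕ.≤ i → Bounded (value i w) (½ ℚ.* ε)) → Defs.∣ w ∣< ε
  -- Strict inequality of reals asks for a uniform gap. With `η = ε / 2` both the bound and the gap
  -- are `η²`, and `2 η² ≤ 4 η² = ε²`.
  bounded⇒∣∣< w {ε} 0<ε (N , h) = ℚ.<⇒≤ 0<ε , η ℚ.* η , 0<* (0<½* 0<ε) (0<½* 0<ε) , N , λ i N≤i → begin
    approx Defs.∣ w ∣² i ℚ.+ η ℚ.* η
      ≤⟨ ℚ.+-monoˡ-≤ (η ℚ.* η) (subst (_≤ η ℚ.* η) (sym (modulus-approx w i))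
           (Bounded.magnitude (subst (λ x → Bounded x η) (value-def i w) (h i N≤i)))) ⟩
    η ℚ.* η ℚ.+ η ℚ.* η
      ≤⟨ subst₂ _≤_ (ℚ.+-identityʳ (η ℚ.* η ℚ.+ η ℚ.* η))
           (solve 1 (λ ε → (con ½ :* ε :* (con ½ :* ε) :+ con ½ :* ε :* (con ½ :* ε)) :+ (con ½ :* ε :* (con ½ :* ε) :+ con ½ :* ε :* (con ½ :* ε)) := ε :* ε) refl ε)
           (ℚ.+-monoʳ-≤ (η ℚ.* η ℚ.+ η ℚ.* η) (ℚ-Lemmas.0≤+ (ℚ-Lemmas.0≤square η) (ℚ-Lemmas.0≤square η))) ⟩
    ε ℚ.* ε ∎
    where η = ½ ℚ.* ε

  bounded⇒≈ : ∀ z w → (∀ ε → 0ℚ < ε → ∃ λ N → ∀ i → N ℕ.≤ i → Bounded (value i z - value i w) ε) → z Defs.≈ w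
  bounded⇒≈ z w h =
      (λ ε 0<ε → proj₁ (h (½ ℚ.* ε) (0<½* 0<ε)) , λ i N≤i →
        ℚ.≤-<-trans (proj₁ (difference ε 0<ε i N≤i)) (½*< 0<ε))
    , (λ ε 0<ε → proj₁ (h (½ ℚ.* ε) (0<½* 0<ε)) , λ i N≤i →
        ℚ.≤-<-trans (proj₂ (difference ε 0<ε i N≤i)) (½*< 0<ε))
    where
    difference : ∀ ε (0<ε : 0ℚ < ε) i → proj₁ (h (½ ℚ.* ε) (0<½* 0<ε)) ℕ.≤ i →
      ∣ approx (re z) i ℚ.- approx (re w) i ∣ ≤ ½ ℚ.* ε × ∣ approx (im z) i ℚ.- approx (im w) i ∣ ≤ ½ ℚ.* ε
    difference ε 0<ε i N≤i = bounded-difference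
      (subst₂ (λ x y → Bounded (x - y) (½ ℚ.* ε)) (value-def i z) (value-def i w)
        (proj₂ (h (½ ℚ.* ε) (0<½* 0<ε)) i N≤i))

  -- The outer two of three differences change the row at a fixed stage, the middle one changes the
  -- stage in the single row `M`; they are allotted ε/4, ε/4 and ε/2. Uniformity in the stage lets
  -- row and stage move together.
  diagonal-cauchy : (f : ℕ → ℕ → ℚ) → (∀ n → Cauchy (f n)) →
    (∀ ε → 0ℚ < ε → ∃ λ M → ∀ i m n → M ℕ.≤ i → M ℕ.≤ m → M ℕ.≤ n → ∣ f m i ℚ.- f n i ∣ ≤ ε) →
    Cauchy (λ i → f i i)
  diagonal-cauchy f fc uniform ε 0<ε = M ℕ.⊔ L , λ m n m≥ n≥ →
    let M≤m = ℕ.≤-trans (ℕ.m≤m⊔n M L) m≥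
        L≤m = ℕ.≤-trans (ℕ.m≤n⊔m M L) m≥
        M≤n = ℕ.≤-trans (ℕ.m≤m⊔n M L) n≥
        L≤n = ℕ.≤-trans (ℕ.m≤n⊔m M L) n≥
    in begin-strict
      ∣ f m m ℚ.- f n n ∣
        ≡⟨ cong ∣_∣ (solve 4 (λ a b c d → a :- d := ((a :- b) :+ (b :- c)) :+ (c :- d)) refl
             (f m m) (f M m) (f M n) (f n n)) ⟩
      ∣ ((f m m ℚ.- f M m) ℚ.+ (f M m ℚ.- f M n)) ℚ.+ (f M n ℚ.- f n n) ∣
        ≤⟨ ℚ.≤-trans (ℚ.∣p+q∣≤∣p∣+∣q∣ ((f m m ℚ.- f M m) ℚ.+ (f M m ℚ.- f M n)) (f M n ℚ.- f n n))
             (ℚ.+-monoˡ-≤ ∣ f M n ℚ.- f n n ∣ (ℚ.∣p+q∣≤∣p∣+∣q∣ (f m m ℚ.- f M m) (f M m ℚ.- f M n))) ⟩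
      (∣ f m m ℚ.- f M m ∣ ℚ.+ ∣ f M m ℚ.- f M n ∣) ℚ.+ ∣ f M n ℚ.- f n n ∣
        <⟨ ℚ.+-mono-<-≤ (ℚ.+-mono-≤-< (proj₂ (uniform η 0<η) m m M M≤m M≤m ℕ.≤-refl)
             (proj₂ (fc M (½ ℚ.* ε) (0<½* 0<ε)) m n L≤m L≤n))
             (proj₂ (uniform η 0<η) n M n M≤n ℕ.≤-refl M≤n) ⟩
      (η ℚ.+ ½ ℚ.* ε) ℚ.+ η
        ≡⟨ solve 1 (λ ε → (con ½ :* (con ½ :* ε) :+ con ½ :* ε) :+ con ½ :* (con ½ :* ε) := ε) refl ε ⟩
      ε ∎
    where
    η = ½ ℚ.* (½ ℚ.* ε)
    0<η : 0ℚ < η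
    0<η = 0<½* (0<½* 0<ε)
    M = proj₁ (uniform η 0<η)
    L = proj₁ (fc M (½ ℚ.* ε) (0<½* 0<ε))

-- Limits of compatible truncations

module Limits (q : ℂ) (r : ℚ) (0<r : 0ℚ ℚ.< r) (r<1 : r ℚ.< 1ℚ) (K : ℕ)
  (q-bounded : ∀ i → K ℕ.≤ i → ℚ[i].Bounded (ℚ[i].value i q) (r ℚ.* r)) where
  open ℚ-Lemmas using (_^_; 0≤+; *-monoˡ-≤; divide-≤; 0<½*)
  open ℚ-Lemmas.Geometric r 0<r r<1
  open Norm r 0≤r
  open ℚ[i] hiding (_+_; _*_)
  open CommutativeRing ring using (_+_; _-_)
  open Closeness
  open import Data.Rational using (∣_∣; _≤_; _<_)
  open ℚ-Solver.+-*-Solver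
  open ℚ.≤-Reasoning

  ev : ℕ → List ℚ → 𝔾
  ev i = Eval.eval (value i q)

  -- Exhibits `ev i p`, for fixed `p`, as the i-th approximation of a complex number, which makes it
  -- Cauchy in `i`.
  evℂ : List ℚ → ℂ
  evℂ []      = Defs.0ℂ
  evℂ (a ∷ p) = (Defs.fromℚ a Defs.+i Defs.0ℝ) Defs.+ q Defs.* evℂ p

  value-evℂ : ∀ i p → value i (evℂ p) ≡ ev i p
  value-evℂ i []      = value-0 i
  value-evℂ i (a ∷ p) = trans (value-+ i (Defs.fromℚ a Defs.+i Defs.0ℝ) (q Defs.* evℂ p))
    (cong₂ _+_ (value-const i a) (trans (value-* i q (evℂ p)) (cong (λ x → value i q ℚ[i].* x) (value-evℂ i p))))

  ev-re : ∀ i p → approx (re (evℂ p)) i ≡ proj₁ (ev i p)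
  ev-re i p = cong proj₁ (trans (sym (value-def i (evℂ p))) (value-evℂ i p))

  ev-im : ∀ i p → approx (im (evℂ p)) i ≡ proj₂ (ev i p)
  ev-im i p = cong proj₂ (trans (sym (value-def i (evℂ p))) (value-evℂ i p))

  ev-bounded : ∀ i → K ℕ.≤ i → ∀ p → Bounded (ev i p) (norm p)
  ev-bounded i K≤i []      = bounded ℚ.≤-refl ℚ.≤-refl
  ev-bounded i K≤i (a ∷ p) = bounded-weaken
    (bounded-+ (bounded-const a) (bounded-* (q-bounded i K≤i) (ev-bounded i K≤i p)))
    (ℚ.+-monoʳ-≤ ∣ a ∣ (ℚ.*-monoʳ-≤-nonNeg (norm p) {{ℚ.nonNegative (0≤norm p)}} rr≤r))
    where
    rr≤r : r ℚ.* r ≤ r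
    rr≤r = subst (r ℚ.* r ≤_) (ℚ.*-identityʳ r) (*-monoˡ-≤ 0≤r (ℚ.<⇒≤ r<1))

  -- For `n ≥ N` one has `∣aₙ∣ r^(2n) ≤ r^N ∣aₙ∣ r^n`: this is where the bound `r²` on the
  -- approximations of `q` pays off.
  ev-small : ∀ i → K ℕ.≤ i → ∀ N p → (∀ n → n ℕ.< N → coefficient p n ≡ 0ℚ) →
    Bounded (ev i p) (r ^ N ℚ.* norm p)
  ev-small i K≤i zero    p       z = subst (Bounded (ev i p)) (sym (ℚ.*-identityˡ (norm p))) (ev-bounded i K≤i p)
  ev-small i K≤i (suc N) []      z = subst (Bounded (0ℚ , 0ℚ)) (sym (ℚ.*-zeroʳ (r ^ suc N))) (bounded ℚ.≤-refl ℚ.≤-refl)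
  ev-small i K≤i (suc N) (a ∷ p) z = subst (Bounded (ev i (a ∷ p))) rearrange
    (bounded-+ (bounded-const a) (bounded-* (q-bounded i K≤i)
      (ev-small i K≤i N p λ n n<N → z (suc n) (ℕ.s≤s n<N))))
    where
    rearrange : ∣ a ∣ ℚ.+ (r ℚ.* r) ℚ.* (r ^ N ℚ.* norm p) ≡ r ^ suc N ℚ.* (∣ a ∣ ℚ.+ r ℚ.* norm p)
    rearrange = trans (cong (λ x → ∣ x ∣ ℚ.+ (r ℚ.* r) ℚ.* (r ^ N ℚ.* norm p)) (z 0 (ℕ.s≤s ℕ.z≤n)))
      (trans (solve 3 (λ r x n → con 0ℚ :+ (r :* r) :* (x :* n) := r :* x :* (con 0ℚ :+ r :* n)) refl r (r ^ N) (norm p))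
        (cong (λ x → r ^ suc N ℚ.* (∣ x ∣ ℚ.+ r ℚ.* norm p)) (sym (z 0 (ℕ.s≤s ℕ.z≤n)))))

  ev-close : ∀ i → K ℕ.≤ i → ∀ {N p s C} → Agree N p s → norm p ≤ C → norm s ≤ C →
    Bounded (ev i p - ev i s) (r ^ N ℚ.* (C ℚ.+ C))
  ev-close i K≤i {N} {p} {s} {C} p~s p≤C s≤C = bounded-weaken
    (subst (λ x → Bounded x (r ^ N ℚ.* norm (p ⊕ ⊖ s)))
      (trans (Eval.eval-⊕ (value i q) p (⊖ s)) (cong (λ x → ev i p + x) (Eval.eval-⊖ (value i q) s)))
      (ev-small i K≤i N (p ⊕ ⊖ s) vanish))
    (*-monoˡ-≤ (0≤r^ N) (norm-⊕-≤ {p} {⊖ s} p≤C (norm-⊖-≤ {s} s≤C)))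
    where
    vanish : ∀ n → n ℕ.< N → coefficient (p ⊕ ⊖ s) n ≡ 0ℚ
    vanish n n<N = trans (Convolution.coefficient-⊕ p (⊖ s) n)
      (trans (cong₂ ℚ._+_ (below p~s n n<N) (Convolution.coefficient-⊖ s n)) (ℚ.+-inverseʳ (coefficient s n)))

  scaled-small : ∀ {D ε} → 0ℚ ≤ D → 0ℚ < ε → ∃ λ N → ∀ n → N ℕ.≤ n → r ^ n ℚ.* D ≤ ε
  scaled-small {D} {ε} 0≤D 0<ε = N , λ n N≤n → begin
    r ^ n ℚ.* D        ≤⟨ *-monoˡ-≤ (0≤r^ n) D≤1+D ⟩
    r ^ n ℚ.* (1ℚ ℚ.+ D)  ≤⟨ ℚ.*-monoʳ-≤-nonNeg (1ℚ ℚ.+ D) {{ℚ.nonNegative (ℚ.<⇒≤ 0<1+D)}} (proj₂ (power-small 0<c) n N≤n) ⟩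
    c ℚ.* (1ℚ ℚ.+ D)   ≡⟨ trans (ℚ.*-comm c (1ℚ ℚ.+ D)) (proj₁ (proj₂ quotient)) ⟩
    ε                  ∎
    where
    0<1+D : 0ℚ < 1ℚ ℚ.+ D
    0<1+D = ℚ.+-mono-<-≤ (ℚ.positive⁻¹ 1ℚ) 0≤D
    D≤1+D : D ≤ 1ℚ ℚ.+ D
    D≤1+D = subst (_≤ 1ℚ ℚ.+ D) (ℚ.+-identityˡ D) (ℚ.+-monoˡ-≤ D (ℚ.nonNegative⁻¹ 1ℚ))
    quotient : ∃ λ c → (1ℚ ℚ.+ D) ℚ.* c ≡ ε × 0ℚ ≤ c
    quotient = divide-≤ 0<1+D (subst (_≤ ε) (sym (ℚ.*-zeroʳ (1ℚ ℚ.+ D))) (ℚ.<⇒≤ 0<ε))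
    c = proj₁ quotient
    0<c : 0ℚ < c
    0<c = ℚ.*-cancelˡ-<-nonNeg (1ℚ ℚ.+ D) {{ℚ.nonNegative (ℚ.<⇒≤ 0<1+D)}}
      (subst₂ _<_ (sym (ℚ.*-zeroʳ (1ℚ ℚ.+ D))) (sym (proj₁ (proj₂ quotient))) 0<ε)
    N = proj₁ (power-small 0<c)

  -- A formal power series, presented as an element of the inverse limit of the rings `ℚ[x]/x^ n`,
  -- with a uniform norm bound on the representatives.
  record Coherent (s : ℕ → List ℚ) (C : ℚ) : Set where
    field
      norm-≤ : ∀ n → norm (s n) ≤ C
      agrees : ∀ {m n} → m ℕ.≤ n → Agree m (s m) (s n)

    0≤C : 0ℚ ≤ C
    0≤C = ℚ.≤-trans (0≤norm (s 0)) (norm-≤ 0)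

    both-agree : ∀ {N m n} → N ℕ.≤ m → N ℕ.≤ n → Agree N (s m) (s n)
    both-agree {N} N≤m N≤n = R.trans (R.sym (agrees N≤m)) (agrees N≤n)
      where module R = CommutativeRing (ℚ[x]/x^ N)

    uniform : ∀ ε → 0ℚ < ε → ∃ λ M → ∀ i m n → M ℕ.≤ i → M ℕ.≤ m → M ℕ.≤ n →
      Bounded (ev i (s m) - ev i (s n)) ε
    uniform ε 0<ε = K ℕ.⊔ N , λ i m n i≥ m≥ n≥ → bounded-weaken
      (ev-close i (ℕ.≤-trans (ℕ.m≤m⊔n K N) i≥) {N}
        (both-agree (ℕ.≤-trans (ℕ.m≤n⊔m K N) m≥) (ℕ.≤-trans (ℕ.m≤n⊔m K N) n≥)) (norm-≤ m) (norm-≤ n))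
      (proj₂ (scaled-small (0≤+ 0≤C 0≤C) 0<ε) N ℕ.≤-refl)
      where N = proj₁ (scaled-small (0≤+ 0≤C 0≤C) 0<ε)

    -- The i-th approximation of the limit is the i-th polynomial at the i-th approximation of q.
    limit : ℂ
    limit = mkℝ (λ i → proj₁ (ev i (s i)))
        (diagonal-cauchy (λ n i → proj₁ (ev i (s n)))
          (λ n → cauchy-cong (λ i → ev-re i (s n)) (cauchy (re (evℂ (s n)))))
          (λ ε 0<ε → proj₁ (uniform ε 0<ε) , λ i m n i≥ m≥ n≥ →
            proj₁ (bounded-difference (proj₂ (uniform ε 0<ε) i m n i≥ m≥ n≥))))
      Defs.+i
      mkℝ (λ i → proj₂ (ev i (s i)))
        (diagonal-cauchy (λ n i → proj₂ (ev i (s n)))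
          (λ n → cauchy-cong (λ i → ev-im i (s n)) (cauchy (im (evℂ (s n)))))
          (λ ε 0<ε → proj₁ (uniform ε 0<ε) , λ i m n i≥ m≥ n≥ →
            proj₂ (bounded-difference (proj₂ (uniform ε 0<ε) i m n i≥ m≥ n≥))))
      where
      cauchy-cong : ∀ {f g : ℕ → ℚ} → (∀ i → f i ≡ g i) → Cauchy f → Cauchy g
      cauchy-cong e fc ε 0<ε = proj₁ (fc ε 0<ε) , λ m n m≥ n≥ →
        subst₂ (λ x y → ∣ x ℚ.- y ∣ < ε) (e m) (e n) (proj₂ (fc ε 0<ε) m n m≥ n≥)

    value-limit : ∀ i → value i limit ≡ ev i (s i)
    value-limit i = value-def i limit

    -- `N` is chosen before `z` and `p`: one order of agreement serves every polynomial within the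
    -- norm bound, so partial products and two-ended partial sums are treated alike.
    near-limit : ∀ ε → 0ℚ < ε → ∃ λ N → ∀ z p → (∀ i → value i z ≡ ev i p) → norm p ≤ C →
      (∀ i → N ℕ.≤ i → Agree N p (s i)) → Defs.∣ z Defs.- limit ∣< ε
    near-limit ε 0<ε = N , λ z p z≡p p≤C p~s → bounded⇒∣∣< (z Defs.- limit) 0<ε
      (K ℕ.⊔ N , λ i i≥ → bounded-weaken
        (subst (λ x → Bounded x (r ^ N ℚ.* (C ℚ.+ C)))
          (sym (trans (value-- i z limit) (cong₂ _-_ (z≡p i) (value-limit i))))
          (ev-close i (ℕ.≤-trans (ℕ.m≤m⊔n K N) i≥) {N} (p~s i (ℕ.≤-trans (ℕ.m≤n⊔m K N) i≥)) p≤C (norm-≤ i)))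
        (proj₂ (scaled-small (0≤+ 0≤C 0≤C) (0<½* 0<ε)) N ℕ.≤-refl))
      where N = proj₁ (scaled-small (0≤+ 0≤C 0≤C) (0<½* 0<ε))

  -- Keeps what is needed of the limit and hides its diagonal construction.
  record Limit (s : ℕ → List ℚ) (C : ℚ) : Set where
    field
      limit       : ℂ
      value-limit : ∀ i → value i limit ≡ ev i (s i)
      near-limit  : ∀ ε → 0ℚ < ε → ∃ λ N → ∀ z p → (∀ i → value i z ≡ ev i p) → norm p ≤ C →
        (∀ i → N ℕ.≤ i → Agree N p (s i)) → Defs.∣ z Defs.- limit ∣< ε

  coherent⇒limit : ∀ {s C} → Coherent s C → Limit s C
  coherent⇒limit c = record { limit = Coherent.limit c ; value-limit = Coherent.value-limit c ; near-limit = Coherent.near-limit c }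

  -- The order of truncation grows with the stage: the i-th approximations differ by at most
  -- `2 C r^i`, which is all that equality of reals demands.
  agree⇒≈ : ∀ z w (s t : ℕ → List ℚ) C → (∀ i → value i z ≡ ev i (s i)) → (∀ i → value i w ≡ ev i (t i)) →
    (∀ i → norm (s i) ≤ C) → (∀ i → norm (t i) ≤ C) → (∀ i → Agree i (s i) (t i)) → z Defs.≈ w
  agree⇒≈ z w s t C z≡ w≡ s≤C t≤C s~t = bounded⇒≈ z w λ ε 0<ε →
    let N , small = scaled-small (0≤+ 0≤C 0≤C) 0<ε in
    K ℕ.⊔ N , λ i i≥ → bounded-weaken
      (subst₂ (λ x y → Bounded (x - y) (r ^ i ℚ.* (C ℚ.+ C))) (sym (z≡ i)) (sym (w≡ i))
        (ev-close i (ℕ.≤-trans (ℕ.m≤m⊔n K N) i≥) {i} (s~t i) (s≤C i) (t≤C i)))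
      (small i (ℕ.≤-trans (ℕ.m≤n⊔m K N) i≥))
    where
    0≤C : 0ℚ ≤ C
    0≤C = ℚ.≤-trans (0≤norm (s 0)) (s≤C 0)

-- The products and the series as limits of truncations

exponent≡pentagonal : ∀ n → Defs.exponent n ≡ pentagonal n
exponent≡pentagonal n = double-injective (Defs.exponent n) (pentagonal n)
  (trans (cong (λ x → + 2 ℤ.* x) (Defs.exponent-exact n)) (trans (expand (Defs.choose2 n) n)
    (trans (cong (λ x → + 3 ℤ.* x ℤ.+ + 4 ℤ.* n) (Defs.choose2-exact n)) (trans (collect n) (sym (pentagonal-double n))))))
  where
  expand : ∀ c n → + 2 ℤ.* (+ 3 ℤ.* c ℤ.+ + 2 ℤ.* n) ≡ + 3 ℤ.* (c ℤ.* + 2) ℤ.+ + 4 ℤ.* n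
  expand = ℤ-Ring.solve-∀
  collect : ∀ n → + 3 ℤ.* (n ℤ.* (n ℤ.+ ℤ.- (+ 1))) ℤ.+ + 4 ℤ.* n ≡ + 3 ℤ.* (n ℤ.* n) ℤ.+ n
  collect = ℤ-Ring.solve-∀

module Truncation (N : ℕ) where
  open CommutativeRing (ℚ[x]/x^ N) public
    using (_≈_) renaming (sym to ≈-sym; trans to ≈-trans; reflexive to ≈-reflexive)
  open Exp (CommutativeRing.commutativeSemiring (ℚ[x]/x^ N)) public using (_^_)
  open IntegerMultiples (ℚ[x]/x^ N) public using (ι)
  open Sums (ℚ[x]/x^ N) public using (∑; ∑ℤ; module _⇓_)
  open TripleProduct (ℚ[x]/x^ N) public using (⟨_⨾_⟩; ⟨⟩-stable)
  open Series (ℚ[x]/x^ N) x̂ N (x̂-nilpotent N) public using (S; h; z; ∑h; qᵏ-nilpotent; quintuple-derivative)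

  Nilpotent : List ℚ → Set
  Nilpotent p = p ^ N ≈ []

-- Powers, products and sums are recursive functions of a whole ring bundle, proofs included, so
-- different truncations do not give convertible terms although the underlying operations coincide.
-- Induction supplies the equalities.
module Independence (M N : ℕ) where
  module M = Truncation M
  module N = Truncation N

  ^-independent : ∀ p n → p M.^ n ≡ p N.^ n
  ^-independent p zero    = refl
  ^-independent p (suc n) = cong (p ⊗_) (^-independent p n)

  ⟨⟩-independent : ∀ a p n → M.⟨ a ⨾ p ⟩ n ≡ N.⟨ a ⨾ p ⟩ n
  ⟨⟩-independent a p zero    = refl
  ⟨⟩-independent a p (suc n) = cong₂ (λ x y → x ⊗ ((1ℚ ∷ []) ⊕ ⊖ (a ⊗ y)))
    (⟨⟩-independent a p n) (^-independent p n)

  ι-independent : ∀ n → M.ι n ≡ N.ι n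
  ι-independent (+ n)    = pos n
    where
    pos : ∀ n → M.ι (+ n) ≡ N.ι (+ n)
    pos 0             = refl
    pos 1             = refl
    pos (suc (suc n)) = cong (_⊕ (1ℚ ∷ [])) (pos (suc n))
  ι-independent -[1+ n ] = cong ⊖_ (ι-independent (+ suc n))

  h-independent : ∀ n → M.h n ≡ N.h n
  h-independent n = cong₂ _⊗_ (ι-independent n) (^-independent x̂ (pentagonal n))

  ∑-independent : ∀ n {f g} → (∀ k → f k ≡ g k) → M.∑ n f ≡ N.∑ n g
  ∑-independent zero    e = refl
  ∑-independent (suc n) e = cong₂ _⊕_ (∑-independent n e) (e n)

  ∑h-independent : ∀ a b → M.∑ℤ a b M.h ≡ N.∑ℤ a b N.h
  ∑h-independent a b = cong₂ _⊕_
    (∑-independent a λ k → h-independent -[1+ k ]) (∑-independent b λ k → h-independent (+ k))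

module Convergence (q : ℂ) (r : ℚ) (0<r : 0ℚ ℚ.< r) (r<1 : r ℚ.< 1ℚ) (K : ℕ)
  (q-bounded : ∀ i → K ℕ.≤ i → ℚ[i].Bounded (ℚ[i].value i q) (r ℚ.* r)) where
  open Limits q r 0<r r<1 K q-bounded
  open ℚ-Lemmas using () renaming (ι to ιℚ; _^_ to _^ℚ_)
  open ℚ-Lemmas.Geometric r 0<r r<1
  open Norm r 0≤r
  open ℚ[i] using (value; value-⟨⟩; value-∑ℤ; value-fromℤ; value-^; value-*; value-neg; value--; module Eval; factor)
  open import Data.Rational using (_≤_)
  open Truncation using (⟨_⨾_⟩)

  G-limit : ℚ
  G-limit = proj₁ G-bound

  module Product (a p : List ℚ) (a≤1 : norm a ≤ 1ℚ) (p≤r : norm p ≤ r)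
    (nilpotent : ∀ N → Truncation.Nilpotent N p) (z w : ℂ)
    (z≡ : ∀ i → value i z ≡ ev i a) (w≡ : ∀ i → value i w ≡ ev i p) where

    -- The n-th entry is the n-th partial product itself, and by stability it also represents the
    -- infinite product modulo `x^n`.
    family : ℕ → List ℚ
    family n = ⟨_⨾_⟩ n a p n

    norm-product : ∀ N n → norm (⟨_⨾_⟩ N a p n) ≤ G-limit
    norm-product N n = ℚ.≤-trans (norm-⟨⟩ N {a} {p} a≤1 p≤r n) (proj₂ G-bound n)

    coherent : Coherent family G-limit
    coherent = record
      { norm-≤ = λ n → norm-product n n
      ; agrees = λ {m} {n} m≤n → let open Truncation m in ≈-sym (≈-trans
          (≈-reflexive (Independence.⟨⟩-independent n m a p n)) (⟨⟩-stable {a} {p} {m} (nilpotent m) m≤n)) }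

    module _ (X : Limit family G-limit) where
      open Limit X using (limit; near-limit)

      converges : Defs.⟨ z ⨾ w ⟩∞≔ limit
      converges ε 0<ε = N , λ n N≤n → near (Defs.∏< n (factor z w)) (family n)
        (λ i → trans (value-⟨⟩ i n z w) (trans
          (cong₂ (λ x y → 𝔾⟨ x ⨾ y ⟩ n) (z≡ i) (w≡ i)) (sym (Eval.eval-⟨⟩ (value i q) n a p n))))
        (norm-product n n)
        (λ i N≤i → Coherent.both-agree coherent N≤n N≤i)
        where
        open TripleProduct ℚ[i].ring using () renaming (⟨_⨾_⟩ to 𝔾⟨_⨾_⟩)
        N = proj₁ (near-limit ε 0<ε)
        near = proj₂ (near-limit ε 0<ε)

  -- The order 0 is an arbitrary choice: for a numeral exponent the power unfolds to the same list
  -- in every truncation.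
  x̂^ : ℕ → List ℚ
  x̂^ k = Truncation._^_ 0 x̂ k

  r^≤r : ∀ k → r ^ℚ suc k ≤ r
  r^≤r k = subst (r ^ℚ suc k ≤_) (ℚ.*-identityʳ r) (r^-antitone {1} {suc k} (ℕ.s≤s ℕ.z≤n))

  norm-x̂^ : ∀ k → norm (x̂^ (suc k)) ≤ r
  norm-x̂^ k = ℚ.≤-trans (norm-^ 0 {x̂} (suc k) norm-x̂) (r^≤r k)

  norm-x̂^-1 : ∀ k → norm (x̂^ (suc k)) ≤ 1ℚ
  norm-x̂^-1 k = ℚ.≤-trans (norm-x̂^ k) (ℚ.<⇒≤ r<1)

  value-q : ∀ i → value i q ≡ ev i x̂
  value-q i = sym (Eval.eval-x̂ (value i q))

  value-q^ : ∀ i k → value i (q Defs.^ k) ≡ ev i (x̂^ k)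
  value-q^ i k = trans (value-^ i q k) (trans (cong (λ x → x 𝔾^ k) (value-q i)) (sym (Eval.eval-^ (value i q) 0 x̂ k)))
    where open Exp (CommutativeRing.commutativeSemiring ℚ[i].ring) using () renaming (_^_ to _𝔾^_)

  value-negative : ∀ z s → (∀ i → value i z ≡ ev i s) → ∀ i → value i (Defs.- z) ≡ ev i (⊖ s)
  value-negative z s z≡ i = trans (value-neg i z) (trans (cong ℚ[i].neg (z≡ i)) (sym (Eval.eval-⊖ (value i q) s)))

  x̂≤1 : norm x̂ ≤ 1ℚ
  x̂≤1 = ℚ.≤-trans norm-x̂ (ℚ.<⇒≤ r<1)

  ProductLimit : ℂ → ℂ → (ℕ → List ℚ) → Set
  ProductLimit z w s = ∃[ L ]
    ( (Defs.⟨ z ⨾ w ⟩∞≔ L) × (∀ i → value i L ≡ ev i (s i)) × (∀ i → norm (s i) ≤ G-limit) )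

  product-limit : ∀ a p → norm a ≤ 1ℚ → norm p ≤ r → (∀ N → Truncation.Nilpotent N p) →
    ∀ z w → (∀ i → value i z ≡ ev i a) → (∀ i → value i w ≡ ev i p) → ProductLimit z w (λ n → ⟨_⨾_⟩ n a p n)
  product-limit a p a≤1 p≤r nilpotent z w z≡ w≡ = from (coherent⇒limit coherent)
    where
    open Product a p a≤1 p≤r nilpotent z w z≡ w≡
    from : Limit family G-limit → ProductLimit z w family
    from X = Limit.limit X , converges X , Limit.value-limit X , λ i → norm-product i i

  W : ℚ
  W = proj₁ weighted-bound

  module S where
    family : ℕ → List ℚ
    family n = Truncation.S n

    -- The crude bound `∣ n ∣ ≤ pentagonal n` suffices, and leaves the summable majorant
    -- `∣n∣ r^∣n∣`.
    norm-h : ∀ N n → norm (Truncation.h N n) ≤ ιℚ (+ ℤ.∣ n ∣) ℚ.* r ^ℚ ℤ.∣ n ∣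
    norm-h N n = norm-⊗-≤ {Truncation.ι N n} {Truncation.z N n} (norm-ι N n)
      (ℚ.≤-trans (norm-^ N {x̂} (pentagonal n) norm-x̂) (r^-antitone (pentagonal-≥ n)))

    norm-∑h : ∀ N a b → norm (Truncation.∑ℤ N a b (Truncation.h N)) ≤ W ℚ.+ W
    norm-∑h N a b = norm-⊕-≤ {Truncation.∑ N a (λ k → Truncation.h N -[1+ k ])} {Truncation.∑ N b (λ k → Truncation.h N (+ k))}
      (ℚ.≤-trans (norm-∑ N a {λ k → Truncation.h N -[1+ k ]} (λ k → norm-h N -[1+ k ]))
        -- The k-th term of the negative half has modulus index `suc k`; prepending the zero term at
        -- index 0 gives a weighted sum of length `suc a`.
        (ℚ.≤-trans (ℚ.≤-reflexive (sym (trans (ℚ∑-head a (λ k → ιℚ (+ k) ℚ.* r ^ℚ k)) (ℚ.+-identityˡ _))))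
          (proj₂ weighted-bound (suc a))))
      (ℚ.≤-trans (norm-∑ N b {λ k → Truncation.h N (+ k)} (λ k → norm-h N (+ k))) (proj₂ weighted-bound b))
      where open Sums ℚ.+-*-commutativeRing using () renaming (∑-head to ℚ∑-head)

    ∑h-agrees : ∀ N a b n → N ℕ.≤ a → N ℕ.≤ b → N ℕ.≤ n → Agree N (Truncation.∑ℤ N a b (Truncation.h N)) (family n)
    ∑h-agrees N a b n N≤a N≤b N≤n = ≈-trans (constant a b N≤a N≤b)
      (≈-sym (≈-trans (≈-reflexive (Independence.∑h-independent n N n n)) (constant n n N≤n N≤n)))
      where
      open Truncation N
      constant = _⇓_.constant ∑h

    coherent : Coherent family (W ℚ.+ W)
    coherent = record
      { norm-≤ = λ n → norm-∑h n n n
      ; agrees = λ {m} {n} m≤n → ∑h-agrees m m m n ℕ.≤-refl ℕ.≤-refl m≤n }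

    value-power : ∀ i N n e → e ≡ pentagonal n → value i (q Defs.^ e) ≡ ev i (Truncation.z N n)
    value-power i N n e refl = trans (value-q^ i e) (cong (ev i) (Independence.^-independent 0 N x̂ e))

    value-monomial : ∀ i N n w → value i w ≡ ev i (Truncation.z N n) →
      value i (Defs.fromℤ n Defs.* w) ≡ ev i (Truncation.h N n)
    value-monomial i N n w e = trans (value-* i (Defs.fromℤ n) w) (trans
      (cong₂ ℚ[i]._*_ (trans (value-fromℤ i n) (sym (Eval.eval-ι (value i q) N n))) e)
      (sym (Eval.eval-⊗ (value i q) (Truncation.ι N n) (Truncation.z N n))))

    module _ (X : Limit family (W ℚ.+ W)) where
      open Limit X using (limit; near-limit)

      converges : ∀ f → (∀ i N n → value i (f n) ≡ ev i (Truncation.h N n)) → Defs.HasSumℤ f limit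
      converges f f≡ ε 0<ε = N , λ a b N≤a N≤b → near
        (Defs.∑-between a b f) (Truncation.∑ℤ N a b (Truncation.h N))
        (λ i → trans (value-∑ℤ i a b f) (trans
          (𝔾∑ℤ-cong a b {λ n → value i (f n)} {λ n → ev i (Truncation.h N n)} (f≡ i N))
          (sym (Eval.eval-∑ℤ (value i q) N a b (Truncation.h N)))))
        (norm-∑h N a b)
        (λ i N≤i → ∑h-agrees N a b i N≤a N≤b N≤i)
        where
        open Sums ℚ[i].ring using () renaming (∑ℤ-cong to 𝔾∑ℤ-cong)
        N = proj₁ (near-limit ε 0<ε)
        near = proj₂ (near-limit ε 0<ε)

  SeriesLimit : (ℤ → ℂ) → Set
  SeriesLimit f = ∃[ L ] ( Defs.HasSumℤ f L × (∀ i → value i L ≡ ev i (S.family i)) )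

  series-limit : ∀ f → (∀ i N n → value i (f n) ≡ ev i (Truncation.h N n)) → SeriesLimit f
  series-limit f f≡ = from (coherent⇒limit S.coherent)
    where
    from : Limit S.family (W ℚ.+ W) → SeriesLimit f
    from X = Limit.limit X , S.converges X f f≡ , Limit.value-limit X

  rhs : ℕ → List ℚ → List ℚ → List ℚ → List ℚ → List ℚ → List ℚ
  rhs i a b c d e = (a ^ 3 ⊗ b ^ 2) ⊕ ⊖ (c ⊗ d ⊗ e)
    where open Truncation i using (_^_)

  value-lhs : ∀ i z s → value i z ≡ ev i s →
    value i (Defs.fromℤ (+ 6) Defs.* z) ≡ ev i (Truncation.ι i (+ 6) ⊗ s)
  value-lhs i z s e = trans (value-* i (Defs.fromℤ (+ 6)) z) (trans
    (cong₂ ℚ[i]._*_ (trans (value-fromℤ i (+ 6)) (sym (Eval.eval-ι (value i q) i (+ 6)))) e)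
    (sym (Eval.eval-⊗ (value i q) (Truncation.ι i (+ 6)) s)))

  value-power : ∀ i z s n → value i z ≡ ev i s → value i (z Defs.^ n) ≡ ev i (Truncation._^_ i s n)
  value-power i z s n e = trans (value-^ i z n) (trans (cong (λ u → u 𝔾^ n) e) (sym (Eval.eval-^ (value i q) i s n)))
    where open Exp (CommutativeRing.commutativeSemiring ℚ[i].ring) using () renaming (_^_ to _𝔾^_)

  value-product : ∀ i z w s t → value i z ≡ ev i s → value i w ≡ ev i t → value i (z Defs.* w) ≡ ev i (s ⊗ t)
  value-product i z w s t e f = trans (value-* i z w) (trans (cong₂ ℚ[i]._*_ e f) (sym (Eval.eval-⊗ (value i q) s t)))

  value-difference : ∀ i z w s t → value i z ≡ ev i s → value i w ≡ ev i t → value i (z Defs.- w) ≡ ev i (s ⊕ ⊖ t)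
  value-difference i z w s t e f = trans (value-- i z w) (trans (cong₂ _𝔾-_ e f)
    (sym (trans (Eval.eval-⊕ (value i q) s (⊖ t)) (cong (λ u → ev i s ℚ[i].+ u) (Eval.eval-⊖ (value i q) t)))))
    where open CommutativeRing ℚ[i].ring using () renaming (_-_ to _𝔾-_)

  value-rhs : ∀ i x y z v w a b c d e →
    value i x ≡ ev i a → value i y ≡ ev i b → value i z ≡ ev i c → value i v ≡ ev i d → value i w ≡ ev i e →
    value i (x Defs.* y Defs.- z Defs.* v Defs.* w) ≡ ev i ((a ⊗ b) ⊕ ⊖ (c ⊗ d ⊗ e))
  value-rhs i x y z v w a b c d e x≡ y≡ z≡ v≡ w≡ =
    value-difference i (x Defs.* y) (z Defs.* v Defs.* w) (a ⊗ b) (c ⊗ d ⊗ e)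
      (value-product i x y a b x≡ y≡)
      (value-product i (z Defs.* v) w (c ⊗ d) e (value-product i z v c d z≡ v≡) w≡)

  norm-rhs : ∀ i {a b c d e G} → norm a ≤ G → norm b ≤ G → norm c ≤ G → norm d ≤ G → norm e ≤ G →
    norm (rhs i a b c d e) ≤ G ^ℚ 3 ℚ.* G ^ℚ 2 ℚ.+ G ℚ.* G ℚ.* G
  norm-rhs i {a} {b} {c} {d} {e} a≤ b≤ c≤ d≤ e≤ = norm-⊕-≤ {a ^ 3 ⊗ b ^ 2} {⊖ (c ⊗ d ⊗ e)}
    (norm-⊗-≤ {a ^ 3} {b ^ 2} (norm-^ i {a} 3 a≤) (norm-^ i {b} 2 b≤))
    (norm-⊖-≤ {c ⊗ d ⊗ e} (norm-⊗-≤ {c ⊗ d} {e} (norm-⊗-≤ {c} {d} c≤ d≤) e≤))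
    where open Truncation i using (_^_)

  equation : (S A B C D E : ℂ) {a b c d e : ℕ → List ℚ} →
    (∀ i → value i S ≡ ev i (S.family i)) → (∀ i → value i A ≡ ev i (a i)) → (∀ i → value i B ≡ ev i (b i)) →
    (∀ i → value i C ≡ ev i (c i)) → (∀ i → value i D ≡ ev i (d i)) → (∀ i → value i E ≡ ev i (e i)) →
    (∀ i → norm (a i) ≤ G-limit) → (∀ i → norm (b i) ≤ G-limit) → (∀ i → norm (c i) ≤ G-limit) →
    (∀ i → norm (d i) ≤ G-limit) → (∀ i → norm (e i) ≤ G-limit) →
    (∀ i → Agree i (Truncation.ι i (+ 6) ⊗ S.family i) (rhs i (a i) (b i) (c i) (d i) (e i))) →
    Defs.fromℤ (+ 6) Defs.* S Defs.≈ A Defs.^ 3 Defs.* B Defs.^ 2 Defs.- C Defs.* D Defs.* E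
  equation S A B C D E {a} {b} {c} {d} {e} S≡ A≡ B≡ C≡ D≡ E≡ a≤ b≤ c≤ d≤ e≤ agreement =
    agree⇒≈ (Defs.fromℤ (+ 6) Defs.* S) ((A Defs.^ 3) Defs.* (B Defs.^ 2) Defs.- C Defs.* D Defs.* E)
      left right (L ℚ.+ R)
      (λ i → value-lhs i S (S.family i) (S≡ i))
      (λ i → value-rhs i (A Defs.^ 3) (B Defs.^ 2) C D E
        (Truncation._^_ i (a i) 3) (Truncation._^_ i (b i) 2) (c i) (d i) (e i)
        (value-power i A (a i) 3 (A≡ i)) (value-power i B (b i) 2 (B≡ i)) (C≡ i) (D≡ i) (E≡ i))
      -- `agree⇒≈` takes one bound for both families; since norms are nonnegative, `L + R` dominates
      -- each side.
      (λ i → ℚ.≤-trans (left≤L i) (subst (_≤ L ℚ.+ R) (ℚ.+-identityʳ L) (ℚ.+-monoʳ-≤ L (ℚ.≤-trans (0≤norm (right 0)) (right≤R 0)))))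
      (λ i → ℚ.≤-trans (right≤R i) (subst (_≤ L ℚ.+ R) (ℚ.+-identityˡ R) (ℚ.+-monoˡ-≤ R (ℚ.≤-trans (0≤norm (left 0)) (left≤L 0)))))
      agreement
    where
    left right : ℕ → List ℚ
    left i = Truncation.ι i (+ 6) ⊗ S.family i
    right i = rhs i (a i) (b i) (c i) (d i) (e i)

    L R : ℚ
    L = ιℚ (+ 6) ℚ.* (W ℚ.+ W)
    R = G-limit ^ℚ 3 ℚ.* G-limit ^ℚ 2 ℚ.+ G-limit ℚ.* G-limit ℚ.* G-limit

    left≤L : ∀ i → norm (left i) ≤ L
    left≤L i = norm-⊗-≤ {Truncation.ι i (+ 6)} {S.family i} (norm-ι i (+ 6)) (S.norm-∑h i i i)

    right≤R : ∀ i → norm (right i) ≤ R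
    right≤R i = norm-rhs i {a i} {b i} {c i} {d i} {e i} {G-limit} (a≤ i) (b≤ i) (c≤ i) (d≤ i) (e≤ i)

  identity : ∀ {f z₁ w₁ z₂ w₂ z₃ w₃ z₄ w₄ z₅ w₅ a b c d e} →
    SeriesLimit f → ProductLimit z₁ w₁ a → ProductLimit z₂ w₂ b →
    ProductLimit z₃ w₃ c → ProductLimit z₄ w₄ d → ProductLimit z₅ w₅ e →
    (∀ i → Agree i (Truncation.ι i (+ 6) ⊗ S.family i) (rhs i (a i) (b i) (c i) (d i) (e i))) →
    ∃[ S ] ∃[ A ] ∃[ B ] ∃[ C ] ∃[ D ] ∃[ E ]
      ( Defs.HasSumℤ f S × (Defs.⟨ z₁ ⨾ w₁ ⟩∞≔ A) × (Defs.⟨ z₂ ⨾ w₂ ⟩∞≔ B) × (Defs.⟨ z₃ ⨾ w₃ ⟩∞≔ C)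
      × (Defs.⟨ z₄ ⨾ w₄ ⟩∞≔ D) × (Defs.⟨ z₅ ⨾ w₅ ⟩∞≔ E)
      × (Defs.fromℤ (+ 6) Defs.* S Defs.≈ A Defs.^ 3 Defs.* B Defs.^ 2 Defs.- C Defs.* D Defs.* E) )
  identity {a = a} {b} {c} {d} {e} (S , hS , S≡) (A , hA , A≡ , a≤) (B , hB , B≡ , b≤) (C , hC , C≡ , c≤) (D , hD , D≡ , d≤) (E , hE , E≡ , e≤) agreement =
    S , A , B , C , D , E , hS , hA , hB , hC , hD , hE ,
    equation S A B C D E {a} {b} {c} {d} {e} S≡ A≡ B≡ C≡ D≡ E≡ a≤ b≤ c≤ d≤ e≤ agreement

  -- The powers of q are named, because comparing types that mention q ^ 2 is slow.
  identity-with-powers : (qᵉ : ℤ → ℂ) (q² q³ : ℂ) → (∀ n → qᵉ n ≡ q Defs.^ Defs.exponent n) →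
    q² ≡ q Defs.^ 2 → q³ ≡ q Defs.^ 3 →
    ∃[ S ] ∃[ A ] ∃[ B ] ∃[ C ] ∃[ D ] ∃[ E ]
      ( Defs.HasSumℤ (λ n → Defs.fromℤ n Defs.* qᵉ n) S × (Defs.⟨ q ⨾ q ⟩∞≔ A) × (Defs.⟨ q ⨾ q² ⟩∞≔ B) × (Defs.⟨ Defs.- q ⨾ q³ ⟩∞≔ C)
      × (Defs.⟨ Defs.- q² ⨾ q³ ⟩∞≔ D) × (Defs.⟨ q³ ⨾ q³ ⟩∞≔ E)
      × (Defs.fromℤ (+ 6) Defs.* S Defs.≈ A Defs.^ 3 Defs.* B Defs.^ 2 Defs.- C Defs.* D Defs.* E) )
  identity-with-powers qᵉ q² q³ qᵉ≡ q²≡ q³≡ = identity {λ n → Defs.fromℤ n Defs.* qᵉ n} {q} {q} {q} {q²} {Defs.- q} {q³} {Defs.- q²} {q³} {q³} {q³}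
    {λ n → ⟨_⨾_⟩ n x̂ x̂ n} {λ n → ⟨_⨾_⟩ n x̂ (x̂^ 2) n} {λ n → ⟨_⨾_⟩ n (⊖ x̂) (x̂^ 3) n}
    {λ n → ⟨_⨾_⟩ n (⊖ x̂^ 2) (x̂^ 3) n} {λ n → ⟨_⨾_⟩ n (x̂^ 3) (x̂^ 3) n}
    (series-limit (λ n → Defs.fromℤ n Defs.* qᵉ n) λ i N n → S.value-monomial i N n (qᵉ n)
      (trans (cong (value i) (qᵉ≡ n)) (S.value-power i N n (Defs.exponent n) (exponent≡pentagonal n))))
    (product-limit x̂ x̂ x̂≤1 norm-x̂ x̂-nilpotent q q value-q value-q)
    (product-limit x̂ (x̂^ 2) x̂≤1 (norm-x̂^ 1) (λ N → Truncation.qᵏ-nilpotent N 1) q q² value-q value-q²)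
    (product-limit (⊖ x̂) (x̂^ 3) (norm-⊖-≤ {x̂} x̂≤1) (norm-x̂^ 2) (λ N → Truncation.qᵏ-nilpotent N 2)
      (Defs.- q) q³ (value-negative q x̂ value-q) value-q³)
    (product-limit (⊖ x̂^ 2) (x̂^ 3) (norm-⊖-≤ {x̂^ 2} (norm-x̂^-1 1)) (norm-x̂^ 2) (λ N → Truncation.qᵏ-nilpotent N 2)
      (Defs.- q²) q³ (value-negative q² (x̂^ 2) value-q²) value-q³)
    (product-limit (x̂^ 3) (x̂^ 3) (norm-x̂^-1 2) (norm-x̂^ 2) (λ N → Truncation.qᵏ-nilpotent N 2)
      q³ q³ value-q³ value-q³)
    Truncation.quintuple-derivative
    where
    value-q² : ∀ i → value i q² ≡ ev i (x̂^ 2)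
    value-q² i = trans (cong (value i) q²≡) (value-q^ i 2)
    value-q³ : ∀ i → value i q³ ≡ ev i (x̂^ 3)
    value-q³ i = trans (cong (value i) q³≡) (value-q^ i 3)

-- Choice of the radius

module Radius (q : ℂ) (∣q∣<1 : Defs.∣ q ∣< 1ℚ) where
  open import Data.Rational using (_≤_; _<_)
  open ℚ-Lemmas using (0≤+; 0≤*; 0<*; 0≤square; ≤-from-difference; difference-≥0; difference->0)
  open ℚ-Solver.+-*-Solver
  open ℚ.≤-Reasoning

  -- Eventually `∣q∣² + δ ≤ 1`, while `∣q∣² ≤ r⁴` is required. Bernoulli's inequality
  -- `(1 - x)⁴ ≥ 1 - 4 x` suggests `x = δ / 4`.
  δ x r : ℚ
  δ = proj₁ (proj₂ ∣q∣<1)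
  x = ½ ℚ.* ½ ℚ.* δ
  r = 1ℚ ℚ.- x

  0<δ : 0ℚ < δ
  0<δ = proj₁ (proj₂ (proj₂ ∣q∣<1))

  K : ℕ
  K = proj₁ (proj₂ (proj₂ (proj₂ ∣q∣<1)))

  modulus : ℕ → ℚ
  modulus i = approx Defs.∣ q ∣² i

  modulus≤ : ∀ i → K ℕ.≤ i → modulus i ℚ.+ δ ≤ 1ℚ
  modulus≤ i K≤i = subst (modulus i ℚ.+ δ ≤_) (ℚ.*-identityʳ 1ℚ) (proj₂ (proj₂ (proj₂ (proj₂ ∣q∣<1))) i K≤i)

  0≤modulus : ∀ i → 0ℚ ≤ modulus i
  0≤modulus i = subst (0ℚ ≤_) (sym (Closeness.modulus-approx q i))
    (0≤+ (0≤square (approx (Defs.re q) i)) (0≤square (approx (Defs.im q) i)))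

  0<x : 0ℚ < x
  0<x = 0<* (ℚ.positive⁻¹ (½ ℚ.* ½)) 0<δ

  x<1 : x < 1ℚ
  x<1 = begin-strict
    ½ ℚ.* ½ ℚ.* δ      ≤⟨ ℚ-Lemmas.*-monoˡ-≤ (ℚ.nonNegative⁻¹ (½ ℚ.* ½)) δ≤1 ⟩
    ½ ℚ.* ½ ℚ.* 1ℚ     <⟨ subst (ℚ._< 1ℚ) refl (ℚ.*<* (ℤ.+<+ (ℕ.s≤s (ℕ.s≤s ℕ.z≤n)))) ⟩
    1ℚ                 ∎
    where
    δ≤1 : δ ≤ 1ℚ
    δ≤1 = begin
      δ                  ≡⟨ ℚ.+-identityˡ δ ⟨
      0ℚ ℚ.+ δ           ≤⟨ ℚ.+-monoˡ-≤ δ (0≤modulus K) ⟩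
      modulus K ℚ.+ δ    ≤⟨ modulus≤ K ℕ.≤-refl ⟩
      1ℚ                 ∎

  0<r : 0ℚ < r
  0<r = difference->0 x<1

  r<1 : r < 1ℚ
  r<1 = subst₂ _<_ (solve 1 (λ x → (con 1ℚ :- x) :+ con 0ℚ := con 1ℚ :- x) refl x)
    (solve 1 (λ x → (con 1ℚ :- x) :+ x := con 1ℚ) refl x) (ℚ.+-monoʳ-< r 0<x)

  q-bounded : ∀ i → K ℕ.≤ i → ℚ[i].Bounded (ℚ[i].value i q) (r ℚ.* r)
  q-bounded i K≤i = subst (λ z → ℚ[i].Bounded z (r ℚ.* r)) (sym (ℚ[i].value-def i q))
    (ℚ[i].bounded (0≤square r) (subst (_≤ r ℚ.* r ℚ.* (r ℚ.* r)) (Closeness.modulus-approx q i) bound))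
    where
    m = modulus i
    -- (1 - x)⁴ - (1 - 4 x) = x² (2 + (2 - x)²)
    bound : m ≤ r ℚ.* r ℚ.* (r ℚ.* r)
    bound = ≤-from-difference (subst (0ℚ ≤_)
      (solve 2 (λ m d → let x = con ½ :* con ½ :* d ; r = con 1ℚ :- x in
          (con 1ℚ :- (m :+ d)) :+ x :* x :* ((con 1ℚ :+ con 1ℚ) :+ (con 1ℚ :+ con 1ℚ :- x) :* (con 1ℚ :+ con 1ℚ :- x))
          := r :* r :* (r :* r) :- m) refl m δ)
      (0≤+ (difference-≥0 (modulus≤ i K≤i)) (0≤* (0≤square x)
        (0≤+ (ℚ.nonNegative⁻¹ (1ℚ ℚ.+ 1ℚ)) (0≤square (1ℚ ℚ.+ 1ℚ ℚ.- x))))))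

open import Defs using (0<∣_∣; ∣_∣<_; HasSumℤ; fromℤ; exponent; _*_; _^_; ⟨_⨾_⟩∞≔_; -_; _-_; _≈_)

theorem2p16 :
    (q : ℂ) → 0<∣ q ∣ → ∣ q ∣< 1ℚ →
    ∃[ S ] ∃[ A ] ∃[ B ] ∃[ C ] ∃[ D ] ∃[ E ]
      ( HasSumℤ (λ n → fromℤ n * q ^ exponent n) S
      × (⟨ q ⨾ q ⟩∞≔ A)
      × (⟨ q ⨾ q ^ 2 ⟩∞≔ B)
      × (⟨ - q ⨾ q ^ 3 ⟩∞≔ C)
      × (⟨ - (q ^ 2) ⨾ q ^ 3 ⟩∞≔ D)
      × (⟨ q ^ 3 ⨾ q ^ 3 ⟩∞≔ E)
      × (fromℤ (+ 6) * S ≈ A ^ 3 * B ^ 2 - C * D * E) )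
theorem2p16 q _ ∣q∣<1 = identity-with-powers _ _ _ (λ _ → refl) refl refl
  where
  open Radius q ∣q∣<1
  open Convergence q r 0<r r<1 K q-bounded
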